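{- There is an absolute constant $C>0$ such that for every $n$ and every graph $H\subseteq K_n$ with at least one edge, the uniform probability measure $\nu_H$ on the copies of $H$ in $K_n$ is $Cq_H\log(2e(H))$-spread.
   Context: All graphs are finite and simple; $e(G)$ is the number of edges of $G$. A graph is nonempty if it has at least one edge. Isolated vertices are omitted, so a subgraph is identified with its edge set together with the endpoints of these edges; subgraphs need not be induced or connected. Logarithms are natural. A copy of $H$ in $K_n$ is a subgraph of $K_n$ isomorphic to $H$, and $N_I(G)$ denotes the number of copies of $I$ in $G$ (subgraphs of $G$ isomorphic to $I$). $\nu_H$ is the uniform probability measure on the copies of $H$ in $K_n$. For nonempty $H\subseteq K_n$, $$q_H:=\max_{\varnothing\ne I\subseteq H}N_I(K_n)^{ -1/e(I)},$$ the maximum being over all nonempty subgraphs $I$ of $H$. A probability measure $\mu$ on subgraphs of $K_n$ is $a$-spread if $\mu(\{S:A\subseteq E(S)\})\le a^{|A|}$ for every nonempty edge set $A\subseteq E(K_n)$. -}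

module Defs where

import Algebra.Definitions.RawSemiring as RawSemiringDefs
open import Data.Bool.Base using (true; false; if_then_else_)
open import Data.Fin.Base using (Fin; zero; suc)
import Data.Fin.Base as Fin
import Data.Fin.Properties as Fin
open import Data.Fin.Subset using (Subset; inside; outside; ∣_∣; _∈_; _⊆_; Nonempty; ⊤)
open import Data.Fin.Subset.Properties using (_∈?_; _⊆?_; nonempty?; ⊆-max)
import Data.Integer.Base as ℤ
import Data.Integer.Properties as ℤ
open import Data.List.Base
  using (List; []; _∷_; _++_; length; map; filter; foldr; applyUpTo; allFin; cartesianProduct)
import Data.List.Base as List
import Data.List.Membership.Propositional as List
open import Data.List.Membership.Propositional.Properties
  using (∈-map⁺; ∈-++⁺ˡ; ∈-++⁺ʳ; ∈-filter⁺)
open import Data.List.Relation.Unary.Any using (here; there)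
open import Data.Nat.Base as ℕ using (ℕ; zero; suc; _!)
open import Data.Nat.Properties using (_!≢0)
import Data.Nat.Properties as ℕ
open import Data.Product.Base using (∃; _×_; _,_; proj₁)
import Data.Product.Properties as Product
open import Data.Rational.Base
  using (ℚ; 0ℚ; 1ℚ; _+_; _*_; _/_; _≤_; _<_; _⊔_; positive; toℚᵘ; +-*-rawSemiring)
import Data.Rational.Properties as ℚ
import Data.Rational.Unnormalised.Base as ᵘ
import Data.Rational.Unnormalised.Properties as ᵘ
open import Data.Sum.Base using (_⊎_)
open import Data.Vec.Base using (Vec; []; _∷_; lookup)
import Data.Vec.Base as Vec
import Data.Vec.Properties as Vec
open import Level using (0ℓ)
open import Relation.Binary.PropositionalEquality
  using (_≡_; refl; sym; trans; cong; cong₂; subst; subst₂; module ≡-Reasoning)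
open import Relation.Nullary.Decidable
  using (Dec; yes; no; does; map′; _×-dec_; _⊎-dec_; _→-dec_)
open import Relation.Unary using (Pred; Decidable)

open RawSemiringDefs +-*-rawSemiring using (_^_)

fromℕ : ℕ → ℚ
fromℕ k = ℤ.+ k / 1

-- A nonnegative real is given by its open upper Dedekind cut, the set of
-- rationals strictly above it.  Inhabitedness rules out +∞.
record ℝ≥0 : Set₁ where
  field
    Above     : Pred ℚ 0ℓ
    >0        : ∀ {r} → Above r → 0ℚ < r
    upward    : ∀ {r s} → Above r → r ≤ s → Above s
    rounded   : ∀ {r} → Above r → ∃ λ s → s < r × Above s
    inhabited : ∃ Above

open ℝ≥0 public using (Above)

infix 4 _≤ᴿ_

_≤ᴿ_ : ℚ → ℝ≥0 → Set
p ≤ᴿ x = ∀ r → Above x r → p ≤ r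

Positiveᴿ : ℝ≥0 → Set
Positiveᴿ x = ∃ λ ε → 0ℚ < ε × ε ≤ᴿ x

inf : (P : Pred ℚ 0ℓ) → (∀ {s} → P s → 0ℚ ≤ s) → ∃ P → ℝ≥0
inf P nonneg (s , Ps) = record
  { Above     = λ r → ∃ λ s → P s × s < r
  ; >0        = λ (_ , Ps , s<r) → ℚ.≤-<-trans (nonneg Ps) s<r
  ; upward    = λ (s , Ps , s<r) r≤t → s , Ps , ℚ.<-≤-trans s<r r≤t
  ; rounded   = λ (s , Ps , s<r) →
                  let (t , s<t , t<r) = ℚ.<-dense s<r in t , t<r , s , Ps , s<t
  ; inhabited = s + 1ℚ , s , Ps ,
                  subst (_< s + 1ℚ) (ℚ.+-identityʳ s) (ℚ.+-monoʳ-< s 0<1)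
  }
  where
  0<1 : 0ℚ < 1ℚ
  0<1 = ℚ.positive⁻¹ 1ℚ

fromℚ : (p : ℚ) → 0ℚ ≤ p → ℝ≥0
fromℚ p 0≤p = inf (p ≡_) (λ p≡s → subst (0ℚ ≤_) p≡s 0≤p) (p , refl)

0ᴿ 1ᴿ : ℝ≥0
0ᴿ = fromℚ 0ℚ ℚ.≤-refl
1ᴿ = fromℚ 1ℚ (ℚ.nonNegative⁻¹ 1ℚ)

infixl 7 _*ᴿ_
infixl 6 _⊔ᴿ_
infixr 8 _^ᴿ_

_*ᴿ_ : ℝ≥0 → ℝ≥0 → ℝ≥0
x *ᴿ y = inf (λ r → ∃ λ s → ∃ λ t → Above x s × Above y t × r ≡ s * t)
             nonneg
             (let (s , x<s) = ℝ≥0.inhabited x ; (t , y<t) = ℝ≥0.inhabited y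
              in s * t , s , t , x<s , y<t , refl)
  where
  nonneg : ∀ {r} → (∃ λ s → ∃ λ t → Above x s × Above y t × r ≡ s * t) → 0ℚ ≤ r
  nonneg (s , t , x<s , y<t , refl) =
    ℚ.<⇒≤ (ℚ.positive⁻¹ (s * t)
      {{ℚ.pos*pos⇒pos s {{positive (ℝ≥0.>0 x x<s)}} t {{positive (ℝ≥0.>0 y y<t)}}}})

_^ᴿ_ : ℝ≥0 → ℕ → ℝ≥0
x ^ᴿ zero  = 1ᴿ
x ^ᴿ suc k = x *ᴿ x ^ᴿ k

_⊔ᴿ_ : ℝ≥0 → ℝ≥0 → ℝ≥0
x ⊔ᴿ y = inf (λ s → Above x s × Above y s)
             (λ (x<s , _) → ℚ.<⇒≤ (ℝ≥0.>0 x x<s))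
             (let (s , x<s) = ℝ≥0.inhabited x ; (t , y<t) = ℝ≥0.inhabited y
              in s ⊔ t , ℝ≥0.upward x x<s (ℚ.p≤p⊔q s t) , ℝ≥0.upward y y<t (ℚ.p≤q⊔p s t))

-- The starting value 0 does not affect the maximum of a nonempty list of
-- nonnegative reals.
maxᴿ : List ℝ≥0 → ℝ≥0
maxᴿ = foldr _⊔ᴿ_ 0ᴿ

1^e≡1 : ∀ e → 1ℚ ^ e ≡ 1ℚ
1^e≡1 zero    = refl
1^e≡1 (suc e) = trans (ℚ.*-identityˡ (1ℚ ^ e)) (1^e≡1 e)

fromℕ-suc : ∀ k → fromℕ (suc k) ≡ 1ℚ + fromℕ k
fromℕ-suc k = sym (ℚ.toℚᵘ-injective (begin
  toℚᵘ (1ℚ + fromℕ k)        ≈⟨ ℚ.toℚᵘ-homo-+ 1ℚ (fromℕ k) ⟩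
  toℚᵘ 1ℚ ᵘ.+ toℚᵘ (fromℕ k) ≈⟨ ᵘ.+-congʳ (toℚᵘ 1ℚ) (ℚ.toℚᵘ-fromℚᵘ (ᵘ.mkℚᵘ (ℤ.+ k) 0)) ⟩
  ᵘ.1ℚᵘ ᵘ.+ ᵘ.mkℚᵘ (ℤ.+ k) 0 ≈⟨ ᵘ.*≡* (cong (ℤ._* ℤ.+ 1) (cong (λ z → ℤ.+ 1 ℤ.+ z) (ℤ.*-identityʳ (ℤ.+ k)))) ⟩
  ᵘ.mkℚᵘ (ℤ.+ suc k) 0       ≈⟨ ᵘ.≃-sym (ℚ.toℚᵘ-fromℚᵘ (ᵘ.mkℚᵘ (ℤ.+ suc k) 0)) ⟩
  toℚᵘ (fromℕ (suc k))       ∎))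
  where
  open ᵘ.≃-Reasoning

0≤fromℕ : ∀ k → 0ℚ ≤ fromℕ k
0≤fromℕ zero    = ℚ.≤-refl
0≤fromℕ (suc k) = subst (0ℚ ≤_) (sym (fromℕ-suc k))
  (ℚ.+-mono-≤ (ℚ.nonNegative⁻¹ 1ℚ) (0≤fromℕ k))

1≤fromℕ : ∀ k .{{_ : ℕ.NonZero k}} → 1ℚ ≤ fromℕ k
1≤fromℕ (suc k) = subst (1ℚ ≤_) (sym (fromℕ-suc k))
  (subst (_≤ 1ℚ + fromℕ k) (ℚ.+-identityʳ 1ℚ) (ℚ.+-monoʳ-≤ 1ℚ (0≤fromℕ k)))

-- N ^-1/ e is the real number N^(-1/e), for N, e ≥ 1: the least s ≥ 0 with N s^e ≥ 1.
infix 8 _^-1/_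

_^-1/_ : (N : ℕ) .{{_ : ℕ.NonZero N}} → ℕ → ℝ≥0
N ^-1/ e = inf (λ s → 0ℚ ≤ s × 1ℚ ≤ fromℕ N * s ^ e) proj₁
  (1ℚ , ℚ.nonNegative⁻¹ 1ℚ ,
   subst (1ℚ ≤_) (sym (trans (cong (fromℕ N *_) (1^e≡1 e)) (ℚ.*-identityʳ (fromℕ N)))) (1≤fromℕ N))

sumℚ : List ℚ → ℚ
sumℚ = foldr _+_ 0ℚ

expTerm : ℚ → ℕ → ℚ
expTerm s j = s ^ j * ((ℤ.+ 1 / j !) {{j !≢0}})

-- The partial sum ∑ s^j/j! over j < k.
expSum : ℚ → ℕ → ℚ
expSum s k = sumℚ (applyUpTo (expTerm s) k)

-- The natural logarithm of m ≥ 1 (junk value 0 at m = 0): the least s ≥ 0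
-- with m ≤ exp s.
-- (The cut depends only on the infimum, so it does not matter that the partial
-- sums reach m only for s slightly above log m.)
log : ℕ → ℝ≥0
log m = inf (λ s → 0ℚ ≤ s × ∃ λ k → fromℕ m ≤ expSum s k) proj₁
  (fromℕ m , 0≤fromℕ m , 2 , m≤1+m)
  where
  open ≡-Reasoning
  eq : expSum (fromℕ m) 2 ≡ 1ℚ + fromℕ m
  eq = cong (1ℚ +_) (begin
    fromℕ m * 1ℚ * 1ℚ + 0ℚ ≡⟨ ℚ.+-identityʳ _ ⟩
    fromℕ m * 1ℚ * 1ℚ      ≡⟨ ℚ.*-identityʳ _ ⟩
    fromℕ m * 1ℚ           ≡⟨ ℚ.*-identityʳ _ ⟩
    fromℕ m                ∎)
  m≤1+m : fromℕ m ≤ expSum (fromℕ m) 2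
  m≤1+m = subst₂ _≤_ (ℚ.+-identityˡ (fromℕ m)) (sym eq)
    (ℚ.+-monoˡ-≤ (fromℕ m) (ℚ.nonNegative⁻¹ 1ℚ))

edges : ∀ n → List (Fin n × Fin n)
edges n = filter (λ (i , j) → i Fin.<? j) (cartesianProduct (allFin n) (allFin n))

-- A set of edges of the complete graph, as a set of positions in `edges n`.
EdgeSet : ℕ → Set
EdgeSet n = Subset (length (edges n))

-- A subgraph of the complete graph without isolated vertices is determined by
-- its edges; its vertices are the endpoints of these edges.
record Graph (n : ℕ) : Set where
  constructor graph
  field E : EdgeSet n

open Graph public

K : ∀ n → Graph n
K n = graph ⊤

e : ∀ {n} → Graph n → ℕ
e G = ∣ E G ∣

NonemptyGraph : ∀ {n} → Graph n → Set
NonemptyGraph G = Nonempty (E G)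

infix 4 _⊆ᴳ_

_⊆ᴳ_ : ∀ {n} → Graph n → Graph n → Set
G ⊆ᴳ H = E G ⊆ E H

module _ {n : ℕ} where

  Adj : Graph n → Fin n → Fin n → Set
  Adj G u v = ∃ λ k → k ∈ E G × (List.lookup (edges n) k ≡ (u , v) ⊎ List.lookup (edges n) k ≡ (v , u))

  IsVertex : Graph n → Fin n → Set
  IsVertex G u = ∃ λ v → Adj G u v

  -- The values of f outside the vertex set of G play no role.
  record IsIsomorphism (G H : Graph n) (f : Fin n → Fin n) : Set where
    constructor isIsomorphism
    field
      maps       : ∀ u → IsVertex G u → IsVertex H (f u)
      injective  : ∀ u v → IsVertex G u → IsVertex G v → f u ≡ f v → u ≡ v
      surjective : ∀ w → IsVertex H w → ∃ λ u → IsVertex G u × f u ≡ w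
      preserves  : ∀ u v → IsVertex G u → IsVertex G v → Adj G u v → Adj H (f u) (f v)
      reflects   : ∀ u v → IsVertex G u → IsVertex G v → Adj H (f u) (f v) → Adj G u v

  infix 4 _≅_ _≅?_

  _≅_ : Graph n → Graph n → Set
  G ≅ H = ∃ λ (f : Vec (Fin n) n) → IsIsomorphism G H (lookup f)

  adj? : ∀ G u v → Dec (Adj G u v)
  adj? G u v = Fin.any? λ k → (k ∈? E G) ×-dec ((List.lookup (edges n) k ≟ (u , v)) ⊎-dec (List.lookup (edges n) k ≟ (v , u)))
    where _≟_ = Product.≡-dec Fin._≟_ Fin._≟_

  isVertex? : ∀ G u → Dec (IsVertex G u)
  isVertex? G u = Fin.any? (adj? G u)

  isIsomorphism? : ∀ G H f → Dec (IsIsomorphism G H f)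
  isIsomorphism? G H f = map′
    (λ (a , b , c , d , e) → isIsomorphism a b c d e)
    (λ (isIsomorphism a b c d e) → a , b , c , d , e)
    (Fin.all? (λ u → isVertex? G u →-dec isVertex? H (f u))
     ×-dec Fin.all? (λ u → Fin.all? λ v → isVertex? G u →-dec (isVertex? G v →-dec
             (f u Fin.≟ f v →-dec u Fin.≟ v)))
     ×-dec Fin.all? (λ w → isVertex? H w →-dec
             Fin.any? λ u → isVertex? G u ×-dec f u Fin.≟ w)
     ×-dec Fin.all? (λ u → Fin.all? λ v → isVertex? G u →-dec (isVertex? G v →-dec
             (adj? G u v →-dec adj? H (f u) (f v))))
     ×-dec Fin.all? (λ u → Fin.all? λ v → isVertex? G u →-dec (isVertex? G v →-dec
             (adj? H (f u) (f v) →-dec adj? G u v))))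

  anyVec? : ∀ {m} {P : Pred (Vec (Fin n) m) 0ℓ} → Decidable P → Dec (∃ P)
  anyVec? {zero}  P? = map′ (λ p → [] , p) (λ { ([] , p) → p }) (P? [])
  anyVec? {suc m} P? = map′ (λ (x , xs , p) → x ∷ xs , p) (λ { (x ∷ xs , p) → x , xs , p })
    (Fin.any? λ x → anyVec? λ xs → P? (x ∷ xs))

  _≅?_ : ∀ G H → Dec (G ≅ H)
  G ≅? H = anyVec? λ f → isIsomorphism? G H (lookup f)

  ≅-refl : ∀ G → G ≅ G
  ≅-refl G = Vec.allFin n , isIsomorphism
    (λ u → subst (IsVertex G) (sym (id≗ u)))
    (λ u v _ _ eq → trans (sym (id≗ u)) (trans eq (id≗ v)))
    (λ w p → w , p , id≗ w)
    (λ u v _ _ → subst₂ (Adj G) (sym (id≗ u)) (sym (id≗ v)))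
    (λ u v _ _ → subst₂ (Adj G) (id≗ u) (id≗ v))
    where
    id≗ : ∀ u → lookup (Vec.allFin n) u ≡ u
    id≗ = Vec.lookup-allFin

-- All subsets of Fin m, each listed once.
subsets : ∀ m → List (Subset m)
subsets zero    = [] ∷ []
subsets (suc m) = map (outside ∷_) (subsets m) ++ map (inside ∷_) (subsets m)

∈-subsets : ∀ {m} (p : Subset m) → p List.∈ subsets m
∈-subsets []            = here refl
∈-subsets (outside ∷ p) = ∈-++⁺ˡ (∈-map⁺ (outside ∷_) (∈-subsets p))
∈-subsets (inside ∷ p)  = ∈-++⁺ʳ (map (outside ∷_) (subsets _)) (∈-map⁺ (inside ∷_) (∈-subsets p))

graphs : ∀ n → List (Graph n)
graphs n = map graph (subsets (length (edges n)))

module _ {n : ℕ} where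

  IsCopy : (I G S : Graph n) → Set
  IsCopy I G S = S ⊆ᴳ G × S ≅ I

  isCopy? : ∀ I G → Decidable (IsCopy I G)
  isCopy? I G S = (E S ⊆? E G) ×-dec (S ≅? I)

  copies : (I G : Graph n) → List (Graph n)
  copies I G = filter (isCopy? I G) (graphs n)

  #copies : (I G : Graph n) → ℕ
  #copies I G = length (copies I G)

  #copies-nonZero : ∀ I → ℕ.NonZero (#copies I (K n))
  #copies-nonZero I = nonZero (∈-filter⁺ (isCopy? I (K n)) (∈-map⁺ graph (∈-subsets (E I))) (⊆-max (E I) , ≅-refl I))
    where
    nonZero : ∀ {xs : List (Graph n)} → I List.∈ xs → ℕ.NonZero (length xs)
    nonZero (here _)  = _
    nonZero (there _) = _

  q : Graph n → ℝ≥0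
  q H = maxᴿ (map (λ I → let instance _ = #copies-nonZero I in #copies I (K n) ^-1/ e I)
                  (filter (λ I → nonempty? (E I) ×-dec (E I ⊆? E H)) (graphs n)))

record ProbabilityMeasure (n : ℕ) : Set where
  field
    mass   : Graph n → ℚ
    nonneg : ∀ S → 0ℚ ≤ mass S
    total  : sumℚ (map mass (graphs n)) ≡ 1ℚ

  measure : {P : Pred (Graph n) 0ℓ} → Decidable P → ℚ
  measure P? = sumℚ (map mass (filter P? (graphs n)))

open ProbabilityMeasure public using (mass; measure)

Spread : ∀ {n} → ProbabilityMeasure n → ℝ≥0 → Set
Spread {n} μ a = ∀ (A : EdgeSet n) → Nonempty A → measure μ (λ S → A ⊆? E S) ≤ᴿ a ^ᴿ ∣ A ∣

sum-indicator : ∀ {A : Set} {P : Pred A 0ℓ} (P? : Decidable P) (p : ℚ) xs →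
  sumℚ (map (λ x → if does (P? x) then p else 0ℚ) xs) ≡ fromℕ (length (filter P? xs)) * p
sum-indicator P? p [] = sym (ℚ.*-zeroˡ p)
sum-indicator P? p (x ∷ xs) with P? x
... | no  _ = trans (ℚ.+-identityˡ _) (sum-indicator P? p xs)
... | yes _ = begin
  p + sumℚ (map (λ x → if does (P? x) then p else 0ℚ) xs)
    ≡⟨ cong₂ _+_ (sym (ℚ.*-identityˡ p)) (sum-indicator P? p xs) ⟩
  1ℚ * p + fromℕ l * p  ≡⟨ sym (ℚ.*-distribʳ-+ p 1ℚ (fromℕ l)) ⟩
  (1ℚ + fromℕ l) * p    ≡⟨ cong (_* p) (sym (fromℕ-suc l)) ⟩
  fromℕ (suc l) * p     ∎
  where
  open ≡-Reasoning
  l = length (filter P? xs)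

fromℕ*1/ : ∀ k .{{_ : ℕ.NonZero k}} → fromℕ k * (ℤ.+ 1 / k) ≡ 1ℚ
fromℕ*1/ (suc k) = ℚ.toℚᵘ-injective (begin
  toℚᵘ (fromℕ (suc k) * (ℤ.+ 1 / suc k))
    ≈⟨ ℚ.toℚᵘ-homo-* (fromℕ (suc k)) (ℤ.+ 1 / suc k) ⟩
  toℚᵘ (fromℕ (suc k)) ᵘ.* toℚᵘ (ℤ.+ 1 / suc k)
    ≈⟨ ᵘ.*-cong (ℚ.toℚᵘ-fromℚᵘ (ᵘ.mkℚᵘ (ℤ.+ suc k) 0)) (ℚ.toℚᵘ-fromℚᵘ (ᵘ.mkℚᵘ (ℤ.+ 1) k)) ⟩
  ᵘ.mkℚᵘ (ℤ.+ suc k) 0 ᵘ.* ᵘ.mkℚᵘ (ℤ.+ 1) k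
    ≈⟨ ᵘ.*-inverseʳ (ᵘ.mkℚᵘ (ℤ.+ suc k) 0) ⟩
  ᵘ.1ℚᵘ ∎)
  where open ᵘ.≃-Reasoning

0≤indicator : ∀ b {p} → 0ℚ ≤ p → 0ℚ ≤ (if b then p else 0ℚ)
0≤indicator true  0≤p = 0≤p
0≤indicator false 0≤p = ℚ.≤-refl

0≤1/ : ∀ k .{{_ : ℕ.NonZero k}} → 0ℚ ≤ ℤ.+ 1 / k
0≤1/ k = ℚ.nonNegative⁻¹ (ℤ.+ 1 / k) {{ℚ.normalize-nonNeg 1 k}}

ν : ∀ {n} → Graph n → ProbabilityMeasure n
ν {n} H = record
  { mass   = λ S → if does (isCopy? H (K n) S) then ℤ.+ 1 / N else 0ℚ
  ; nonneg = λ S → 0≤indicator (does (isCopy? H (K n) S)) (0≤1/ N)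
  ; total  = trans (sum-indicator (isCopy? H (K n)) (ℤ.+ 1 / N) (graphs n)) (fromℕ*1/ N)
  }
  where
  N = #copies H (K n)
  instance _ = #copies-nonZero H

{-# OPTIONS --safe #-}
-- Write N_A(G) for the number of copies of A in G, N = e(H), and g(N) for the harmonic number,
-- which is at most 4 log (2N).  By double counting, ν_H(A ⊆ S) = N_A(H) / N_A(K_n), so it is enough
-- to show N_A(H) ≤ N_A(K_n) (3072 q g(N))^e(A) whenever N_J(K_n) q^e(J) ≥ 1 for all J ⊆ H.  This goes
-- by induction on N.  Put b = 3072 q g(N) and let I maximise N_I(H) / (N_I(K_n) b^e(I)); suppose that
-- this exceeds 1.  The induction hypothesis for H - e shows that every edge e of H is missed by at
-- most a fraction (g(N-1) / g(N))^e(I) of the copies of I in H, so for a suitable t ≈ 2 N g(N) / e(I)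
-- most unions of t copies of I in H cover at least half of H.  On the other hand, a sequence of t
-- copies in K_n whose union J lies in a copy of H can be enumerated copy by copy, according to the
-- intersection with the previous ones.  By maximality of I, each step costs a factor at most
-- N_I(H) (1 + 1 / (12 g(N)))^e(I), if a union J is given the weight (256 q)^e(J), and by sparsity J lies
-- in at most a fraction 2^N q^e(J) of the copies of H.  Comparing both counts gives 16^N ≤ 2 · 4^N.
module Submission where

open import Defs
import Algebra.Bundles as Bundles
import Algebra.Properties.CommutativeSemiring.Exp as Exp
open import Data.Bool.Base using (true; false; if_then_else_)
import Data.Bool.Properties as Bool
open import Data.Empty using (⊥-elim) renaming (⊥ to Empty)
open import Data.Fin.Base as Fin using (Fin; zero; suc)
import Data.Fin.Permutation as Permutation
open import Data.Fin.Permutation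
  using (Permutation′; _⟨$⟩ʳ_; _⟨$⟩ˡ_; inverseˡ; inverseʳ; transpose; _∘ₚ_; flip)
import Data.Fin.Properties as Fin
open import Data.Fin.Subset
  using (Subset; _∈_; _∉_; _⊆_; _∪_; _∩_; ∁; ⊥; ∣_∣; Nonempty) renaming (_-_ to _-ˢ_)
open import Data.Fin.Subset.Properties
import Data.Integer.Base as ℤ
open import Data.List.Base as List
  using (List; []; _∷_; _++_; length; map; filter; applyUpTo; allFin; cartesianProduct)
open import Data.List.Membership.Propositional using () renaming (_∈_ to _∈ˡ_)
open import Data.List.Membership.Propositional.Properties
  using (∈-allFin; ∈-cartesianProduct⁺; ∈-filter⁺; ∈-filter⁻; ∈-lookup; ∈-map⁺)
import Data.List.Properties as List
import Data.List.Relation.Unary.All as All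
open import Data.List.Relation.Unary.AllPairs.Core using (_∷_)
open import Data.List.Relation.Unary.Any as Any using (here; there)
open import Data.List.Relation.Unary.Any.Properties using (lookup-index)
open import Data.List.Relation.Unary.Unique.Propositional using (Unique)
import Data.List.Relation.Unary.Unique.Propositional.Properties as Unique
open import Data.Nat using (ℕ; _*_)
open import Data.Nat.Base as ℕ using (zero; suc; _!)
import Data.Nat.DivMod as ℕ
import Data.Nat.Properties as ℕ
open import Data.Nat.Properties using (_!≢0)
import Data.Nat.Solver as ℕSolver
open import Data.Product using (∃; _×_; _,_; proj₁; proj₂)
open import Data.Rational.Base
  using (ℚ; 0ℚ; 1ℚ; _+_; _-_; -_; _/_; _≤_; _<_; positive; nonNegative) renaming (_*_ to _·_)
import Data.Rational.Base as ℚ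
import Data.Rational.Properties as ℚ
open import Data.Rational.Solver using (module +-*-Solver)
open import Data.Sum.Base as Sum using (_⊎_; inj₁; inj₂; [_,_]′)
open import Data.Vec.Base using ([]; _∷_; there)
import Data.Vec.Base as Vec
import Data.Vec.Properties as Vec
open import Function.Base using (_∘_; it)
open import Level using (0ℓ)
open import Relation.Binary.Core using (Rel)
open import Relation.Binary.Definitions
  using (DecidableEquality; Reflexive; Symmetric; Transitive; tri<; tri≈; tri>)
open import Relation.Binary.PropositionalEquality
  using (_≡_; _≢_; refl; sym; trans; cong; cong₂; subst; subst₂; module ≡-Reasoning)
open import Relation.Nullary.Decidable using (Dec; yes; no; does; dec-true; ¬?; _×-dec_; toSum)
open import Relation.Nullary.Negation using (¬_; contradiction)
open import Relation.Unary using (Pred; Decidable)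

open import Algebra.Definitions.RawSemiring ℚ.+-*-rawSemiring using (_^_)
open +-*-Solver using (solve; _:+_; _:*_; _:-_; :-_; _:=_; con)
open Exp (Bundles.CommutativeRing.commutativeSemiring ℚ.+-*-commutativeRing)
  using (^-homo-*; ^-assocʳ; ^-distrib-*)

-- Rational numbers

-- The harmonic number settles two competing demands on t. With b proportional to g(N), an edge is
-- missed by at most a fraction (1 - 1/(N g(N)))^(e(I) t) of the tuples, so covering asks for e(I) t
-- of order N g(N). The enumeration costs (1 + x)^(e(I) t) with x of order 1/g(N), and this must
-- stay exponential in N. Both are possible because N (g(N) - g(N-1)) = 1; increments of smaller
-- order than 1/N would force e(I) t beyond the order of N g(N). Summing increments 1/N is what
-- produces the logarithm. The combinatorial argument takes place in the rationals: a bound by a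
-- real number is tested against every rational above it, so q becomes a rational above q_H, and the
-- logarithm enters only through a comparison of harmonic numbers with partial sums of the
-- exponential series.

0≤1 : 0ℚ ≤ 1ℚ
0≤1 = ℚ.nonNegative⁻¹ 1ℚ

0<1 : 0ℚ < 1ℚ
0<1 = ℚ.positive⁻¹ 1ℚ

*-monoˡ : ∀ {a b c} → 0ℚ ≤ c → a ≤ b → c · a ≤ c · b
*-monoˡ {c = c} 0≤c = ℚ.*-monoˡ-≤-nonNeg c {{nonNegative 0≤c}}

*-monoʳ : ∀ {a b c} → 0ℚ ≤ c → a ≤ b → a · c ≤ b · c
*-monoʳ {c = c} 0≤c = ℚ.*-monoʳ-≤-nonNeg c {{nonNegative 0≤c}}

*-mono : ∀ {a b c d} → 0ℚ ≤ a → 0ℚ ≤ d → a ≤ b → c ≤ d → a · c ≤ b · d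
*-mono 0≤a 0≤d a≤b c≤d = ℚ.≤-trans (*-monoˡ 0≤a c≤d) (*-monoʳ 0≤d a≤b)

0≤* : ∀ {a b} → 0ℚ ≤ a → 0ℚ ≤ b → 0ℚ ≤ a · b
0≤* {a} {b} 0≤a 0≤b = subst (_≤ a · b) (ℚ.*-zeroʳ a) (*-monoˡ 0≤a 0≤b)

0<* : ∀ {a b} → 0ℚ < a → 0ℚ < b → 0ℚ < a · b
0<* {a} {b} 0<a 0<b = ℚ.positive⁻¹ (a · b) {{ℚ.pos*pos⇒pos a {{positive 0<a}} b {{positive 0<b}}}}

0≤+ : ∀ {a b} → 0ℚ ≤ a → 0ℚ ≤ b → 0ℚ ≤ a + b
0≤+ = ℚ.+-mono-≤

*-cancelˡ : ∀ {a b c} → 0ℚ < c → c · a ≤ c · b → a ≤ b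
*-cancelˡ {c = c} 0<c = ℚ.*-cancelˡ-≤-pos c {{positive 0<c}}

≤-by-+ : ∀ {a b c} → 0ℚ ≤ c → a + c ≡ b → a ≤ b
≤-by-+ {a} {b} {c} 0≤c refl = subst (_≤ a + c) (ℚ.+-identityʳ a) (ℚ.+-monoʳ-≤ a 0≤c)

^-nonneg : ∀ {x} n → 0ℚ ≤ x → 0ℚ ≤ x ^ n
^-nonneg zero    0≤x = 0≤1
^-nonneg (suc n) 0≤x = 0≤* 0≤x (^-nonneg n 0≤x)

^-pos : ∀ {x} n → 0ℚ < x → 0ℚ < x ^ n
^-pos zero    0<x = 0<1
^-pos (suc n) 0<x = 0<* 0<x (^-pos n 0<x)

^-monoˡ : ∀ {x y} n → 0ℚ ≤ x → x ≤ y → x ^ n ≤ y ^ n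
^-monoˡ zero    0≤x x≤y = ℚ.≤-refl
^-monoˡ (suc n) 0≤x x≤y = *-mono 0≤x (^-nonneg n (ℚ.≤-trans 0≤x x≤y)) x≤y (^-monoˡ n 0≤x x≤y)

1≤^ : ∀ {x} n → 1ℚ ≤ x → 1ℚ ≤ x ^ n
1≤^ {x} n 1≤x = subst (_≤ x ^ n) (1^e≡1 n) (^-monoˡ n 0≤1 1≤x)

^-monoʳ : ∀ {x m n} → 1ℚ ≤ x → m ℕ.≤ n → x ^ m ≤ x ^ n
^-monoʳ {x} {m} {n} 1≤x m≤n = begin
  x ^ m                  ≡⟨ sym (ℚ.*-identityʳ (x ^ m)) ⟩
  x ^ m · 1ℚ             ≤⟨ *-monoˡ (^-nonneg m (ℚ.≤-trans 0≤1 1≤x)) (1≤^ (n ℕ.∸ m) 1≤x) ⟩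
  x ^ m · x ^ (n ℕ.∸ m)  ≡⟨ sym (^-homo-* x m (n ℕ.∸ m)) ⟩
  x ^ (m ℕ.+ (n ℕ.∸ m))  ≡⟨ cong (x ^_) (ℕ.m+[n∸m]≡n m≤n) ⟩
  x ^ n                  ∎
  where open ℚ.≤-Reasoning

^-antimono : ∀ {x m n} → 0ℚ ≤ x → x ≤ 1ℚ → m ℕ.≤ n → x ^ n ≤ x ^ m
^-antimono {x} {m} {n} 0≤x x≤1 m≤n = begin
  x ^ n                  ≡⟨ cong (x ^_) (sym (ℕ.m+[n∸m]≡n m≤n)) ⟩
  x ^ (m ℕ.+ (n ℕ.∸ m))  ≡⟨ ^-homo-* x m (n ℕ.∸ m) ⟩
  x ^ m · x ^ (n ℕ.∸ m)  ≤⟨ *-monoˡ (^-nonneg m 0≤x) (subst (x ^ (n ℕ.∸ m) ≤_) (1^e≡1 (n ℕ.∸ m)) (^-monoˡ (n ℕ.∸ m) 0≤x x≤1)) ⟩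
  x ^ m · 1ℚ             ≡⟨ ℚ.*-identityʳ (x ^ m) ⟩
  x ^ m                  ∎
  where open ℚ.≤-Reasoning

fromℕ-+ : ∀ a b → fromℕ (a ℕ.+ b) ≡ fromℕ a + fromℕ b
fromℕ-+ zero    b = sym (ℚ.+-identityˡ (fromℕ b))
fromℕ-+ (suc a) b = begin
  fromℕ (suc (a ℕ.+ b))     ≡⟨ fromℕ-suc (a ℕ.+ b) ⟩
  1ℚ + fromℕ (a ℕ.+ b)      ≡⟨ cong (1ℚ +_) (fromℕ-+ a b) ⟩
  1ℚ + (fromℕ a + fromℕ b)  ≡⟨ sym (ℚ.+-assoc 1ℚ (fromℕ a) (fromℕ b)) ⟩
  1ℚ + fromℕ a + fromℕ b    ≡⟨ cong (_+ fromℕ b) (sym (fromℕ-suc a)) ⟩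
  fromℕ (suc a) + fromℕ b   ∎
  where open ≡-Reasoning

fromℕ-* : ∀ a b → fromℕ (a ℕ.* b) ≡ fromℕ a · fromℕ b
fromℕ-* zero    b = sym (ℚ.*-zeroˡ (fromℕ b))
fromℕ-* (suc a) b = begin
  fromℕ (b ℕ.+ a ℕ.* b)           ≡⟨ fromℕ-+ b (a ℕ.* b) ⟩
  fromℕ b + fromℕ (a ℕ.* b)       ≡⟨ cong (fromℕ b +_) (fromℕ-* a b) ⟩
  fromℕ b + fromℕ a · fromℕ b     ≡⟨ solve 2 (λ a b → b :+ a :* b := (con 1ℚ :+ a) :* b) refl (fromℕ a) (fromℕ b) ⟩
  (1ℚ + fromℕ a) · fromℕ b        ≡⟨ cong (_· fromℕ b) (sym (fromℕ-suc a)) ⟩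
  fromℕ (suc a) · fromℕ b         ∎
  where open ≡-Reasoning

fromℕ-mono : ∀ {a b} → a ℕ.≤ b → fromℕ a ≤ fromℕ b
fromℕ-mono {a} {b} a≤b = ≤-by-+ (0≤fromℕ (b ℕ.∸ a)) (trans (sym (fromℕ-+ a (b ℕ.∸ a))) (cong fromℕ (ℕ.m+[n∸m]≡n a≤b)))

0<fromℕ : ∀ k .{{_ : ℕ.NonZero k}} → 0ℚ < fromℕ k
0<fromℕ k = ℚ.<-≤-trans 0<1 (1≤fromℕ k)

bernoulli : ∀ {a} k → 0ℚ ≤ a → 1ℚ + fromℕ k · a ≤ (1ℚ + a) ^ k
bernoulli {a} zero    0≤a = ℚ.≤-reflexive (trans (cong (1ℚ +_) (ℚ.*-zeroˡ a)) (ℚ.+-identityʳ 1ℚ))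
bernoulli {a} (suc k) 0≤a = begin
  1ℚ + fromℕ (suc k) · a           ≡⟨ cong (λ c → 1ℚ + c · a) (fromℕ-suc k) ⟩
  1ℚ + (1ℚ + fromℕ k) · a          ≤⟨ ≤-by-+ (0≤* (0≤fromℕ k) (0≤* 0≤a 0≤a))
                                       (solve 2 (λ a k → (con 1ℚ :+ (con 1ℚ :+ k) :* a) :+ k :* (a :* a) := (con 1ℚ :+ a) :* (con 1ℚ :+ k :* a)) refl a (fromℕ k)) ⟩
  (1ℚ + a) · (1ℚ + fromℕ k · a)    ≤⟨ *-monoˡ (0≤+ 0≤1 0≤a) (bernoulli k 0≤a) ⟩
  (1ℚ + a) · (1ℚ + a) ^ k          ∎
  where open ℚ.≤-Reasoning

+-cancelˡ : ∀ a {b c} → a + b ≤ a + c → b ≤ c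
+-cancelˡ a {b} {c} ab≤ac = subst₂ _≤_ (cancel b) (cancel c) (ℚ.+-monoʳ-≤ (- a) ab≤ac)
  where
  cancel : ∀ x → - a + (a + x) ≡ x
  cancel x = solve 2 (λ a x → :- a :+ (a :+ x) := x) refl a x

2ℚ 4ℚ 12ℚ 16ℚ 256ℚ : ℚ
2ℚ   = fromℕ 2
4ℚ   = fromℕ 4
12ℚ  = fromℕ 12
16ℚ  = fromℕ 16
256ℚ = fromℕ 256

-- Bernoulli's inequality is applied to 1 + a, a lower bound for 1/ξ, so that ξ^M is halved without
-- any estimate of the exponential function.
2*^≤1 : ∀ {ξ a} M → 0ℚ ≤ ξ → 0ℚ ≤ a → 1ℚ ≤ fromℕ M · a → ξ · (1ℚ + a) ≤ 1ℚ → 2ℚ · ξ ^ M ≤ 1ℚ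
2*^≤1 {ξ} {a} M 0≤ξ 0≤a 1≤Ma ξ+ξa≤1 = begin
  2ℚ · ξ ^ M                  ≤⟨ *-monoʳ (^-nonneg M 0≤ξ) (ℚ.+-monoʳ-≤ 1ℚ 1≤Ma) ⟩
  (1ℚ + fromℕ M · a) · ξ ^ M  ≤⟨ *-monoʳ (^-nonneg M 0≤ξ) (bernoulli M 0≤a) ⟩
  (1ℚ + a) ^ M · ξ ^ M        ≡⟨ sym (^-distrib-* (1ℚ + a) ξ M) ⟩
  ((1ℚ + a) · ξ) ^ M          ≡⟨ cong (_^ M) (ℚ.*-comm (1ℚ + a) ξ) ⟩
  (ξ · (1ℚ + a)) ^ M          ≤⟨ ^-monoˡ M (0≤* 0≤ξ (0≤+ 0≤1 0≤a)) ξ+ξa≤1 ⟩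
  1ℚ ^ M                      ≡⟨ 1^e≡1 M ⟩
  1ℚ                          ∎
  where open ℚ.≤-Reasoning

-- The power occurs on the right as well: once k x is at most 1/2 it can be absorbed into the left
-- side, which bounds (1 + x)^k by 2.
[1+x]^k≤1+kx[1+x]^k : ∀ {x} k → 0ℚ ≤ x → (1ℚ + x) ^ k ≤ 1ℚ + fromℕ k · x · (1ℚ + x) ^ k
[1+x]^k≤1+kx[1+x]^k {x} zero    0≤x = ≤-by-+ (0≤* (0≤* (ℚ.≤-refl {0ℚ}) 0≤x) 0≤1) refl
[1+x]^k≤1+kx[1+x]^k {x} (suc k) 0≤x = begin
  (1ℚ + x) · P                                ≡⟨ solve 2 (λ x p → (con 1ℚ :+ x) :* p := p :+ x :* p) refl x P ⟩
  P + x · P                                   ≤⟨ ℚ.+-monoˡ-≤ (x · P) ([1+x]^k≤1+kx[1+x]^k k 0≤x) ⟩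
  1ℚ + fromℕ k · x · P + x · P                ≤⟨ ≤-by-+ (0≤* (0≤+ 0≤1 (0≤fromℕ k)) (0≤* (0≤* 0≤x 0≤x) 0≤P))
      (solve 3 (λ x p k → (con 1ℚ :+ k :* x :* p :+ x :* p) :+ (con 1ℚ :+ k) :* (x :* x :* p)
                := con 1ℚ :+ (con 1ℚ :+ k) :* x :* ((con 1ℚ :+ x) :* p)) refl x P (fromℕ k)) ⟩
  1ℚ + (1ℚ + fromℕ k) · x · ((1ℚ + x) · P)    ≡⟨ cong (λ c → 1ℚ + c · x · ((1ℚ + x) · P)) (sym (fromℕ-suc k)) ⟩
  1ℚ + fromℕ (suc k) · x · ((1ℚ + x) · P)     ∎
  where
  open ℚ.≤-Reasoning
  P = (1ℚ + x) ^ k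
  0≤P = ^-nonneg k (0≤+ 0≤1 0≤x)

[1+x]^k≤2 : ∀ {x} k → 0ℚ ≤ x → 2ℚ · (fromℕ k · x) ≤ 1ℚ → (1ℚ + x) ^ k ≤ 2ℚ
[1+x]^k≤2 {x} k 0≤x 2kx≤1 = +-cancelˡ P (begin
  P + P                              ≡⟨ solve 1 (λ p → p :+ p := con 2ℚ :* p) refl P ⟩
  2ℚ · P                             ≤⟨ *-monoˡ (0≤fromℕ 2) ([1+x]^k≤1+kx[1+x]^k k 0≤x) ⟩
  2ℚ · (1ℚ + fromℕ k · x · P)        ≡⟨ solve 2 (λ kx p → con 2ℚ :* (con 1ℚ :+ kx :* p) := con 2ℚ :+ con 2ℚ :* kx :* p) refl (fromℕ k · x) P ⟩
  2ℚ + 2ℚ · (fromℕ k · x) · P        ≤⟨ ℚ.+-monoʳ-≤ 2ℚ (*-monoʳ (^-nonneg k (0≤+ 0≤1 0≤x)) 2kx≤1) ⟩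
  2ℚ + 1ℚ · P                        ≡⟨ cong (2ℚ +_) (ℚ.*-identityˡ P) ⟩
  2ℚ + P                             ≡⟨ ℚ.+-comm 2ℚ P ⟩
  P + 2ℚ                             ∎)
  where
  open ℚ.≤-Reasoning
  P = (1ℚ + x) ^ k

-- Harmonic numbers and the exponential series

harmonic : ℕ → ℚ
harmonic zero    = 0ℚ
harmonic (suc n) = harmonic n + ℤ.+ 1 / suc n

0≤harmonic : ∀ n → 0ℚ ≤ harmonic n
0≤harmonic zero    = ℚ.≤-refl
0≤harmonic (suc n) = 0≤+ (0≤harmonic n) (0≤1/ (suc n))

harmonic-mono : ∀ {m n} → m ℕ.≤′ n → harmonic m ≤ harmonic n
harmonic-mono ℕ.≤′-refl              = ℚ.≤-refl
harmonic-mono {m} (ℕ.≤′-step {n} m≤n) = ℚ.≤-trans (harmonic-mono m≤n) (≤-by-+ (0≤1/ (suc n)) refl)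

1≤harmonic : ∀ n → 1ℚ ≤ harmonic (suc n)
1≤harmonic n = harmonic-mono (ℕ.≤⇒≤′ (ℕ.s≤s (ℕ.z≤n {n})))

-- Exponents are natural numbers, so g(N) has to be rounded up. Each increment of the harmonic sum
-- is at most 1, so raising the rounded value by 1 is always enough.
harmonic-ceiling : ∀ n → ∃ λ j → harmonic n ≤ fromℕ j × fromℕ j ≤ harmonic n + 1ℚ
harmonic-ceiling zero    = 0 , ℚ.≤-refl , 0≤1
harmonic-ceiling (suc n) with harmonic-ceiling n
... | j , h≤j , j≤h+1 with ℚ.≤-total (harmonic (suc n)) (fromℕ j)
...   | inj₁ h′≤j = j , h′≤j , ℚ.≤-trans j≤h+1 (ℚ.+-monoˡ-≤ 1ℚ (harmonic-mono {n} {suc n} (ℕ.≤′-step ℕ.≤′-refl)))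
...   | inj₂ j≤h′ = suc j
  , subst (harmonic (suc n) ≤_) (trans (ℚ.+-comm (fromℕ j) 1ℚ) (sym (fromℕ-suc j)))
      (ℚ.+-mono-≤ h≤j (subst (_≤ 1ℚ) (ℚ.*-identityˡ _) (subst (1ℚ · (ℤ.+ 1 / suc n) ≤_) (fromℕ*1/ (suc n))
        (*-monoʳ (0≤1/ (suc n)) (1≤fromℕ (suc n))))))
  , subst (_≤ harmonic (suc n) + 1ℚ) (trans (ℚ.+-comm (fromℕ j) 1ℚ) (sym (fromℕ-suc j))) (ℚ.+-monoˡ-≤ 1ℚ j≤h′)

1/-unique : ∀ k .{{_ : ℕ.NonZero k}} {y} → fromℕ k · y ≡ 1ℚ → y ≡ ℤ.+ 1 / k
1/-unique k {y} ky≡1 = begin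
  y                                ≡⟨ sym (ℚ.*-identityˡ y) ⟩
  1ℚ · y                           ≡⟨ cong (_· y) (sym (fromℕ*1/ k)) ⟩
  fromℕ k · (ℤ.+ 1 / k) · y        ≡⟨ solve 3 (λ a b c → a :* b :* c := b :* (a :* c)) refl (fromℕ k) (ℤ.+ 1 / k) y ⟩
  (ℤ.+ 1 / k) · (fromℕ k · y)      ≡⟨ cong ((ℤ.+ 1 / k) ·_) ky≡1 ⟩
  (ℤ.+ 1 / k) · 1ℚ                 ≡⟨ ℚ.*-identityʳ _ ⟩
  ℤ.+ 1 / k                        ∎
  where open ≡-Reasoning

infix 9 1/_!

1/_! : ℕ → ℚ
1/ j ! = (ℤ.+ 1 / j !) {{j !≢0}}

0≤1/! : ∀ j → 0ℚ ≤ 1/ j !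
0≤1/! j = 0≤1/ (j !) {{j !≢0}}

suc*1/suc! : ∀ j → fromℕ (suc j) · 1/ suc j ! ≡ 1/ j !
suc*1/suc! j = 1/-unique (j !) {{j !≢0}} (begin
  fromℕ (j !) · (fromℕ (suc j) · 1/ suc j !)  ≡⟨ solve 3 (λ a b c → a :* (b :* c) := b :* a :* c) refl (fromℕ (j !)) (fromℕ (suc j)) (1/ suc j !) ⟩
  fromℕ (suc j) · fromℕ (j !) · 1/ suc j !    ≡⟨ cong (_· 1/ suc j !) (sym (fromℕ-* (suc j) (j !))) ⟩
  fromℕ (suc j !) · 1/ suc j !                ≡⟨ fromℕ*1/ (suc j !) {{suc j !≢0}} ⟩
  1ℚ                                          ∎)
  where open ≡-Reasoning

-- The derivative is evaluated at the larger endpoint s + d; its factor j + 1 later cancels against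
-- the factorial in the exponential series.
[s+d]^[1+j] : ∀ {s d} j → 0ℚ ≤ s → 0ℚ ≤ d → (s + d) ^ suc j ≤ s ^ suc j + fromℕ (suc j) · d · (s + d) ^ j
[s+d]^[1+j] {s} {d} zero    0≤s 0≤d = ℚ.≤-reflexive
  (solve 2 (λ s d → (s :+ d) :* con 1ℚ := s :* con 1ℚ :+ con 1ℚ :* d :* con 1ℚ) refl s d)
[s+d]^[1+j] {s} {d} (suc j) 0≤s 0≤d = begin
  u · (u · U)                                  ≤⟨ *-monoˡ 0≤u ([s+d]^[1+j] j 0≤s 0≤d) ⟩
  u · (s · S + n · d · U)                      ≡⟨ solve 5 (λ s d S U n → (s :+ d) :* (s :* S :+ n :* d :* U)
                                                     := s :* (s :* S) :+ (d :* (s :* S) :+ n :* d :* ((s :+ d) :* U))) refl s d S U n ⟩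
  s · (s · S) + (d · (s · S) + n · d · (u · U)) ≤⟨ ℚ.+-monoʳ-≤ (s · (s · S)) (ℚ.+-monoˡ-≤ (n · d · (u · U))
                                                     (*-monoˡ 0≤d (^-monoˡ (suc j) 0≤s (≤-by-+ 0≤d refl)))) ⟩
  s · (s · S) + (d · (u · U) + n · d · (u · U)) ≡⟨ cong (s · (s · S) +_) (solve 3 (λ d n v → d :* v :+ n :* d :* v := (con 1ℚ :+ n) :* d :* v) refl d n (u · U)) ⟩
  s · (s · S) + (1ℚ + n) · d · (u · U)          ≡⟨ cong (λ c → s · (s · S) + c · d · (u · U)) (sym (fromℕ-suc (suc j))) ⟩
  s · (s · S) + fromℕ (suc (suc j)) · d · (u · U) ∎
  where
  open ℚ.≤-Reasoning
  u = s + d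
  U = u ^ j
  S = s ^ j
  n = fromℕ (suc j)
  0≤u = 0≤+ 0≤s 0≤d

0≤expTerm : ∀ {s} j → 0ℚ ≤ s → 0ℚ ≤ expTerm s j
0≤expTerm j 0≤s = 0≤* (^-nonneg j 0≤s) (0≤1/! j)

expTerm-shift : ∀ {s d} j → 0ℚ ≤ s → 0ℚ ≤ d → expTerm (s + d) (suc j) ≤ expTerm s (suc j) + d · expTerm (s + d) j
expTerm-shift {s} {d} j 0≤s 0≤d = begin
  u ^ suc j · f                          ≤⟨ *-monoʳ (0≤1/! (suc j)) ([s+d]^[1+j] j 0≤s 0≤d) ⟩
  (s ^ suc j + n · d · u ^ j) · f        ≡⟨ solve 5 (λ S n d U f → (S :+ n :* d :* U) :* f := S :* f :+ d :* (U :* (n :* f))) refl (s ^ suc j) n d (u ^ j) f ⟩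
  s ^ suc j · f + d · (u ^ j · (n · f))  ≡⟨ cong (λ c → s ^ suc j · f + d · (u ^ j · c)) (suc*1/suc! j) ⟩
  s ^ suc j · f + d · (u ^ j · 1/ j !)   ∎
  where
  open ℚ.≤-Reasoning
  u = s + d
  n = fromℕ (suc j)
  f = 1/ suc j !

Σ< : (ℕ → ℚ) → ℕ → ℚ
Σ< f k = sumℚ (applyUpTo f k)

Σ<-mono : ∀ {f g} k → (∀ j → f j ≤ g j) → Σ< f k ≤ Σ< g k
Σ<-mono zero    f≤g = ℚ.≤-refl
Σ<-mono (suc k) f≤g = ℚ.+-mono-≤ (f≤g 0) (Σ<-mono k (λ j → f≤g (suc j)))

Σ<-linear : ∀ f g d k → Σ< (λ j → f j + d · g j) k ≡ Σ< f k + d · Σ< g k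
Σ<-linear f g d zero    = sym (trans (ℚ.+-identityˡ _) (ℚ.*-zeroʳ d))
Σ<-linear f g d (suc k) = trans (cong (f 0 + d · g 0 +_) (Σ<-linear (λ j → f (suc j)) (λ j → g (suc j)) d k))
  (solve 5 (λ a b d A B → (a :+ d :* b) :+ (A :+ d :* B) := (a :+ A) :+ d :* (b :+ B)) refl (f 0) (g 0) d (Σ< (λ j → f (suc j)) k) (Σ< (λ j → g (suc j)) k))

Σ<-suc : ∀ {f} k → (∀ j → 0ℚ ≤ f j) → Σ< f k ≤ Σ< f (suc k)
Σ<-suc {f} zero    0≤f = 0≤+ (0≤f 0) ℚ.≤-refl
Σ<-suc {f} (suc k) 0≤f = ℚ.+-monoʳ-≤ (f 0) (Σ<-suc k (λ j → 0≤f (suc j)))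

expSum-mono : ∀ {s t} k → 0ℚ ≤ s → s ≤ t → expSum s k ≤ expSum t k
expSum-mono k 0≤s s≤t = Σ<-mono k λ j → *-monoʳ (0≤1/! j) (^-monoˡ j 0≤s s≤t)

-- The mean value inequality exp (s + d) - exp s ≤ d exp (s + d), for partial sums.
expSum-shift : ∀ {s d} k → 0ℚ ≤ s → 0ℚ ≤ d → expSum (s + d) k ≤ expSum s k + d · expSum (s + d) k
expSum-shift {s} {d} zero    0≤s 0≤d = ℚ.≤-reflexive (sym (trans (ℚ.+-identityˡ _) (ℚ.*-zeroʳ d)))
expSum-shift {s} {d} (suc k) 0≤s 0≤d = begin
  c + Σ< (λ j → expTerm u (suc j)) k                            ≤⟨ ℚ.+-monoʳ-≤ c (Σ<-mono k (λ j → expTerm-shift j 0≤s 0≤d)) ⟩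
  c + Σ< (λ j → expTerm s (suc j) + d · expTerm u j) k          ≡⟨ cong (c +_) (Σ<-linear (λ j → expTerm s (suc j)) (expTerm u) d k) ⟩
  c + (Σ< (λ j → expTerm s (suc j)) k + d · expSum u k)         ≡⟨ sym (ℚ.+-assoc c (Σ< (λ j → expTerm s (suc j)) k) (d · expSum u k)) ⟩
  c + Σ< (λ j → expTerm s (suc j)) k + d · expSum u k           ≤⟨ ℚ.+-monoʳ-≤ (expSum s (suc k)) (*-monoˡ 0≤d (Σ<-suc k (λ j → 0≤expTerm j (0≤+ 0≤s 0≤d)))) ⟩
  expSum s (suc k) + d · expSum u (suc k)                       ∎
  where
  open ℚ.≤-Reasoning
  u = s + d
  c = expTerm s 0

expSum0≤1 : ∀ k → expSum 0ℚ k ≤ 1ℚ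
expSum0≤1 zero    = 0≤1
expSum0≤1 (suc k) = ℚ.≤-reflexive (trans (cong (1ℚ +_) (zeros k (λ j → trans (cong (_· 1/ suc j !) (ℚ.*-zeroˡ (0ℚ ^ j))) (ℚ.*-zeroˡ (1/ suc j !))))) (ℚ.+-identityʳ 1ℚ))
  where
  zeros : ∀ {f} k → (∀ j → f j ≡ 0ℚ) → Σ< f k ≡ 0ℚ
  zeros zero    f≡0 = refl
  zeros (suc k) f≡0 = cong₂ _+_ (f≡0 0) (zeros k (λ j → f≡0 (suc j)))

¼ : ℚ
¼ = ℤ.+ 1 / 4

-- From exp(s + d) (1 - d) ≤ exp(s) with d = 1/(4(n+1)), passing from n to n + 1 multiplies the
-- exponential by at most 4(n+1)/(4n+3), and this is at most (n+3)/(n+2). The bound is uniform in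
-- the number k of terms.
expSum-harmonic : ∀ n k → 2ℚ · expSum (harmonic n · ¼) k ≤ fromℕ n + 2ℚ
expSum-harmonic zero    k = subst (2ℚ · expSum 0ℚ k ≤_) refl (*-monoˡ (0≤fromℕ 2) (expSum0≤1 k))
expSum-harmonic (suc n) k = *-cancelˡ 0<c (begin
  c · (2ℚ · e₁)                                   ≡⟨ solve 2 (λ n e → (con 4ℚ :* n :+ con (fromℕ 3)) :* (con 2ℚ :* e)
                                                       := con (fromℕ 8) :* (con 1ℚ :+ n) :* e :- con 2ℚ :* e) refl m e₁ ⟩
  fromℕ 8 · (1ℚ + m) · e₁ - 2ℚ · e₁                ≤⟨ ℚ.+-monoˡ-≤ (- (2ℚ · e₁)) (*-monoˡ (0≤* (0≤fromℕ 8) (0≤+ 0≤1 (0≤fromℕ n))) e≤) ⟩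
  fromℕ 8 · (1ℚ + m) · (e₀ + d · e₁) - 2ℚ · e₁     ≡⟨ solve 4 (λ n e₀ i e → con (fromℕ 8) :* (con 1ℚ :+ n) :* (e₀ :+ i :* con ¼ :* e) :- con 2ℚ :* e
                                                       := con 4ℚ :* (con 1ℚ :+ n) :* (con 2ℚ :* e₀) :+ ((con 1ℚ :+ n) :* i :- con 1ℚ) :* (con 2ℚ :* e)) refl m e₀ r e₁ ⟩
  4ℚ · (1ℚ + m) · (2ℚ · e₀) + ((1ℚ + m) · r - 1ℚ) · (2ℚ · e₁)
                                                 ≡⟨ cong (λ z → 4ℚ · (1ℚ + m) · (2ℚ · e₀) + (z - 1ℚ) · (2ℚ · e₁)) (trans (cong (_· r) (sym (fromℕ-suc n))) (fromℕ*1/ (suc n))) ⟩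
  4ℚ · (1ℚ + m) · (2ℚ · e₀) + 0ℚ · (2ℚ · e₁)      ≡⟨ trans (cong (4ℚ · (1ℚ + m) · (2ℚ · e₀) +_) (ℚ.*-zeroˡ (2ℚ · e₁))) (ℚ.+-identityʳ _) ⟩
  4ℚ · (1ℚ + m) · (2ℚ · e₀)                      ≤⟨ *-monoˡ (0≤* (0≤fromℕ 4) (0≤+ 0≤1 (0≤fromℕ n))) (expSum-harmonic n k) ⟩
  4ℚ · (1ℚ + m) · (m + 2ℚ)                       ≤⟨ ≤-by-+ (0≤+ (0≤* (0≤fromℕ 3) (0≤fromℕ n)) 0≤1)
                                                       (solve 1 (λ n → con 4ℚ :* (con 1ℚ :+ n) :* (n :+ con 2ℚ) :+ (con (fromℕ 3) :* n :+ con 1ℚ)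
                                                         := (con 4ℚ :* n :+ con (fromℕ 3)) :* (con 1ℚ :+ n :+ con 2ℚ)) refl m) ⟩
  c · (1ℚ + m + 2ℚ)                              ≡⟨ cong (λ z → c · (z + 2ℚ)) (sym (fromℕ-suc n)) ⟩
  c · (fromℕ (suc n) + 2ℚ)                       ∎)
  where
  open ℚ.≤-Reasoning
  m = fromℕ n
  r = ℤ.+ 1 / suc n
  d = r · ¼
  c = 4ℚ · m + fromℕ 3
  0≤d : 0ℚ ≤ d
  0≤d = 0≤* (0≤1/ (suc n)) (ℚ.nonNegative⁻¹ ¼)
  0<c : 0ℚ < c
  0<c = ℚ.<-≤-trans (0<fromℕ 3) (subst (_≤ c) (ℚ.+-identityˡ (fromℕ 3)) (ℚ.+-monoˡ-≤ (fromℕ 3) (0≤* (0≤fromℕ 4) (0≤fromℕ n))))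
  e₀ = expSum (harmonic n · ¼) k
  e₁ = expSum (harmonic (suc n) · ¼) k
  e≤ : e₁ ≤ e₀ + d · e₁
  e≤ = subst (λ s → expSum s k ≤ e₀ + d · expSum s k) (sym (ℚ.*-distribʳ-+ ¼ (harmonic n) r))
         (expSum-shift k (0≤* (0≤harmonic n) (ℚ.nonNegative⁻¹ ¼)) 0≤d)

-- If s were below a quarter of the harmonic number, 2n would be at most (n + 2)/2, that is, 3n ≤ 2.
-- The factor 2 in 2n matters at n = 1, where the harmonic number is 1 but log 1 is 0.
harmonic≤4s : ∀ n .{{_ : ℕ.NonZero n}} {s} k → 0ℚ ≤ s → fromℕ (2 ℕ.* n) ≤ expSum s k → harmonic n ≤ 4ℚ · s
harmonic≤4s n {s} k 0≤s 2n≤exp with ℚ.≤-total (harmonic n) (4ℚ · s)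
... | inj₁ h≤4s = h≤4s
... | inj₂ 4s≤h = ⊥-elim (ℚ.<-irrefl refl (ℚ.<-≤-trans 2<3n 3n≤2))
  where
  open ℚ.≤-Reasoning
  s≤h/4 : s ≤ harmonic n · ¼
  s≤h/4 = subst (_≤ harmonic n · ¼) (solve 1 (λ s → con 4ℚ :* s :* con ¼ := s) refl s) (*-monoʳ (ℚ.nonNegative⁻¹ ¼) 4s≤h)
  4n≤n+2 : fromℕ 4 · fromℕ n ≤ fromℕ n + 2ℚ
  4n≤n+2 = begin
    4ℚ · fromℕ n                        ≡⟨ solve 1 (λ n → con 4ℚ :* n := con 2ℚ :* (con 2ℚ :* n)) refl (fromℕ n) ⟩
    2ℚ · (2ℚ · fromℕ n)                 ≡⟨ cong (2ℚ ·_) (sym (fromℕ-* 2 n)) ⟩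
    2ℚ · fromℕ (2 ℕ.* n)                ≤⟨ *-monoˡ (0≤fromℕ 2) (ℚ.≤-trans 2n≤exp (expSum-mono k 0≤s s≤h/4)) ⟩
    2ℚ · expSum (harmonic n · ¼) k      ≤⟨ expSum-harmonic n k ⟩
    fromℕ n + 2ℚ                        ∎
  3n≤2 : fromℕ 3 · fromℕ n ≤ 2ℚ
  3n≤2 = +-cancelˡ (fromℕ n) (subst (_≤ fromℕ n + 2ℚ) (solve 1 (λ n → con 4ℚ :* n := n :+ con (fromℕ 3) :* n) refl (fromℕ n)) 4n≤n+2)
  2<3n : 2ℚ < fromℕ 3 · fromℕ n
  2<3n = ℚ.<-≤-trans (ℚ.+-monoʳ-< 2ℚ 0<1) (subst (_≤ fromℕ 3 · fromℕ n) (ℚ.*-identityʳ (fromℕ 3)) (*-monoˡ (0≤fromℕ 3) (1≤fromℕ n)))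

-- Choosing the number of copies

multiple : ∀ i m → ∃ λ t → m ℕ.≤ suc i ℕ.* t × suc i ℕ.* t ℕ.≤ suc i ℕ.+ m
multiple i m = t , m≤ , ≤m
  where
  t = suc (m ℕ./ suc i)
  eq : suc i ℕ.* t ≡ suc i ℕ.+ m ℕ./ suc i ℕ.* suc i
  eq = trans (ℕ.*-suc (suc i) (m ℕ./ suc i)) (cong (suc i ℕ.+_) (ℕ.*-comm (suc i) (m ℕ./ suc i)))
  m≤ : m ℕ.≤ suc i ℕ.* t
  m≤ = begin
    m                                         ≡⟨ ℕ.m≡m%n+[m/n]*n m (suc i) ⟩
    m ℕ.% suc i ℕ.+ m ℕ./ suc i ℕ.* suc i     ≤⟨ ℕ.+-monoˡ-≤ (m ℕ./ suc i ℕ.* suc i) (ℕ.<⇒≤ (ℕ.m%n<n m (suc i))) ⟩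
    suc i ℕ.+ m ℕ./ suc i ℕ.* suc i           ≡⟨ sym eq ⟩
    suc i ℕ.* t                               ∎
    where open ℕ.≤-Reasoning
  ≤m : suc i ℕ.* t ℕ.≤ suc i ℕ.+ m
  ≤m = subst (ℕ._≤ suc i ℕ.+ m) (sym eq) (ℕ.+-monoʳ-≤ (suc i) (ℕ.m/n*n≤m m (suc i)))

-- With N = n + 1 and g = `harmonic N`, ξ is 1 - 1/(N g), so about 2 N g factors ξ bring the product
-- below 1/4, while x = 1/(12 g) allows up to 6 N g factors 1 + x before 2^N is exceeded. Rounding
-- keeps the exponent inside this window.
exponent : ∀ n i → i ℕ.≤ n → ∃ λ t → ∀ {ξ x} →
  0ℚ ≤ ξ → ξ · harmonic (suc n) ≡ harmonic n → 0ℚ ≤ x → x · (12ℚ · harmonic (suc n)) ≡ 1ℚ →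
  4ℚ · ξ ^ (suc i ℕ.* t) ≤ 1ℚ × (1ℚ + x) ^ (suc i ℕ.* t) ≤ 2ℚ ^ suc n
exponent n i i≤n with harmonic-ceiling (suc n)
... | zero  , g≤0 , _     = ⊥-elim (ℚ.<-irrefl refl (ℚ.<-≤-trans 0<1 (ℚ.≤-trans (1≤harmonic n) g≤0)))
... | suc j , g≤J , J≤g+1 = t , λ {ξ} {x} 0≤ξ ξg≡h 0≤x 12gx≡1 → decay 0≤ξ ξg≡h , growth 0≤x 12gx≡1
  where
  open ℚ.≤-Reasoning
  g = harmonic (suc n)
  h = harmonic n
  J = fromℕ (suc j)
  N = fromℕ (suc n)
  -- N times g rounded up: M factors ξ give 1/2, twice as many give 1/4.
  M = suc j ℕ.* suc n
  r₁ = ℤ.+ 1 / suc n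
  r₂ = ℤ.+ 1 / suc j
  t = proj₁ (multiple i (M ℕ.+ M))
  2M≤ = proj₁ (proj₂ (multiple i (M ℕ.+ M)))
  ≤i+2M = proj₂ (proj₂ (multiple i (M ℕ.+ M)))
  0<g : 0ℚ < g
  0<g = ℚ.<-≤-trans 0<1 (1≤harmonic n)
  h≤g : h ≤ g
  h≤g = ≤-by-+ (0≤1/ (suc n)) refl

  decay : ∀ {ξ} → 0ℚ ≤ ξ → ξ · g ≡ h → 4ℚ · ξ ^ (suc i ℕ.* t) ≤ 1ℚ
  decay {ξ} 0≤ξ ξg≡h = begin
    4ℚ · ξ ^ (suc i ℕ.* t)          ≤⟨ *-monoˡ (0≤fromℕ 4) (^-antimono 0≤ξ ξ≤1 2M≤) ⟩
    4ℚ · ξ ^ (M ℕ.+ M)              ≡⟨ cong (4ℚ ·_) (^-homo-* ξ M M) ⟩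
    4ℚ · (ξ ^ M · ξ ^ M)            ≡⟨ solve 1 (λ p → con 4ℚ :* (p :* p) := (con 2ℚ :* p) :* (con 2ℚ :* p)) refl (ξ ^ M) ⟩
    (2ℚ · ξ ^ M) · (2ℚ · ξ ^ M)     ≤⟨ *-mono (0≤* (0≤fromℕ 2) (^-nonneg M 0≤ξ)) 0≤1 2ξ^M≤1 2ξ^M≤1 ⟩
    1ℚ · 1ℚ                         ≡⟨ refl ⟩
    1ℚ                              ∎
    where
    ξ≤1 : ξ ≤ 1ℚ
    ξ≤1 = *-cancelˡ 0<g (subst₂ _≤_ (trans (sym ξg≡h) (ℚ.*-comm ξ g)) (sym (ℚ.*-identityʳ g)) h≤g)
    -- This is 1/M. As h a ≤ 1/N, the product h (1 + a) is at most g, that is, ξ (1 + a) ≤ 1.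
    a = r₁ · r₂
    0≤a : 0ℚ ≤ a
    0≤a = 0≤* (0≤1/ (suc n)) (0≤1/ (suc j))
    Ma≡1 : fromℕ M · a ≡ 1ℚ
    Ma≡1 = trans (cong (_· a) (fromℕ-* (suc j) (suc n)))
      (trans (solve 4 (λ J N r s → J :* N :* (r :* s) := (J :* s) :* (N :* r)) refl J N r₁ r₂)
             (cong₂ _·_ (fromℕ*1/ (suc j)) (fromℕ*1/ (suc n))))
    ha≤ : h · a ≤ r₁
    ha≤ = begin
      h · a          ≤⟨ *-monoʳ 0≤a (ℚ.≤-trans h≤g g≤J) ⟩
      J · a          ≡⟨ solve 3 (λ J r s → J :* (r :* s) := (J :* s) :* r) refl J r₁ r₂ ⟩
      J · r₂ · r₁    ≡⟨ cong (_· r₁) (fromℕ*1/ (suc j)) ⟩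
      1ℚ · r₁        ≡⟨ ℚ.*-identityˡ r₁ ⟩
      r₁             ∎
    2ξ^M≤1 : 2ℚ · ξ ^ M ≤ 1ℚ
    2ξ^M≤1 = 2*^≤1 M 0≤ξ 0≤a (ℚ.≤-reflexive (sym Ma≡1)) (*-cancelˡ 0<g (begin
      g · (ξ · (1ℚ + a))     ≡⟨ solve 3 (λ g ξ a → g :* (ξ :* (con 1ℚ :+ a)) := ξ :* g :* (con 1ℚ :+ a)) refl g ξ a ⟩
      ξ · g · (1ℚ + a)       ≡⟨ cong (_· (1ℚ + a)) ξg≡h ⟩
      h · (1ℚ + a)           ≡⟨ solve 2 (λ h a → h :* (con 1ℚ :+ a) := h :+ h :* a) refl h a ⟩
      h + h · a              ≤⟨ ℚ.+-monoʳ-≤ h ha≤ ⟩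
      g                      ≡⟨ sym (ℚ.*-identityʳ g) ⟩
      g · 1ℚ                 ∎))

  growth : ∀ {x} → 0ℚ ≤ x → x · (12ℚ · g) ≡ 1ℚ → (1ℚ + x) ^ (suc i ℕ.* t) ≤ 2ℚ ^ suc n
  growth {x} 0≤x 12gx≡1 = begin
    (1ℚ + x) ^ (suc i ℕ.* t)                 ≤⟨ ^-monoʳ (≤-by-+ 0≤x refl) T≤ ⟩
    (1ℚ + x) ^ (3 ℕ.* suc j ℕ.* suc n)       ≡⟨ sym (^-assocʳ (1ℚ + x) (3 ℕ.* suc j) (suc n)) ⟩
    ((1ℚ + x) ^ (3 ℕ.* suc j)) ^ suc n       ≤⟨ ^-monoˡ (suc n) (^-nonneg (3 ℕ.* suc j) (0≤+ 0≤1 0≤x)) ([1+x]^k≤2 (3 ℕ.* suc j) 0≤x 6Jx≤1) ⟩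
    2ℚ ^ suc n                               ∎
    where
    -- Rounding up to a multiple of `suc i` costs at most `suc i`, which is at most N and hence at
    -- most M.
    T≤ : suc i ℕ.* t ℕ.≤ 3 ℕ.* suc j ℕ.* suc n
    T≤ = ℕ.≤-trans ≤i+2M (subst (suc i ℕ.+ (M ℕ.+ M) ℕ.≤_) 3M≡ (ℕ.+-monoˡ-≤ (M ℕ.+ M) (ℕ.≤-trans (ℕ.s≤s i≤n) (ℕ.m≤m+n (suc n) (j ℕ.* suc n)))))
      where
      open ℕSolver.+-*-Solver renaming (solve to solveℕ; _:+_ to _⊕_; _:*_ to _⊗_; _:=_ to _⊜_; con to conℕ)
      3M≡ : M ℕ.+ (M ℕ.+ M) ≡ 3 ℕ.* suc j ℕ.* suc n
      3M≡ = solveℕ 2 (λ a b → a ⊗ b ⊕ (a ⊗ b ⊕ a ⊗ b) ⊜ conℕ 3 ⊗ a ⊗ b) refl (suc j) (suc n)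
    -- The 12 in the hypothesis on x originates here: J ≤ g + 1 ≤ 2g, so 2 · 3J x is at most 12 g x.
    6Jx≤1 : 2ℚ · (fromℕ (3 ℕ.* suc j) · x) ≤ 1ℚ
    6Jx≤1 = begin
      2ℚ · (fromℕ (3 ℕ.* suc j) · x)        ≡⟨ cong (λ z → 2ℚ · (z · x)) (fromℕ-* 3 (suc j)) ⟩
      2ℚ · (fromℕ 3 · J · x)                ≡⟨ solve 2 (λ J x → con 2ℚ :* (con (fromℕ 3) :* J :* x) := con (fromℕ 6) :* x :* J) refl J x ⟩
      fromℕ 6 · x · J                       ≤⟨ *-monoˡ (0≤* (0≤fromℕ 6) 0≤x) (ℚ.≤-trans J≤g+1 (ℚ.+-monoʳ-≤ g (1≤harmonic n))) ⟩
      fromℕ 6 · x · (g + g)                 ≡⟨ solve 2 (λ g x → con (fromℕ 6) :* x :* (g :+ g) := x :* (con 12ℚ :* g)) refl g x ⟩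
      x · (12ℚ · g)                         ≡⟨ 12gx≡1 ⟩
      1ℚ                                    ∎

-- Sums over subsets

𝟙 : {P : Set} → Dec P → ℚ
𝟙 P? = if does P? then 1ℚ else 0ℚ

0≤𝟙 : {P : Set} (P? : Dec P) → 0ℚ ≤ 𝟙 P?
0≤𝟙 P? = 0≤indicator (does P?) 0≤1

𝟙≤1 : {P : Set} (P? : Dec P) → 𝟙 P? ≤ 1ℚ
𝟙≤1 (yes _) = ℚ.≤-refl
𝟙≤1 (no _)  = 0≤1

𝟙-yes : {P : Set} (P? : Dec P) → P → 𝟙 P? ≡ 1ℚ
𝟙-yes (yes _) p = refl
𝟙-yes (no ¬p) p = contradiction p ¬p

𝟙-no : {P : Set} (P? : Dec P) → ¬ P → 𝟙 P? ≡ 0ℚ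
𝟙-no (yes p) ¬p = contradiction p ¬p
𝟙-no (no _)  ¬p = refl

𝟙*-cong : {P : Set} (P? : Dec P) → ∀ {a b} → (P → a ≡ b) → 𝟙 P? · a ≡ 𝟙 P? · b
𝟙*-cong (yes p)         eq = cong (1ℚ ·_) (eq p)
𝟙*-cong (no _)  {a} {b} eq = trans (ℚ.*-zeroˡ a) (sym (ℚ.*-zeroˡ b))

𝟙*-mono : {P : Set} (P? : Dec P) → ∀ {a b} → (P → a ≤ b) → 𝟙 P? · a ≤ 𝟙 P? · b
𝟙*-mono (yes p)         le = *-monoˡ 0≤1 (le p)
𝟙*-mono (no _)  {a} {b} le = ℚ.≤-reflexive (trans (ℚ.*-zeroˡ a) (sym (ℚ.*-zeroˡ b)))

𝟙-⇔ : {P Q : Set} (P? : Dec P) (Q? : Dec Q) → (P → Q) → (Q → P) → 𝟙 P? ≡ 𝟙 Q?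
𝟙-⇔ (yes p) Q? f g = sym (𝟙-yes Q? (f p))
𝟙-⇔ (no ¬p) Q? f g = sym (𝟙-no Q? (¬p ∘ g))

𝟙-mono : {P Q : Set} (P? : Dec P) (Q? : Dec Q) → (P → Q) → 𝟙 P? ≤ 𝟙 Q?
𝟙-mono (yes p) Q? f = ℚ.≤-reflexive (sym (𝟙-yes Q? (f p)))
𝟙-mono (no _)  Q? f = 0≤𝟙 Q?

𝟙-∧ : {P Q R : Set} (P? : Dec P) (Q? : Dec Q) (R? : Dec R) → (P → Q → R) → (R → P) → (R → Q) → 𝟙 P? · 𝟙 Q? ≡ 𝟙 R?
𝟙-∧ (no ¬p) Q? R? f g h = trans (ℚ.*-zeroˡ (𝟙 Q?)) (sym (𝟙-no R? (¬p ∘ g)))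
𝟙-∧ (yes p) Q? R? f g h = trans (ℚ.*-identityˡ (𝟙 Q?)) (𝟙-⇔ Q? R? (f p) h)

infix 4 _≟ˢ_

_≟ˢ_ : ∀ {m} → DecidableEquality (Subset m)
_≟ˢ_ = Vec.≡-dec Bool._≟_

-- The recursion follows the order of `subsets` and lets weights defined coordinatewise, such as
-- `W`, be summed one coordinate at a time.
Σ : ∀ {m} → (Subset m → ℚ) → ℚ
Σ {zero}  f = f []
Σ {suc m} f = Σ (λ S → f (false ∷ S)) + Σ (λ S → f (true ∷ S))

Σ-cong : ∀ {m} {f g : Subset m → ℚ} → (∀ S → f S ≡ g S) → Σ f ≡ Σ g
Σ-cong {zero}  f≗g = f≗g []
Σ-cong {suc m} f≗g = cong₂ _+_ (Σ-cong (λ S → f≗g (false ∷ S))) (Σ-cong (λ S → f≗g (true ∷ S)))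

Σ-mono : ∀ {m} {f g : Subset m → ℚ} → (∀ S → f S ≤ g S) → Σ f ≤ Σ g
Σ-mono {zero}  f≤g = f≤g []
Σ-mono {suc m} f≤g = ℚ.+-mono-≤ (Σ-mono (λ S → f≤g (false ∷ S))) (Σ-mono (λ S → f≤g (true ∷ S)))

0≤Σ : ∀ {m} {f : Subset m → ℚ} → (∀ S → 0ℚ ≤ f S) → 0ℚ ≤ Σ f
0≤Σ {zero}  0≤f = 0≤f []
0≤Σ {suc m} 0≤f = 0≤+ (0≤Σ (λ S → 0≤f (false ∷ S))) (0≤Σ (λ S → 0≤f (true ∷ S)))

Σ-+ : ∀ {m} (f g : Subset m → ℚ) → Σ (λ S → f S + g S) ≡ Σ f + Σ g
Σ-+ {zero}  f g = refl
Σ-+ {suc m} f g = trans (cong₂ _+_ (Σ-+ (f ∘ (false ∷_)) (g ∘ (false ∷_))) (Σ-+ (f ∘ (true ∷_)) (g ∘ (true ∷_))))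
  (solve 4 (λ a b c d → (a :+ b) :+ (c :+ d) := (a :+ c) :+ (b :+ d)) refl
    (Σ (f ∘ (false ∷_))) (Σ (g ∘ (false ∷_))) (Σ (f ∘ (true ∷_))) (Σ (g ∘ (true ∷_))))

Σ-*ˡ : ∀ {m} c (f : Subset m → ℚ) → Σ (λ S → c · f S) ≡ c · Σ f
Σ-*ˡ {zero}  c f = refl
Σ-*ˡ {suc m} c f = trans (cong₂ _+_ (Σ-*ˡ c (f ∘ (false ∷_))) (Σ-*ˡ c (f ∘ (true ∷_))))
  (sym (ℚ.*-distribˡ-+ c (Σ (f ∘ (false ∷_))) (Σ (f ∘ (true ∷_)))))

Σ-swap : ∀ {m n} (f : Subset m → Subset n → ℚ) → Σ (λ S → Σ (f S)) ≡ Σ (λ T → Σ (λ S → f S T))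
Σ-swap {zero}  f = refl
Σ-swap {suc m} f = trans (cong₂ _+_ (Σ-swap (f ∘ (false ∷_))) (Σ-swap (f ∘ (true ∷_))))
  (sym (Σ-+ (λ T → Σ (λ S → f (false ∷ S) T)) (λ T → Σ (λ S → f (true ∷ S) T))))

Σ-zero : ∀ {m} {f : Subset m → ℚ} → (∀ S → f S ≡ 0ℚ) → Σ f ≡ 0ℚ
Σ-zero {zero}  f≡0 = f≡0 []
Σ-zero {suc m} f≡0 = cong₂ _+_ (Σ-zero (λ S → f≡0 (false ∷ S))) (Σ-zero (λ S → f≡0 (true ∷ S)))

Σ-only : ∀ {m} (f : Subset m → ℚ) T → (∀ S → S ≢ T → f S ≡ 0ℚ) → Σ f ≡ f T
Σ-only f []          f≡0 = refl
Σ-only f (false ∷ T) f≡0 = trans (cong₂ _+_ (Σ-only (f ∘ (false ∷_)) T (λ S S≢T → f≡0 (false ∷ S) (S≢T ∘ Vec.∷-injectiveʳ)))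
                                            (Σ-zero (λ S → f≡0 (true ∷ S) λ ())))
                                 (ℚ.+-identityʳ (f (false ∷ T)))
Σ-only f (true ∷ T)  f≡0 = trans (cong₂ _+_ (Σ-zero (λ S → f≡0 (false ∷ S) λ ()))
                                            (Σ-only (f ∘ (true ∷_)) T (λ S S≢T → f≡0 (true ∷ S) (S≢T ∘ Vec.∷-injectiveʳ))))
                                 (ℚ.+-identityˡ (f (true ∷ T)))

term≤Σ : ∀ {m} {f : Subset m → ℚ} → (∀ S → 0ℚ ≤ f S) → ∀ T → f T ≤ Σ f
term≤Σ         0≤f []          = ℚ.≤-refl
term≤Σ {f = f} 0≤f (false ∷ T) = ℚ.≤-trans (term≤Σ (0≤f ∘ (false ∷_)) T) (≤-by-+ (0≤Σ (0≤f ∘ (true ∷_))) refl)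
term≤Σ {f = f} 0≤f (true ∷ T)  = ℚ.≤-trans (term≤Σ (0≤f ∘ (true ∷_)) T)
  (≤-by-+ (0≤Σ (0≤f ∘ (false ∷_))) (ℚ.+-comm (Σ (f ∘ (true ∷_))) (Σ (f ∘ (false ∷_)))))

-- Inserting the indicator of T = `to S` and exchanging the sums reduces the reindexing to sums with
-- a single nonzero term.
Σ-bijection : ∀ {m} (f : Subset m → ℚ) {to from : Subset m → Subset m} →
  (∀ S → from (to S) ≡ S) → (∀ S → to (from S) ≡ S) → Σ (λ S → f (to S)) ≡ Σ f
Σ-bijection f {to} {from} from-to to-from = begin
  Σ (λ S → f (to S))                           ≡⟨ Σ-cong (λ S → sym (pick S)) ⟩
  Σ (λ S → Σ (λ T → 𝟙 (T ≟ˢ to S) · f T))      ≡⟨ Σ-swap (λ S T → 𝟙 (T ≟ˢ to S) · f T) ⟩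
  Σ (λ T → Σ (λ S → 𝟙 (T ≟ˢ to S) · f T))      ≡⟨ Σ-cong pick′ ⟩
  Σ f                                          ∎
  where
  open ≡-Reasoning
  pick : ∀ S → Σ (λ T → 𝟙 (T ≟ˢ to S) · f T) ≡ f (to S)
  pick S = trans (Σ-only _ (to S) (λ T T≢ → trans (cong (_· f T) (𝟙-no (T ≟ˢ to S) T≢)) (ℚ.*-zeroˡ (f T))))
    (trans (cong (_· f (to S)) (𝟙-yes (to S ≟ˢ to S) refl)) (ℚ.*-identityˡ (f (to S))))
  pick′ : ∀ T → Σ (λ S → 𝟙 (T ≟ˢ to S) · f T) ≡ f T
  pick′ T = trans (Σ-only _ (from T) (λ S S≢ → trans (cong (_· f T) (𝟙-no (T ≟ˢ to S) (λ eq → S≢ (trans (sym (from-to S)) (cong from (sym eq)))))) (ℚ.*-zeroˡ (f T))))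
    (trans (cong (_· f T) (𝟙-yes (T ≟ˢ to (from T)) (sym (to-from T)))) (ℚ.*-identityˡ (f T)))

argmax : ∀ {m} (f : Subset m → ℚ) → ∃ λ T → ∀ S → f S ≤ f T
argmax {zero}  f = [] , λ { [] → ℚ.≤-refl }
argmax {suc m} f with argmax (f ∘ (false ∷_)) | argmax (f ∘ (true ∷_))
... | T₀ , max₀ | T₁ , max₁ with ℚ.≤-total (f (false ∷ T₀)) (f (true ∷ T₁))
...   | inj₁ f₀≤f₁ = true ∷ T₁ , λ { (false ∷ S) → ℚ.≤-trans (max₀ S) f₀≤f₁ ; (true ∷ S) → max₁ S }
...   | inj₂ f₁≤f₀ = false ∷ T₀ , λ { (false ∷ S) → max₀ S ; (true ∷ S) → ℚ.≤-trans (max₁ S) f₁≤f₀ }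

-- W x A S is x ^ (∣ S ∣ - ∣ A ∣) if A ⊆ S, and 0 otherwise.
W : ∀ {m} → ℚ → Subset m → Subset m → ℚ
W x []          []          = 1ℚ
W x (false ∷ A) (false ∷ S) = W x A S
W x (false ∷ A) (true  ∷ S) = x · W x A S
W x (true  ∷ A) (true  ∷ S) = W x A S
W x (true  ∷ A) (false ∷ S) = 0ℚ

0≤W : ∀ {m x} (A S : Subset m) → 0ℚ ≤ x → 0ℚ ≤ W x A S
0≤W []          []          0≤x = 0≤1
0≤W (false ∷ A) (false ∷ S) 0≤x = 0≤W A S 0≤x
0≤W (false ∷ A) (true  ∷ S) 0≤x = 0≤* 0≤x (0≤W A S 0≤x)
0≤W (true  ∷ A) (true  ∷ S) 0≤x = 0≤W A S 0≤x
0≤W (true  ∷ A) (false ∷ S) 0≤x = ℚ.≤-refl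

-- The binomial theorem: an element of S contributes 1 if it lies in A and x if it does not.
Σ-W : ∀ {m} x (S : Subset m) → Σ (λ A → W x A S) ≡ (1ℚ + x) ^ ∣ S ∣
Σ-W x []          = refl
Σ-W x (false ∷ S) = trans (cong₂ _+_ (Σ-W x S) (Σ-zero {f = λ A → W x (true ∷ A) (false ∷ S)} (λ A → refl))) (ℚ.+-identityʳ _)
Σ-W x (true ∷ S)  = trans (cong₂ _+_ (trans (Σ-*ˡ x (λ A → W x A S)) (cong (x ·_) (Σ-W x S))) (Σ-W x S))
  (solve 2 (λ x p → x :* p :+ p := (con 1ℚ :+ x) :* p) refl x ((1ℚ + x) ^ ∣ S ∣))

-- Adding S to J creates ∣S∣ - ∣J ∩ S∣ new elements. The weight of a union thus splits into the
-- weight of J and a factor that sees J only through its intersection with S.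
W-∩ : ∀ {m} y (J S : Subset m) → y ^ ∣ J ∣ · W y (J ∩ S) S ≡ y ^ ∣ J ∪ S ∣
W-∩ y []          []          = refl
W-∩ y (false ∷ J) (false ∷ S) = W-∩ y J S
W-∩ y (false ∷ J) (true  ∷ S) = trans (solve 3 (λ y p w → p :* (y :* w) := y :* (p :* w)) refl y (y ^ ∣ J ∣) (W y (J ∩ S) S)) (cong (y ·_) (W-∩ y J S))
W-∩ y (true  ∷ J) (false ∷ S) = trans (ℚ.*-assoc y (y ^ ∣ J ∣) _) (cong (y ·_) (W-∩ y J S))
W-∩ y (true  ∷ J) (true  ∷ S) = trans (ℚ.*-assoc y (y ^ ∣ J ∣) _) (cong (y ·_) (W-∩ y J S))

-- For A ⊆ S, both sides are b^∣S∣ x^(∣S∣ - ∣A∣) times b^0. This turns a sum over intersections A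
-- weighted by b^∣A∣ into the binomial sum of `Σ-W`.
W-scale : ∀ {m} x b (A S : Subset m) → b ^ ∣ A ∣ · W (x · b) A S ≡ b ^ ∣ S ∣ · W x A S
W-scale x b []          []          = refl
W-scale x b (false ∷ A) (false ∷ S) = W-scale x b A S
W-scale x b (false ∷ A) (true  ∷ S) = begin
  b ^ ∣ A ∣ · (x · b · W (x · b) A S)    ≡⟨ solve 4 (λ p x b w → p :* (x :* b :* w) := x :* b :* (p :* w)) refl (b ^ ∣ A ∣) x b (W (x · b) A S) ⟩
  x · b · (b ^ ∣ A ∣ · W (x · b) A S)    ≡⟨ cong (x · b ·_) (W-scale x b A S) ⟩
  x · b · (b ^ ∣ S ∣ · W x A S)          ≡⟨ solve 4 (λ p x b w → x :* b :* (p :* w) := b :* p :* (x :* w)) refl (b ^ ∣ S ∣) x b (W x A S) ⟩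
  b · b ^ ∣ S ∣ · (x · W x A S)          ∎
  where open ≡-Reasoning
W-scale x b (true  ∷ A) (true  ∷ S) = trans (ℚ.*-assoc b (b ^ ∣ A ∣) _) (trans (cong (b ·_) (W-scale x b A S)) (sym (ℚ.*-assoc b (b ^ ∣ S ∣) _)))
W-scale x b (true  ∷ A) (false ∷ S) = trans (ℚ.*-zeroʳ (b · b ^ ∣ A ∣)) (sym (ℚ.*-zeroʳ (b ^ ∣ S ∣)))

true∷⊈false∷ : ∀ {m} {A S : Subset m} → ¬ (true ∷ A ⊆ false ∷ S)
true∷⊈false∷ A⊆S with A⊆S Vec.here
... | ()

W-⊆ : ∀ {m} x {A S : Subset m} → A ⊆ S → W x A S ≡ x ^ (∣ S ∣ ℕ.∸ ∣ A ∣)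
W-⊆ x {[]}        {[]}        A⊆S = refl
W-⊆ x {false ∷ A} {false ∷ S} A⊆S = W-⊆ x {A} {S} (drop-∷-⊆ A⊆S)
W-⊆ x {false ∷ A} {true  ∷ S} A⊆S = trans (cong (x ·_) (W-⊆ x {A} {S} (drop-∷-⊆ A⊆S)))
  (sym (cong (x ^_) (ℕ.+-∸-assoc 1 (p⊆q⇒∣p∣≤∣q∣ (drop-∷-⊆ A⊆S)))))
W-⊆ x {true  ∷ A} {true  ∷ S} A⊆S = W-⊆ x {A} {S} (drop-∷-⊆ A⊆S)
W-⊆ x {true  ∷ A} {false ∷ S} A⊆S = contradiction (λ {i} → A⊆S {i}) true∷⊈false∷

W-⊈ : ∀ {m} x {A S : Subset m} → ¬ (A ⊆ S) → W x A S ≡ 0ℚ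
W-⊈ x {[]}        {[]}        A⊈S = contradiction (λ {i} z → z) A⊈S
W-⊈ x {false ∷ A} {s ∷ S}     A⊈S with s | W-⊈ x {A} {S} (λ A⊆S → A⊈S (out⊆ A⊆S))
... | false | eq = eq
... | true  | eq = trans (cong (x ·_) eq) (ℚ.*-zeroʳ x)
W-⊈ x {true  ∷ A} {true  ∷ S} A⊈S = W-⊈ x {A} {S} (λ A⊆S → A⊈S (s⊆s A⊆S))
W-⊈ x {true  ∷ A} {false ∷ S} A⊈S = refl

-- Symmetries of the complete graph do not respect the coordinatewise recursion; in this closed form
-- the invariance of `W` can be read off from inclusion and size.
W-𝟙 : ∀ {m} x (A S : Subset m) → W x A S ≡ 𝟙 (A ⊆? S) · x ^ (∣ S ∣ ℕ.∸ ∣ A ∣)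
W-𝟙 x A S with A ⊆? S
... | yes A⊆S = trans (W-⊆ x A⊆S) (sym (ℚ.*-identityˡ _))
... | no  A⊈S = trans (W-⊈ x A⊈S) (sym (ℚ.*-zeroˡ (x ^ (∣ S ∣ ℕ.∸ ∣ A ∣))))

Σ-⊆ : ∀ {m} (S : Subset m) → Σ (λ A → 𝟙 (A ⊆? S)) ≡ fromℕ 2 ^ ∣ S ∣
Σ-⊆ S = trans (Σ-cong (λ A → sym (trans (W-𝟙 1ℚ A S) (trans (cong (𝟙 (A ⊆? S) ·_) (1^e≡1 (∣ S ∣ ℕ.∸ ∣ A ∣))) (ℚ.*-identityʳ _))))) (Σ-W 1ℚ S)

Σᶠ : ∀ {m} → (Fin m → ℚ) → ℚ
Σᶠ {zero}  f = 0ℚ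
Σᶠ {suc m} f = f zero + Σᶠ (f ∘ suc)

Σᶠ-cong : ∀ {m} {f g : Fin m → ℚ} → (∀ e → f e ≡ g e) → Σᶠ f ≡ Σᶠ g
Σᶠ-cong {zero}  f≗g = refl
Σᶠ-cong {suc m} f≗g = cong₂ _+_ (f≗g zero) (Σᶠ-cong (f≗g ∘ suc))

Σᶠ-mono : ∀ {m} {f g : Fin m → ℚ} → (∀ e → f e ≤ g e) → Σᶠ f ≤ Σᶠ g
Σᶠ-mono {zero}  f≤g = ℚ.≤-refl
Σᶠ-mono {suc m} f≤g = ℚ.+-mono-≤ (f≤g zero) (Σᶠ-mono (f≤g ∘ suc))

Σᶠ-*ʳ : ∀ {m} c (f : Fin m → ℚ) → Σᶠ (λ e → f e · c) ≡ Σᶠ f · c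
Σᶠ-*ʳ {zero}  c f = sym (ℚ.*-zeroˡ c)
Σᶠ-*ʳ {suc m} c f = trans (cong (f zero · c +_) (Σᶠ-*ʳ c (f ∘ suc))) (sym (ℚ.*-distribʳ-+ c (f zero) (Σᶠ (f ∘ suc))))

Σᶠ-∈ : ∀ {m} (S : Subset m) → Σᶠ (λ e → 𝟙 (e ∈? S)) ≡ fromℕ ∣ S ∣
Σᶠ-∈ []          = refl
Σᶠ-∈ (false ∷ S) = trans (ℚ.+-identityˡ _) (trans (Σᶠ-cong (λ e → 𝟙-⇔ (suc e ∈? false ∷ S) (e ∈? S) drop-there Vec.there)) (Σᶠ-∈ S))
Σᶠ-∈ (true ∷ S)  = trans (cong (1ℚ +_) (trans (Σᶠ-cong (λ e → 𝟙-⇔ (suc e ∈? true ∷ S) (e ∈? S) drop-there Vec.there)) (Σᶠ-∈ S))) (sym (fromℕ-suc ∣ S ∣))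

Σ-Σᶠ : ∀ {m n} (f : Subset m → Fin n → ℚ) → Σ (λ S → Σᶠ (f S)) ≡ Σᶠ (λ e → Σ (λ S → f S e))
Σ-Σᶠ {n = zero}  f = Σ-zero {f = λ S → Σᶠ (f S)} (λ S → refl)
Σ-Σᶠ {n = suc n} f = trans (Σ-+ (λ S → f S zero) (λ S → Σᶠ (f S ∘ suc))) (cong (Σ (λ S → f S zero) +_) (Σ-Σᶠ (λ S → f S ∘ suc)))

-- unionSum w t f J is the sum of w S₁ ⋯ w Sₜ f (J ∪ S₁ ∪ ⋯ ∪ Sₜ) over all S₁, …, Sₜ.
unionSum : ∀ {m} → (Subset m → ℚ) → ℕ → (Subset m → ℚ) → Subset m → ℚ
unionSum w zero    f J = f J
unionSum w (suc t) f J = Σ (λ S → w S · unionSum w t f (J ∪ S))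

module _ {m : ℕ} {w : Subset m → ℚ} (0≤w : ∀ S → 0ℚ ≤ w S) where

  unionSum-mono : ∀ t {f g} → (∀ J → f J ≤ g J) → ∀ J → unionSum w t f J ≤ unionSum w t g J
  unionSum-mono zero    f≤g J = f≤g J
  unionSum-mono (suc t) f≤g J = Σ-mono λ S → *-monoˡ (0≤w S) (unionSum-mono t f≤g (J ∪ S))

  -- Each further set costs at most a factor κ, whatever the union already is, so the factors
  -- accumulate to κ^t.
  unionSum-bound : ∀ t {f κ} → 0ℚ ≤ κ → (∀ J → Σ (λ S → w S · f (J ∪ S)) ≤ κ · f J) → ∀ J → unionSum w t f J ≤ κ ^ t · f J
  unionSum-bound zero    {f}     0≤κ le J = ℚ.≤-reflexive (sym (ℚ.*-identityˡ (f J)))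
  unionSum-bound (suc t) {f} {κ} 0≤κ le J = begin
    Σ (λ S → w S · unionSum w t f (J ∪ S))    ≤⟨ Σ-mono (λ S → *-monoˡ (0≤w S) (unionSum-bound t 0≤κ le (J ∪ S))) ⟩
    Σ (λ S → w S · (κ ^ t · f (J ∪ S)))       ≡⟨ Σ-cong (λ S → solve 3 (λ w k f → w :* (k :* f) := k :* (w :* f)) refl (w S) (κ ^ t) (f (J ∪ S))) ⟩
    Σ (λ S → κ ^ t · (w S · f (J ∪ S)))       ≡⟨ Σ-*ˡ (κ ^ t) (λ S → w S · f (J ∪ S)) ⟩
    κ ^ t · Σ (λ S → w S · f (J ∪ S))         ≤⟨ *-monoˡ (^-nonneg t 0≤κ) (le J) ⟩
    κ ^ t · (κ · f J)                         ≡⟨ solve 3 (λ a k f → a :* (k :* f) := k :* a :* f) refl (κ ^ t) κ (f J) ⟩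
    κ · κ ^ t · f J                           ∎
    where open ℚ.≤-Reasoning

module _ {m : ℕ} (w : Subset m → ℚ) where

  unionSum-cong : ∀ t {f g} → (∀ J → f J ≡ g J) → ∀ J → unionSum w t f J ≡ unionSum w t g J
  unionSum-cong zero    f≗g J = f≗g J
  unionSum-cong (suc t) f≗g J = Σ-cong λ S → cong (w S ·_) (unionSum-cong t f≗g (J ∪ S))

  unionSum-+ : ∀ t f g J → unionSum w t (λ J → f J + g J) J ≡ unionSum w t f J + unionSum w t g J
  unionSum-+ zero    f g J = refl
  unionSum-+ (suc t) f g J = trans
    (Σ-cong λ S → trans (cong (w S ·_) (unionSum-+ t f g (J ∪ S))) (ℚ.*-distribˡ-+ (w S) _ _))
    (Σ-+ (λ S → w S · unionSum w t f (J ∪ S)) (λ S → w S · unionSum w t g (J ∪ S)))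

  unionSum-*ˡ : ∀ t c f J → unionSum w t (λ J → c · f J) J ≡ c · unionSum w t f J
  unionSum-*ˡ zero    c f J = refl
  unionSum-*ˡ (suc t) c f J = trans
    (Σ-cong λ S → trans (cong (w S ·_) (unionSum-*ˡ t c f (J ∪ S)))
      (solve 3 (λ w c u → w :* (c :* u) := c :* (w :* u)) refl (w S) c (unionSum w t f (J ∪ S))))
    (Σ-*ˡ c (λ S → w S · unionSum w t f (J ∪ S)))

  unionSum-Σᶠ : ∀ {n} t (f : Fin n → Subset m → ℚ) J → unionSum w t (λ J → Σᶠ (λ e → f e J)) J ≡ Σᶠ (λ e → unionSum w t (f e) J)
  unionSum-Σᶠ zero    f J = refl
  unionSum-Σᶠ (suc t) f J = trans
    (Σ-cong λ S → trans (cong (w S ·_) (unionSum-Σᶠ t f (J ∪ S)))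
      (trans (ℚ.*-comm (w S) (Σᶠ (λ e → unionSum w t (f e) (J ∪ S)))) (trans (sym (Σᶠ-*ʳ (w S) (λ e → unionSum w t (f e) (J ∪ S)))) (Σᶠ-cong (λ e → ℚ.*-comm (unionSum w t (f e) (J ∪ S)) (w S))))))
    (Σ-Σᶠ (λ S e → w S · unionSum w t (f e) (J ∪ S)))

  -- A multiplicative f sees the t sets independently. The main case is the indicator that the union
  -- misses a fixed edge.
  unionSum-multiplicative : ∀ t {f} → (∀ J S → f (J ∪ S) ≡ f J · f S) → ∀ J → unionSum w t f J ≡ f J · Σ (λ S → w S · f S) ^ t
  unionSum-multiplicative zero    {f} f-∪ J = sym (ℚ.*-identityʳ (f J))
  unionSum-multiplicative (suc t) {f} f-∪ J = begin
    Σ (λ S → w S · unionSum w t f (J ∪ S))        ≡⟨ Σ-cong (λ S → cong (w S ·_) (trans (unionSum-multiplicative t f-∪ (J ∪ S)) (cong (_· c ^ t) (f-∪ J S)))) ⟩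
    Σ (λ S → w S · (f J · f S · c ^ t))           ≡⟨ Σ-cong (λ S → solve 4 (λ w a b p → w :* (a :* b :* p) := a :* p :* (w :* b)) refl (w S) (f J) (f S) (c ^ t)) ⟩
    Σ (λ S → f J · c ^ t · (w S · f S))           ≡⟨ Σ-*ˡ (f J · c ^ t) (λ S → w S · f S) ⟩
    f J · c ^ t · c                               ≡⟨ solve 3 (λ a p c → a :* p :* c := a :* (c :* p)) refl (f J) (c ^ t) c ⟩
    f J · (c · c ^ t)                             ∎
    where
    open ≡-Reasoning
    c = Σ (λ S → w S · f S)

reciprocal : ∀ {x} → 0ℚ < x → ∃ λ y → 0ℚ < y × x · y ≡ 1ℚ
reciprocal {x} 0<x = ℚ.1/ x , ℚ.positive⁻¹ _ {{ℚ.1/pos⇒pos x}} , ℚ.*-inverseʳ x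
  where instance
  _ = positive 0<x
  _ = ℚ.pos⇒nonZero x

Σ-*ʳ : ∀ {m} c (f : Subset m → ℚ) → Σ (λ S → f S · c) ≡ Σ f · c
Σ-*ʳ c f = trans (Σ-cong (λ S → ℚ.*-comm (f S) c)) (trans (Σ-*ˡ c f) (ℚ.*-comm c (Σ f)))

-- Unions that cover half of H

∣∣≤∣∣+∣-∣ : ∀ {m} (H J : Subset m) → ∣ H ∣ ℕ.≤ ∣ J ∣ ℕ.+ ∣ H ∩ ∁ J ∣
∣∣≤∣∣+∣-∣ []          []          = ℕ.z≤n
∣∣≤∣∣+∣-∣ (false ∷ H) (false ∷ J) = ∣∣≤∣∣+∣-∣ H J
∣∣≤∣∣+∣-∣ (false ∷ H) (true  ∷ J) = ℕ.m≤n⇒m≤1+n (∣∣≤∣∣+∣-∣ H J)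
∣∣≤∣∣+∣-∣ (true  ∷ H) (false ∷ J) = subst (suc ∣ H ∣ ℕ.≤_) (sym (ℕ.+-suc ∣ J ∣ ∣ H ∩ ∁ J ∣)) (ℕ.s≤s (∣∣≤∣∣+∣-∣ H J))
∣∣≤∣∣+∣-∣ (true  ∷ H) (true  ∷ J) = ℕ.s≤s (∣∣≤∣∣+∣-∣ H J)

module _ {m : ℕ} (H : Subset m) where

  missing : Subset m → ℚ
  missing J = Σᶠ λ e → 𝟙 (e ∈? H) · 𝟙 (¬? (e ∈? J))

  missing≡ : ∀ J → missing J ≡ fromℕ ∣ H ∩ ∁ J ∣
  missing≡ J = trans (Σᶠ-cong λ e → 𝟙-∧ (e ∈? H) (¬? (e ∈? J)) (e ∈? H ∩ ∁ J)
      (λ e∈H e∉J → x∈p∩q⁺ (e∈H , x∉p⇒x∈∁p e∉J))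
      (λ e∈ → proj₁ (x∈p∩q⁻ H (∁ J) e∈))
      (λ e∈ → x∈∁p⇒x∉p (proj₂ (x∈p∩q⁻ H (∁ J) e∈))))
    (Σᶠ-∈ (H ∩ ∁ J))

  -- If J misses at most half of H, then ∣J∣ ≥ ∣H∣/2 and the first term suffices; otherwise the
  -- second does. The dichotomy is packed into one inequality, linear in the two functions of J, so
  -- that it can be averaged over all tuples.
  large-or-missing : ∀ J → fromℕ ∣ H ∣ · 16ℚ ^ ∣ H ∣ ≤ fromℕ ∣ H ∣ · 256ℚ ^ ∣ J ∣ + 2ℚ · 16ℚ ^ ∣ H ∣ · missing J
  large-or-missing J = subst (λ u → fromℕ ∣ H ∣ · 16ℚ ^ ∣ H ∣ ≤ fromℕ ∣ H ∣ · 256ℚ ^ ∣ J ∣ + 2ℚ · 16ℚ ^ ∣ H ∣ · u) (sym (missing≡ J)) bound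
    where
    open ℚ.≤-Reasoning
    u = ∣ H ∩ ∁ J ∣
    bound : fromℕ ∣ H ∣ · 16ℚ ^ ∣ H ∣ ≤ fromℕ ∣ H ∣ · 256ℚ ^ ∣ J ∣ + 2ℚ · 16ℚ ^ ∣ H ∣ · fromℕ u
    bound with ℕ.≤-total ∣ H ∣ (2 ℕ.* u)
    ... | inj₁ N≤2u = begin
      fromℕ ∣ H ∣ · 16ℚ ^ ∣ H ∣                 ≤⟨ *-monoʳ (^-nonneg ∣ H ∣ (0≤fromℕ 16)) (fromℕ-mono N≤2u) ⟩
      fromℕ (2 ℕ.* u) · 16ℚ ^ ∣ H ∣         ≡⟨ cong (_· 16ℚ ^ ∣ H ∣) (fromℕ-* 2 u) ⟩
      2ℚ · fromℕ u · 16ℚ ^ ∣ H ∣            ≤⟨ ≤-by-+ (0≤* (0≤fromℕ ∣ H ∣) (^-nonneg ∣ J ∣ (0≤fromℕ 256)))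
                                             (solve 3 (λ u p z → con 2ℚ :* u :* p :+ z := z :+ con 2ℚ :* p :* u) refl (fromℕ u) (16ℚ ^ ∣ H ∣) (fromℕ ∣ H ∣ · 256ℚ ^ ∣ J ∣)) ⟩
      fromℕ ∣ H ∣ · 256ℚ ^ ∣ J ∣ + 2ℚ · 16ℚ ^ ∣ H ∣ · fromℕ u ∎
    ... | inj₂ 2u≤N = begin
      fromℕ ∣ H ∣ · 16ℚ ^ ∣ H ∣                 ≤⟨ *-monoˡ (0≤fromℕ ∣ H ∣) (^-monoʳ (1≤fromℕ 16) N≤2J) ⟩
      fromℕ ∣ H ∣ · 16ℚ ^ (2 ℕ.* ∣ J ∣)      ≡⟨ cong (fromℕ ∣ H ∣ ·_) (sym (^-assocʳ 16ℚ 2 ∣ J ∣)) ⟩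
      fromℕ ∣ H ∣ · 256ℚ ^ ∣ J ∣            ≤⟨ ≤-by-+ (0≤* (0≤* (0≤fromℕ 2) (^-nonneg ∣ H ∣ (0≤fromℕ 16))) (0≤fromℕ u)) refl ⟩
      fromℕ ∣ H ∣ · 256ℚ ^ ∣ J ∣ + 2ℚ · 16ℚ ^ ∣ H ∣ · fromℕ u ∎
      where
      N≤2J : ∣ H ∣ ℕ.≤ 2 ℕ.* ∣ J ∣
      N≤2J = ℕ.+-cancelʳ-≤ ∣ H ∣ ∣ H ∣ (2 ℕ.* ∣ J ∣) (ℕ.≤-trans
        (subst (ℕ._≤ 2 ℕ.* (∣ J ∣ ℕ.+ u)) (cong (∣ H ∣ ℕ.+_) (ℕ.+-identityʳ ∣ H ∣)) (ℕ.*-monoʳ-≤ 2 (∣∣≤∣∣+∣-∣ H J)))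
        (subst (ℕ._≤ 2 ℕ.* ∣ J ∣ ℕ.+ ∣ H ∣) (sym (ℕ.*-distribˡ-+ 2 ∣ J ∣ u)) (ℕ.+-monoʳ-≤ (2 ℕ.* ∣ J ∣) 2u≤N)))

  -- Each edge of H is missed by at most a quarter of the t-tuples, so half of H is missed
  -- by at most half of them.
  union-large : .{{_ : ℕ.NonZero ∣ H ∣}} {w : Subset m → ℚ} → (∀ S → 0ℚ ≤ w S) → ∀ t →
    (∀ e → e ∈ H → 4ℚ · Σ (λ S → w S · 𝟙 (¬? (e ∈? S))) ^ t ≤ Σ w ^ t) →
    16ℚ ^ ∣ H ∣ · Σ w ^ t ≤ 2ℚ · unionSum w t (λ J → 256ℚ ^ ∣ J ∣) ⊥
  -- Doubling `average` leaves a missing term that is, by `4U≤`, at most one of the two equal terms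
  -- on the left, so these cancel.
  union-large {w} 0≤w t rare = *-cancelˡ (0<fromℕ ∣ H ∣) (+-cancelˡ (fromℕ ∣ H ∣ · (P · n)) (begin
    fromℕ ∣ H ∣ · (P · n) + fromℕ ∣ H ∣ · (P · n)              ≡⟨ solve 3 (λ N P n → N :* (P :* n) :+ N :* (P :* n) := con 2ℚ :* (N :* P :* n)) refl (fromℕ ∣ H ∣) P n ⟩
    2ℚ · (fromℕ ∣ H ∣ · P · n)                             ≤⟨ *-monoˡ (0≤fromℕ 2) average ⟩
    2ℚ · (fromℕ ∣ H ∣ · Z + 2ℚ · P · U)                    ≡⟨ solve 4 (λ N Z P U → con 2ℚ :* (N :* Z :+ con 2ℚ :* P :* U) := P :* (con 4ℚ :* U) :+ N :* (con 2ℚ :* Z)) refl (fromℕ ∣ H ∣) Z P U ⟩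
    P · (4ℚ · U) + fromℕ ∣ H ∣ · (2ℚ · Z)                  ≤⟨ ℚ.+-monoˡ-≤ (fromℕ ∣ H ∣ · (2ℚ · Z)) (*-monoˡ (^-nonneg ∣ H ∣ (0≤fromℕ 16)) 4U≤) ⟩
    P · (fromℕ ∣ H ∣ · n) + fromℕ ∣ H ∣ · (2ℚ · Z)             ≡⟨ cong (_+ fromℕ ∣ H ∣ · (2ℚ · Z)) (solve 3 (λ N P n → P :* (N :* n) := N :* (P :* n)) refl (fromℕ ∣ H ∣) P n) ⟩
    fromℕ ∣ H ∣ · (P · n) + fromℕ ∣ H ∣ · (2ℚ · Z)             ∎))
    where
    open ℚ.≤-Reasoning
    P = 16ℚ ^ ∣ H ∣
    n = Σ w ^ t
    Z = unionSum w t (λ J → 256ℚ ^ ∣ J ∣) ⊥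
    U = unionSum w t missing ⊥
    missed : Fin m → ℚ
    missed e = unionSum w t (λ J → 𝟙 (¬? (e ∈? J))) ⊥
    missed≡ : ∀ e → missed e ≡ Σ (λ S → w S · 𝟙 (¬? (e ∈? S))) ^ t
    missed≡ e = trans (unionSum-multiplicative w t {λ J → 𝟙 (¬? (e ∈? J))} (λ J S → sym (𝟙-∧ (¬? (e ∈? J)) (¬? (e ∈? S)) (¬? (e ∈? J ∪ S))
        (λ e∉J e∉S e∈ → [ e∉J , e∉S ]′ (x∈p∪q⁻ J S e∈))
        (λ e∉ e∈J → e∉ (x∈p∪q⁺ (inj₁ e∈J)))
        (λ e∉ e∈S → e∉ (x∈p∪q⁺ (inj₂ e∈S))))) ⊥)
      (trans (cong (_· Σ (λ S → w S · 𝟙 (¬? (e ∈? S))) ^ t) (𝟙-yes (¬? (e ∈? ⊥)) ∉⊥)) (ℚ.*-identityˡ _))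
    constant : ∀ c → unionSum w t (λ _ → c) ⊥ ≡ c · n
    constant c = begin-equality
      unionSum w t (λ _ → c) ⊥           ≡⟨ unionSum-cong w t (λ _ → sym (ℚ.*-identityʳ c)) ⊥ ⟩
      unionSum w t (λ _ → c · 1ℚ) ⊥      ≡⟨ unionSum-*ˡ w t c (λ _ → 1ℚ) ⊥ ⟩
      c · unionSum w t (λ _ → 1ℚ) ⊥      ≡⟨ cong (c ·_) (unionSum-multiplicative w t {λ _ → 1ℚ} (λ _ _ → refl) ⊥) ⟩
      c · (1ℚ · Σ (λ S → w S · 1ℚ) ^ t)  ≡⟨ cong (c ·_) (ℚ.*-identityˡ _) ⟩
      c · Σ (λ S → w S · 1ℚ) ^ t         ≡⟨ cong (λ z → c · z ^ t) (Σ-cong (λ S → ℚ.*-identityʳ (w S))) ⟩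
      c · n                              ∎
    U≡ : U ≡ Σᶠ (λ e → 𝟙 (e ∈? H) · missed e)
    U≡ = trans (unionSum-Σᶠ w t (λ e J → 𝟙 (e ∈? H) · 𝟙 (¬? (e ∈? J))) ⊥)
      (Σᶠ-cong λ e → unionSum-*ˡ w t (𝟙 (e ∈? H)) (λ J → 𝟙 (¬? (e ∈? J))) ⊥)
    4U≤ : 4ℚ · U ≤ fromℕ ∣ H ∣ · n
    4U≤ = begin
      4ℚ · U                                            ≡⟨ trans (cong (4ℚ ·_) U≡) (ℚ.*-comm 4ℚ (Σᶠ (λ e → 𝟙 (e ∈? H) · missed e))) ⟩
      Σᶠ (λ e → 𝟙 (e ∈? H) · missed e) · 4ℚ             ≡⟨ sym (Σᶠ-*ʳ 4ℚ (λ e → 𝟙 (e ∈? H) · missed e)) ⟩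
      Σᶠ (λ e → 𝟙 (e ∈? H) · missed e · 4ℚ)             ≡⟨ Σᶠ-cong (λ e → solve 2 (λ i z → i :* z :* con 4ℚ := i :* (con 4ℚ :* z)) refl (𝟙 (e ∈? H)) (missed e)) ⟩
      Σᶠ (λ e → 𝟙 (e ∈? H) · (4ℚ · missed e))           ≤⟨ Σᶠ-mono (λ e → 𝟙*-mono (e ∈? H) (λ e∈H → subst (λ z → 4ℚ · z ≤ n) (sym (missed≡ e)) (rare e e∈H))) ⟩
      Σᶠ (λ e → 𝟙 (e ∈? H) · n)                         ≡⟨ Σᶠ-*ʳ n (λ e → 𝟙 (e ∈? H)) ⟩
      Σᶠ (λ e → 𝟙 (e ∈? H)) · n                         ≡⟨ cong (_· n) (Σᶠ-∈ H) ⟩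
      fromℕ ∣ H ∣ · n                                       ∎
    average : fromℕ ∣ H ∣ · P · n ≤ fromℕ ∣ H ∣ · Z + 2ℚ · P · U
    average = begin
      fromℕ ∣ H ∣ · P · n                                   ≡⟨ sym (constant (fromℕ ∣ H ∣ · P)) ⟩
      unionSum w t (λ _ → fromℕ ∣ H ∣ · P) ⊥                ≤⟨ unionSum-mono 0≤w t large-or-missing ⊥ ⟩
      unionSum w t (λ J → fromℕ ∣ H ∣ · 256ℚ ^ ∣ J ∣ + 2ℚ · P · missing J) ⊥
                                                        ≡⟨ unionSum-+ w t (λ J → fromℕ ∣ H ∣ · 256ℚ ^ ∣ J ∣) (λ J → 2ℚ · P · missing J) ⊥ ⟩
      unionSum w t (λ J → fromℕ ∣ H ∣ · 256ℚ ^ ∣ J ∣) ⊥ + unionSum w t (λ J → 2ℚ · P · missing J) ⊥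
                                                        ≡⟨ cong₂ _+_ (unionSum-*ˡ w t (fromℕ ∣ H ∣) (λ J → 256ℚ ^ ∣ J ∣) ⊥) (unionSum-*ˡ w t (2ℚ · P) missing ⊥) ⟩
      fromℕ ∣ H ∣ · Z + 2ℚ · P · U                          ∎

x∉p-x : ∀ {m} (p : Subset m) x → x ∉ p -ˢ x
x∉p-x (_     ∷ p) zero    ()
x∉p-x (false ∷ p) (suc x) (there x∈) = x∉p-x p x x∈
x∉p-x (true  ∷ p) (suc x) (there x∈) = x∉p-x p x x∈

-- Copies

-- Copies are counted for an abstract isomorphism relation on edge sets.  All that is used of graph
-- isomorphism is that isomorphic edge sets are exchanged by symmetries of the complete graph.
record Automorphism {m} (_~_ : Rel (Subset m) 0ℓ) : Set where
  field
    to from   : Subset m → Subset m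
    from-to   : ∀ S → from (to S) ≡ S
    to-from   : ∀ S → to (from S) ≡ S
    to-mono   : ∀ {S T} → S ⊆ T → to S ⊆ to T
    from-mono : ∀ {S T} → S ⊆ T → from S ⊆ from T
    to-~      : ∀ S → to S ~ S

  to-cancel-⊆ : ∀ {S T} → to S ⊆ to T → S ⊆ T
  to-cancel-⊆ {S} {T} p = subst₂ _⊆_ (from-to S) (from-to T) (from-mono p)

record Isomorphism (m : ℕ) : Set₁ where
  infix 4 _~_ _~?_
  field
    _~_          : Rel (Subset m) 0ℓ
    _~?_         : ∀ A B → Dec (A ~ B)
    ~-refl       : Reflexive _~_
    ~-sym        : Symmetric _~_
    ~-trans      : Transitive _~_
    automorphism : ∀ {A B} → A ~ B → ∃ λ (α : Automorphism _~_) → Automorphism.to α A ≡ B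

module Counting {m : ℕ} (iso : Isomorphism m) where

  open Isomorphism iso
  open Automorphism

  Σ-automorphism : ∀ (α : Automorphism _~_) (f : Subset m → ℚ) → Σ (λ S → f (to α S)) ≡ Σ f
  Σ-automorphism α f = Σ-bijection f {to α} {from α} (from-to α) (to-from α)

  total : Subset m → ℚ
  total A = Σ λ S → 𝟙 (S ~? A)

  count : (A H : Subset m) → ℚ
  count A H = Σ λ S → 𝟙 (S ~? A) · 𝟙 (S ⊆? H)

  extensions : (H J : Subset m) → ℚ
  extensions H J = Σ λ S → 𝟙 (S ~? H) · 𝟙 (J ⊆? S)

  0≤count : ∀ A H → 0ℚ ≤ count A H
  0≤count A H = 0≤Σ λ S → 0≤* (0≤𝟙 (S ~? A)) (0≤𝟙 (S ⊆? H))

  1≤total : ∀ A → 1ℚ ≤ total A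
  1≤total A = subst (_≤ total A) (𝟙-yes (A ~? A) ~-refl) (term≤Σ (λ S → 0≤𝟙 (S ~? A)) A)

  0<total : ∀ A → 0ℚ < total A
  0<total A = ℚ.<-≤-trans 0<1 (1≤total A)

  -- Counting subsets of A and of B shows 2 ^ ∣ A ∣ = 2 ^ ∣ B ∣.
  ~⇒∣∣≡ : ∀ {A B} → A ~ B → ∣ A ∣ ≡ ∣ B ∣
  ~⇒∣∣≡ {A} {B} A~B with automorphism A~B
  ... | α , refl = ℕ.≤-antisym (ℕ.≮⇒≥ (λ lt → irrefl lt (sym eq))) (ℕ.≮⇒≥ (λ lt → irrefl lt eq))
    where
    eq : fromℕ 2 ^ ∣ A ∣ ≡ fromℕ 2 ^ ∣ to α A ∣
    eq = begin
      fromℕ 2 ^ ∣ A ∣                      ≡⟨ sym (Σ-⊆ A) ⟩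
      Σ (λ S → 𝟙 (S ⊆? A))                 ≡⟨ Σ-cong (λ S → 𝟙-⇔ (S ⊆? A) (to α S ⊆? to α A) (to-mono α) (to-cancel-⊆ α)) ⟩
      Σ (λ S → 𝟙 (to α S ⊆? to α A))       ≡⟨ Σ-automorphism α (λ S → 𝟙 (S ⊆? to α A)) ⟩
      Σ (λ S → 𝟙 (S ⊆? to α A))            ≡⟨ Σ-⊆ (to α A) ⟩
      fromℕ 2 ^ ∣ to α A ∣                 ∎
      where open ≡-Reasoning
    1<2 : 1ℚ < fromℕ 2
    1<2 = ℚ.+-monoʳ-< 1ℚ 0<1
    irrefl : ∀ {a b} → a ℕ.< b → ¬ (fromℕ 2 ^ a ≡ fromℕ 2 ^ b)
    irrefl {a} {b} a<b eq = ℚ.<-irrefl eq (ℚ.<-≤-trans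
      (subst (_< fromℕ 2 · fromℕ 2 ^ a) (ℚ.*-identityˡ (fromℕ 2 ^ a)) (ℚ.*-monoˡ-<-pos (fromℕ 2 ^ a) {{positive (^-pos a (0<fromℕ 2))}} 1<2))
      (^-monoʳ (ℚ.<⇒≤ 1<2) a<b))

  total-cong : ∀ {A B} → A ~ B → total A ≡ total B
  total-cong {A} {B} A~B = Σ-cong λ S → 𝟙-⇔ (S ~? A) (S ~? B) (λ p → ~-trans p A~B) (λ p → ~-trans p (~-sym A~B))

  module _ (α : Automorphism _~_) where

    to-~?⇔ : ∀ S A → 𝟙 (S ~? A) ≡ 𝟙 (to α S ~? A)
    to-~?⇔ S A = 𝟙-⇔ (S ~? A) (to α S ~? A) (~-trans (to-~ α S)) (~-trans (~-sym (to-~ α S)))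

    to-⊆?⇔ : ∀ S T → 𝟙 (S ⊆? T) ≡ 𝟙 (to α S ⊆? to α T)
    to-⊆?⇔ S T = 𝟙-⇔ (S ⊆? T) (to α S ⊆? to α T) (to-mono α) (to-cancel-⊆ α)

  count-congʳ : ∀ A {G H} → G ~ H → count A G ≡ count A H
  count-congʳ A {G} G~H with automorphism G~H
  ... | α , refl = trans (Σ-cong λ S → cong₂ _·_ (to-~?⇔ α S A) (to-⊆?⇔ α S G))
                         (Σ-automorphism α (λ S → 𝟙 (S ~? A) · 𝟙 (S ⊆? to α G)))

  extensions-cong : ∀ H {J K} → J ~ K → extensions H J ≡ extensions H K
  extensions-cong H {J} J~K with automorphism J~K
  ... | α , refl = trans (Σ-cong λ S → cong₂ _·_ (to-~?⇔ α S H) (to-⊆?⇔ α J S))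
                         (Σ-automorphism α (λ S → 𝟙 (S ~? H) · 𝟙 (to α J ⊆? S)))

  weightedExtensions : ℚ → (I A : Subset m) → ℚ
  weightedExtensions y I A = Σ λ S → 𝟙 (S ~? I) · W y A S

  weightedExtensions-cong : ∀ y I {A B} → A ~ B → weightedExtensions y I A ≡ weightedExtensions y I B
  weightedExtensions-cong y I {A} A~B with automorphism A~B
  ... | α , refl = trans (Σ-cong λ S → cong₂ _·_ (to-~?⇔ α S I) (W-to S))
                         (Σ-automorphism α (λ S → 𝟙 (S ~? I) · W y (to α A) S))
    where
    W-to : ∀ S → W y A S ≡ W y (to α A) (to α S)
    W-to S = trans (W-𝟙 y A S) (trans
      (cong₂ (λ a b → a · y ^ b) (to-⊆?⇔ α A S) (sym (cong₂ ℕ._∸_ (~⇒∣∣≡ (to-~ α S)) (~⇒∣∣≡ (to-~ α A)))))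
      (sym (W-𝟙 y (to α A) (to α S))))

  -- Pairs of a copy K of J and a copy G of H with K ⊆ G are counted by K and by G. For J = A this
  -- gives the probability in the spread condition; for J a union of copies of I it gives the rarity
  -- of J in `extensions-bound`.
  extensions*total≡total*count : ∀ H J → extensions H J · total J ≡ total H · count J H
  extensions*total≡total*count H J = begin
    extensions H J · total J                                        ≡⟨ ℚ.*-comm (extensions H J) (total J) ⟩
    total J · extensions H J                                        ≡⟨ sym (Σ-*ʳ (extensions H J) (λ K → 𝟙 (K ~? J))) ⟩
    Σ (λ K → 𝟙 (K ~? J) · extensions H J)                           ≡⟨ Σ-cong (λ K → 𝟙*-cong (K ~? J) (λ K~J → extensions-cong H (~-sym K~J))) ⟩
    Σ (λ K → 𝟙 (K ~? J) · extensions H K)                           ≡⟨ Σ-cong (λ K → sym (Σ-*ˡ (𝟙 (K ~? J)) (λ G → 𝟙 (G ~? H) · 𝟙 (K ⊆? G)))) ⟩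
    Σ (λ K → Σ (λ G → 𝟙 (K ~? J) · (𝟙 (G ~? H) · 𝟙 (K ⊆? G))))      ≡⟨ Σ-swap (λ K G → 𝟙 (K ~? J) · (𝟙 (G ~? H) · 𝟙 (K ⊆? G))) ⟩
    Σ (λ G → Σ (λ K → 𝟙 (K ~? J) · (𝟙 (G ~? H) · 𝟙 (K ⊆? G))))      ≡⟨ Σ-cong (λ G → Σ-cong (λ K → solve 3 (λ a b c → a :* (b :* c) := b :* (a :* c)) refl (𝟙 (K ~? J)) (𝟙 (G ~? H)) (𝟙 (K ⊆? G)))) ⟩
    Σ (λ G → Σ (λ K → 𝟙 (G ~? H) · (𝟙 (K ~? J) · 𝟙 (K ⊆? G))))      ≡⟨ Σ-cong (λ G → Σ-*ˡ (𝟙 (G ~? H)) (λ K → 𝟙 (K ~? J) · 𝟙 (K ⊆? G))) ⟩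
    Σ (λ G → 𝟙 (G ~? H) · count J G)                                ≡⟨ Σ-cong (λ G → 𝟙*-cong (G ~? H) (count-congʳ J)) ⟩
    Σ (λ G → 𝟙 (G ~? H) · count J H)                                ≡⟨ Σ-*ʳ (count J H) (λ G → 𝟙 (G ~? H)) ⟩
    total H · count J H                                             ∎
    where open ≡-Reasoning

  count≤2^ : ∀ A H → count A H ≤ fromℕ 2 ^ ∣ H ∣
  count≤2^ A H = subst (count A H ≤_) (Σ-⊆ H) (Σ-mono λ S → subst (𝟙 (S ~? A) · 𝟙 (S ⊆? H) ≤_) (ℚ.*-identityˡ (𝟙 (S ⊆? H)))
    (*-monoʳ (0≤𝟙 (S ⊆? H)) (𝟙≤1 (S ~? A))))

  count-small : ∀ A H → ∣ H ∣ ℕ.< ∣ A ∣ → count A H ≡ 0ℚ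
  count-small A H lt = Σ-zero λ S → trans (𝟙*-cong (S ~? A) (λ S~A → 𝟙-no (S ⊆? H) (λ S⊆H →
    ℕ.<⇒≱ lt (subst (ℕ._≤ ∣ H ∣) (~⇒∣∣≡ S~A) (p⊆q⇒∣p∣≤∣q∣ S⊆H))))) (ℚ.*-zeroʳ (𝟙 (S ~? A)))

  count≤total : ∀ A H → count A H ≤ total A
  count≤total A H = Σ-mono λ S → subst (𝟙 (S ~? A) · 𝟙 (S ⊆? H) ≤_) (ℚ.*-identityʳ _) (*-monoˡ (0≤𝟙 (S ~? A)) (𝟙≤1 (S ⊆? H)))

  -- The polynomial form of q ≥ q_H: it involves no roots and is inherited by subgraphs, as the
  -- induction requires. The empty J, absent from the maximum q_H, satisfies it trivially.
  Sparse : ℚ → Subset m → Set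
  Sparse q H = ∀ J → J ⊆ H → 1ℚ ≤ total J · q ^ ∣ J ∣

  sparse-⊆ : ∀ {q G H} → G ⊆ H → Sparse q H → Sparse q G
  sparse-⊆ G⊆H sparse J J⊆G = sparse J (⊆-trans J⊆G G⊆H)

  sparse-cong : ∀ {q G H} → G ~ H → Sparse q H → Sparse q G
  sparse-cong {q} {G} G~H sparse J J⊆G with automorphism G~H
  ... | α , refl = subst₂ (λ t k → 1ℚ ≤ t · q ^ k) (total-cong (to-~ α J)) (~⇒∣∣≡ (to-~ α J)) (sparse (to α J) (to-mono α J⊆G))

  inverseTotal : Subset m → ℚ
  inverseTotal A = proj₁ (reciprocal (0<total A))

  0≤inverseTotal : ∀ A → 0ℚ ≤ inverseTotal A
  0≤inverseTotal A = ℚ.<⇒≤ (proj₁ (proj₂ (reciprocal (0<total A))))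

  total*inverseTotal : ∀ A → total A · inverseTotal A ≡ 1ℚ
  total*inverseTotal A = proj₂ (proj₂ (reciprocal (0<total A)))

  inverseTotal-cong : ∀ {A B} → A ~ B → inverseTotal A ≡ inverseTotal B
  inverseTotal-cong {A} {B} A~B = begin
    inverseTotal A                                 ≡⟨ sym (ℚ.*-identityʳ (inverseTotal A)) ⟩
    inverseTotal A · 1ℚ                            ≡⟨ cong (inverseTotal A ·_) (sym (total*inverseTotal B)) ⟩
    inverseTotal A · (total B · inverseTotal B)    ≡⟨ cong (λ t → inverseTotal A · (t · inverseTotal B)) (sym (total-cong A~B)) ⟩
    inverseTotal A · (total A · inverseTotal B)    ≡⟨ solve 3 (λ a t b → a :* (t :* b) := t :* a :* b) refl (inverseTotal A) (total A) (inverseTotal B) ⟩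
    total A · inverseTotal A · inverseTotal B      ≡⟨ cong (_· inverseTotal B) (total*inverseTotal A) ⟩
    1ℚ · inverseTotal B                            ≡⟨ ℚ.*-identityˡ (inverseTotal B) ⟩
    inverseTotal B                                 ∎
    where open ≡-Reasoning

  -- Each A ⊆ G is averaged over the copies of A.
  Σ-subgraphs : ∀ {G H} → G ~ H → (f : Subset m → ℚ) → (∀ {A B} → A ~ B → f A ≡ f B) →
    Σ (λ A → 𝟙 (A ⊆? G) · f A) ≡ Σ (λ A → count A H · (inverseTotal A · f A))
  Σ-subgraphs {G} {H} G~H f f-cong = sym (begin
    Σ (λ A → count A H · g A)                                   ≡⟨ Σ-cong (λ A → cong (_· g A) (sym (count-congʳ A G~H))) ⟩
    Σ (λ A → count A G · g A)                                   ≡⟨ Σ-cong (λ A → sym (Σ-*ʳ (g A) (λ B → 𝟙 (B ~? A) · 𝟙 (B ⊆? G)))) ⟩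
    Σ (λ A → Σ (λ B → 𝟙 (B ~? A) · 𝟙 (B ⊆? G) · g A))           ≡⟨ Σ-swap (λ A B → 𝟙 (B ~? A) · 𝟙 (B ⊆? G) · g A) ⟩
    Σ (λ B → Σ (λ A → 𝟙 (B ~? A) · 𝟙 (B ⊆? G) · g A))           ≡⟨ Σ-cong (λ B → Σ-cong (λ A → move A B)) ⟩
    Σ (λ B → Σ (λ A → 𝟙 (A ~? B) · (𝟙 (B ⊆? G) · g B)))         ≡⟨ Σ-cong (λ B → Σ-*ʳ (𝟙 (B ⊆? G) · g B) (λ A → 𝟙 (A ~? B))) ⟩
    Σ (λ B → total B · (𝟙 (B ⊆? G) · (inverseTotal B · f B)))   ≡⟨ Σ-cong cancel ⟩
    Σ (λ B → 𝟙 (B ⊆? G) · f B)                                  ∎)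
    where
    open ≡-Reasoning
    g : Subset m → ℚ
    g A = inverseTotal A · f A
    move : ∀ A B → 𝟙 (B ~? A) · 𝟙 (B ⊆? G) · g A ≡ 𝟙 (A ~? B) · (𝟙 (B ⊆? G) · g B)
    move A B = trans (ℚ.*-assoc (𝟙 (B ~? A)) (𝟙 (B ⊆? G)) (g A))
      (trans (cong (_· (𝟙 (B ⊆? G) · g A)) (𝟙-⇔ (B ~? A) (A ~? B) ~-sym ~-sym))
        (𝟙*-cong (A ~? B) (λ A~B → cong (𝟙 (B ⊆? G) ·_) (cong₂ _·_ (inverseTotal-cong A~B) (f-cong A~B)))))
    cancel : ∀ B → total B · (𝟙 (B ⊆? G) · (inverseTotal B · f B)) ≡ 𝟙 (B ⊆? G) · f B
    cancel B = begin
      total B · (𝟙 (B ⊆? G) · (inverseTotal B · f B))   ≡⟨ solve 4 (λ t i r f → t :* (i :* (r :* f)) := t :* r :* (i :* f)) refl (total B) (𝟙 (B ⊆? G)) (inverseTotal B) (f B) ⟩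
      total B · inverseTotal B · (𝟙 (B ⊆? G) · f B)     ≡⟨ cong (_· (𝟙 (B ⊆? G) · f B)) (total*inverseTotal B) ⟩
      1ℚ · (𝟙 (B ⊆? G) · f B)                           ≡⟨ ℚ.*-identityˡ _ ⟩
      𝟙 (B ⊆? G) · f B                                  ∎

  -- Enumerating unions of copies

  Extendable : (H J : Subset m) → Set
  Extendable H J = ∃ λ G → G ~ H × J ⊆ G

  extendable? : ∀ H J → Dec (Extendable H J)
  extendable? H J = anySubset? λ G → (G ~? H) ×-dec (J ⊆? G)

  module _ {I H : Subset m} {b x : ℚ} (0<b : 0ℚ < b) (0≤x : 0ℚ ≤ x)
    (maximal : ∀ A → count A H · (total I · b ^ ∣ I ∣) ≤ count I H · (total A · b ^ ∣ A ∣)) where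

    private
      ext : Subset m → ℚ
      ext = weightedExtensions (x · b) I
      0≤ext : ∀ A → 0ℚ ≤ ext A
      0≤ext A = 0≤Σ λ S → 0≤* (0≤𝟙 (S ~? I)) (0≤W A S (0≤* 0≤x (ℚ.<⇒≤ 0<b)))
      c : ℚ
      c = total I · b ^ ∣ I ∣
      rate : ℚ
      rate = count I H · (1ℚ + x) ^ ∣ I ∣

    -- Exchanging the sums leaves, for each copy S of I, the sum over A ⊆ S of b^∣A∣ (x b)^(∣S∣ -
    -- ∣A∣), which is b^∣I∣ (1 + x)^∣I∣.
    Σ-weightedExtensions : Σ (λ A → b ^ ∣ A ∣ · ext A) ≡ c · (1ℚ + x) ^ ∣ I ∣
    Σ-weightedExtensions = begin
      Σ (λ A → b ^ ∣ A ∣ · ext A)                                     ≡⟨ Σ-cong (λ A → sym (Σ-*ˡ (b ^ ∣ A ∣) (λ S → 𝟙 (S ~? I) · W (x · b) A S))) ⟩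
      Σ (λ A → Σ (λ S → b ^ ∣ A ∣ · (𝟙 (S ~? I) · W (x · b) A S)))  ≡⟨ Σ-swap (λ A S → b ^ ∣ A ∣ · (𝟙 (S ~? I) · W (x · b) A S)) ⟩
      Σ (λ S → Σ (λ A → b ^ ∣ A ∣ · (𝟙 (S ~? I) · W (x · b) A S)))  ≡⟨ Σ-cong (λ S → Σ-cong (λ A → scale A S)) ⟩
      Σ (λ S → Σ (λ A → 𝟙 (S ~? I) · b ^ ∣ S ∣ · W x A S))          ≡⟨ Σ-cong (λ S → trans (Σ-*ˡ (𝟙 (S ~? I) · b ^ ∣ S ∣) (λ A → W x A S)) (trans (cong (𝟙 (S ~? I) · b ^ ∣ S ∣ ·_) (Σ-W x S)) (size S))) ⟩
      Σ (λ S → 𝟙 (S ~? I) · (b ^ ∣ I ∣ · (1ℚ + x) ^ ∣ I ∣))         ≡⟨ Σ-*ʳ (b ^ ∣ I ∣ · (1ℚ + x) ^ ∣ I ∣) (λ S → 𝟙 (S ~? I)) ⟩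
      total I · (b ^ ∣ I ∣ · (1ℚ + x) ^ ∣ I ∣)                      ≡⟨ sym (ℚ.*-assoc (total I) (b ^ ∣ I ∣) ((1ℚ + x) ^ ∣ I ∣)) ⟩
      c · (1ℚ + x) ^ ∣ I ∣                                          ∎
      where
      open ≡-Reasoning
      scale : ∀ A S → b ^ ∣ A ∣ · (𝟙 (S ~? I) · W (x · b) A S) ≡ 𝟙 (S ~? I) · b ^ ∣ S ∣ · W x A S
      scale A S = trans (solve 3 (λ b i w → b :* (i :* w) := i :* (b :* w)) refl (b ^ ∣ A ∣) (𝟙 (S ~? I)) (W (x · b) A S))
        (trans (cong (𝟙 (S ~? I) ·_) (W-scale x b A S)) (sym (ℚ.*-assoc (𝟙 (S ~? I)) (b ^ ∣ S ∣) (W x A S))))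
      size : ∀ S → 𝟙 (S ~? I) · b ^ ∣ S ∣ · (1ℚ + x) ^ ∣ S ∣ ≡ 𝟙 (S ~? I) · (b ^ ∣ I ∣ · (1ℚ + x) ^ ∣ I ∣)
      size S = trans (ℚ.*-assoc (𝟙 (S ~? I)) (b ^ ∣ S ∣) ((1ℚ + x) ^ ∣ S ∣))
        (𝟙*-cong (S ~? I) (λ S~I → cong (λ k → b ^ k · (1ℚ + x) ^ k) (~⇒∣∣≡ S~I)))

    -- Averaging over the copies of A replaces the indicator of A ⊆ G by `count A H` / `total A`,
    -- which the maximality of I bounds by `count I H` b^∣A∣ / c. The sum of b^∣A∣ `ext A` over all
    -- A then returns the factor c.
    Σ-subgraphs-bound : ∀ {G} → G ~ H → Σ (λ A → 𝟙 (A ⊆? G) · ext A) ≤ rate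
    Σ-subgraphs-bound {G} G~H = *-cancelˡ (0<* (0<total I) (^-pos ∣ I ∣ 0<b)) (begin
      c · Σ (λ A → 𝟙 (A ⊆? G) · ext A)                      ≡⟨ cong (c ·_) (Σ-subgraphs G~H ext (weightedExtensions-cong (x · b) I)) ⟩
      c · Σ (λ A → count A H · (inverseTotal A · ext A))    ≡⟨ sym (Σ-*ˡ c (λ A → count A H · (inverseTotal A · ext A))) ⟩
      Σ (λ A → c · (count A H · (inverseTotal A · ext A)))  ≤⟨ Σ-mono term ⟩
      Σ (λ A → count I H · (b ^ ∣ A ∣ · ext A))             ≡⟨ Σ-*ˡ (count I H) (λ A → b ^ ∣ A ∣ · ext A) ⟩
      count I H · Σ (λ A → b ^ ∣ A ∣ · ext A)               ≡⟨ cong (count I H ·_) Σ-weightedExtensions ⟩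
      count I H · (c · (1ℚ + x) ^ ∣ I ∣)                  ≡⟨ solve 3 (λ n c p → n :* (c :* p) := c :* (n :* p)) refl (count I H) c ((1ℚ + x) ^ ∣ I ∣) ⟩
      c · rate                                               ∎)
      where
      open ℚ.≤-Reasoning
      term : ∀ A → c · (count A H · (inverseTotal A · ext A)) ≤ count I H · (b ^ ∣ A ∣ · ext A)
      term A = begin
        c · (count A H · (inverseTotal A · ext A))                        ≡⟨ solve 3 (λ c n g → c :* (n :* g) := n :* c :* g) refl c (count A H) (inverseTotal A · ext A) ⟩
        count A H · c · (inverseTotal A · ext A)                          ≤⟨ *-monoʳ (0≤* (0≤inverseTotal A) (0≤ext A)) (maximal A) ⟩
        count I H · (total A · b ^ ∣ A ∣) · (inverseTotal A · ext A)      ≡⟨ solve 5 (λ n t b r e → n :* (t :* b) :* (r :* e) := t :* r :* (n :* (b :* e))) refl (count I H) (total A) (b ^ ∣ A ∣) (inverseTotal A) (ext A) ⟩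
        total A · inverseTotal A · (count I H · (b ^ ∣ A ∣ · ext A))      ≡⟨ cong (_· (count I H · (b ^ ∣ A ∣ · ext A))) (total*inverseTotal A) ⟩
        1ℚ · (count I H · (b ^ ∣ A ∣ · ext A))                            ≡⟨ ℚ.*-identityˡ _ ⟩
        count I H · (b ^ ∣ A ∣ · ext A)                                   ∎

    -- Unions contained in no copy of H contribute nothing to the double count. Discarding them puts
    -- every intersection with J inside a copy G of H, where `Σ-subgraphs-bound` applies.
    weight : Subset m → ℚ
    weight J = 𝟙 (extendable? H J) · (x · b) ^ ∣ J ∣

    weight-step : ∀ J → Σ (λ S → 𝟙 (S ~? I) · weight (J ∪ S)) ≤ rate · weight J
    weight-step J = begin
      Σ (λ S → 𝟙 (S ~? I) · weight (J ∪ S))                      ≤⟨ Σ-mono shrink ⟩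
      Σ (λ S → v · (𝟙 (S ~? I) · y ^ ∣ J ∪ S ∣))                 ≡⟨ Σ-*ˡ v (λ S → 𝟙 (S ~? I) · y ^ ∣ J ∪ S ∣) ⟩
      v · Σ (λ S → 𝟙 (S ~? I) · y ^ ∣ J ∪ S ∣)                   ≤⟨ 𝟙*-mono (extendable? H J) (λ (G , G~H , J⊆G) → bound G~H J⊆G) ⟩
      v · (rate · y ^ ∣ J ∣)                                        ≡⟨ solve 3 (λ v k p → v :* (k :* p) := k :* (v :* p)) refl v rate (y ^ ∣ J ∣) ⟩
      rate · weight J                                               ∎
      where
      open ℚ.≤-Reasoning
      y = x · b
      0≤y = 0≤* 0≤x (ℚ.<⇒≤ 0<b)
      v = 𝟙 (extendable? H J)
      shrink : ∀ S → 𝟙 (S ~? I) · weight (J ∪ S) ≤ v · (𝟙 (S ~? I) · y ^ ∣ J ∪ S ∣)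
      shrink S = begin
        𝟙 (S ~? I) · (𝟙 (extendable? H (J ∪ S)) · p)    ≤⟨ *-monoˡ (0≤𝟙 (S ~? I)) (*-monoʳ (^-nonneg ∣ J ∪ S ∣ 0≤y) smaller) ⟩
        𝟙 (S ~? I) · (v · p)                            ≡⟨ solve 3 (λ i v p → i :* (v :* p) := v :* (i :* p)) refl (𝟙 (S ~? I)) v p ⟩
        v · (𝟙 (S ~? I) · p)                            ∎
        where
        p = y ^ ∣ J ∪ S ∣
        smaller : 𝟙 (extendable? H (J ∪ S)) ≤ v
        smaller = 𝟙-mono (extendable? H (J ∪ S)) (extendable? H J)
          (λ (G , G~H , J∪S⊆G) → G , G~H , ⊆-trans (p⊆p∪q S) J∪S⊆G)
      bound : ∀ {G} → G ~ H → J ⊆ G → Σ (λ S → 𝟙 (S ~? I) · y ^ ∣ J ∪ S ∣) ≤ rate · y ^ ∣ J ∣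
      bound {G} G~H J⊆G = begin
        Σ (λ S → 𝟙 (S ~? I) · y ^ ∣ J ∪ S ∣)                         ≡⟨ Σ-cong (λ S → cong (𝟙 (S ~? I) ·_) (sym (W-∩ y J S))) ⟩
        Σ (λ S → 𝟙 (S ~? I) · (y ^ ∣ J ∣ · W y (J ∩ S) S))           ≡⟨ Σ-cong (λ S → solve 3 (λ i p w → i :* (p :* w) := p :* (i :* w)) refl (𝟙 (S ~? I)) (y ^ ∣ J ∣) (W y (J ∩ S) S)) ⟩
        Σ (λ S → y ^ ∣ J ∣ · (𝟙 (S ~? I) · W y (J ∩ S) S))           ≡⟨ Σ-*ˡ (y ^ ∣ J ∣) (λ S → 𝟙 (S ~? I) · W y (J ∩ S) S) ⟩
        y ^ ∣ J ∣ · Σ (λ S → 𝟙 (S ~? I) · W y (J ∩ S) S)             ≤⟨ *-monoˡ (^-nonneg ∣ J ∣ 0≤y) (Σ-mono (λ S → *-monoˡ (0≤𝟙 (S ~? I)) (single S))) ⟩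
        y ^ ∣ J ∣ · Σ (λ S → 𝟙 (S ~? I) · Σ (λ A → 𝟙 (A ⊆? G) · W y A S)) ≡⟨ cong (y ^ ∣ J ∣ ·_) regroup ⟩
        y ^ ∣ J ∣ · Σ (λ A → 𝟙 (A ⊆? G) · ext A)                       ≤⟨ *-monoˡ (^-nonneg ∣ J ∣ 0≤y) (Σ-subgraphs-bound G~H) ⟩
        y ^ ∣ J ∣ · rate                                                ≡⟨ ℚ.*-comm (y ^ ∣ J ∣) rate ⟩
        rate · y ^ ∣ J ∣                                                ∎
        where
        -- Summing over all A ⊆ G, and not only A = J ∩ S, removes J from the bound; the larger sum
        -- depends on G only up to isomorphism.
        single : ∀ S → W y (J ∩ S) S ≤ Σ (λ A → 𝟙 (A ⊆? G) · W y A S)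
        single S = subst (_≤ Σ (λ A → 𝟙 (A ⊆? G) · W y A S))
          (trans (cong (_· W y (J ∩ S) S) (𝟙-yes (J ∩ S ⊆? G) (⊆-trans (p∩q⊆p J S) J⊆G))) (ℚ.*-identityˡ (W y (J ∩ S) S)))
          (term≤Σ {f = λ A → 𝟙 (A ⊆? G) · W y A S} (λ A → 0≤* (0≤𝟙 (A ⊆? G)) (0≤W A S 0≤y)) (J ∩ S))
        regroup : Σ (λ S → 𝟙 (S ~? I) · Σ (λ A → 𝟙 (A ⊆? G) · W y A S)) ≡ Σ (λ A → 𝟙 (A ⊆? G) · ext A)
        regroup = trans
          (Σ-cong λ S → trans (sym (Σ-*ˡ (𝟙 (S ~? I)) (λ A → 𝟙 (A ⊆? G) · W y A S)))
            (Σ-cong λ A → solve 3 (λ i j w → i :* (j :* w) := j :* (i :* w)) refl (𝟙 (S ~? I)) (𝟙 (A ⊆? G)) (W y A S)))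
          (trans (Σ-swap (λ S A → 𝟙 (A ⊆? G) · (𝟙 (S ~? I) · W y A S)))
            (Σ-cong λ A → Σ-*ˡ (𝟙 (A ⊆? G)) (λ S → 𝟙 (S ~? I) · W y A S)))

  -- Either G is chosen first and then the sets inside it, or the sets first and then a copy G
  -- around their union with J. The condition J ⊆ G in the statement carries the induction, since it
  -- combines with S ⊆ G to J ∪ S ⊆ G.
  unionSum-restrict : ∀ (w : Subset m → ℚ) t (h : Subset m → ℚ) H J →
    Σ (λ G → 𝟙 (G ~? H) · (𝟙 (J ⊆? G) · unionSum (λ S → w S · 𝟙 (S ⊆? G)) t h J)) ≡
    unionSum w t (λ J → extensions H J · h J) J
  unionSum-restrict w zero    h H J = trans
    (Σ-cong λ G → sym (ℚ.*-assoc (𝟙 (G ~? H)) (𝟙 (J ⊆? G)) (h J)))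
    (Σ-*ʳ (h J) (λ G → 𝟙 (G ~? H) · 𝟙 (J ⊆? G)))
  unionSum-restrict w (suc t) h H J = begin
    Σ (λ G → 𝟙 (G ~? H) · (𝟙 (J ⊆? G) · Σ (λ S → w S · 𝟙 (S ⊆? G) · u G (J ∪ S))))
      ≡⟨ Σ-cong (λ G → trans (sym (ℚ.*-assoc (𝟙 (G ~? H)) (𝟙 (J ⊆? G)) _))
           (trans (sym (Σ-*ˡ (𝟙 (G ~? H) · 𝟙 (J ⊆? G)) (λ S → w S · 𝟙 (S ⊆? G) · u G (J ∪ S)))) (Σ-cong (merge G)))) ⟩
    Σ (λ G → Σ (λ S → w S · (𝟙 (G ~? H) · (𝟙 (J ∪ S ⊆? G) · u G (J ∪ S)))))
      ≡⟨ Σ-swap (λ G S → w S · (𝟙 (G ~? H) · (𝟙 (J ∪ S ⊆? G) · u G (J ∪ S)))) ⟩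
    Σ (λ S → Σ (λ G → w S · (𝟙 (G ~? H) · (𝟙 (J ∪ S ⊆? G) · u G (J ∪ S)))))
      ≡⟨ Σ-cong (λ S → trans (Σ-*ˡ (w S) (λ G → 𝟙 (G ~? H) · (𝟙 (J ∪ S ⊆? G) · u G (J ∪ S)))) (cong (w S ·_) (unionSum-restrict w t h H (J ∪ S)))) ⟩
    Σ (λ S → w S · unionSum w t (λ J → extensions H J · h J) (J ∪ S))
      ∎
    where
    open ≡-Reasoning
    u : Subset m → Subset m → ℚ
    u G = unionSum (λ S → w S · 𝟙 (S ⊆? G)) t h
    ∪-lub : ∀ {G S} → J ⊆ G → S ⊆ G → J ∪ S ⊆ G
    ∪-lub {G} {S} J⊆G S⊆G i∈ = [ J⊆G , S⊆G ]′ (x∈p∪q⁻ J S i∈)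
    merge : ∀ G S → 𝟙 (G ~? H) · 𝟙 (J ⊆? G) · (w S · 𝟙 (S ⊆? G) · u G (J ∪ S)) ≡ w S · (𝟙 (G ~? H) · (𝟙 (J ∪ S ⊆? G) · u G (J ∪ S)))
    merge G S = trans
      (solve 5 (λ g j w s u → g :* j :* (w :* s :* u) := w :* (g :* (j :* s :* u))) refl (𝟙 (G ~? H)) (𝟙 (J ⊆? G)) (w S) (𝟙 (S ⊆? G)) (u G (J ∪ S)))
      (cong (λ z → w S · (𝟙 (G ~? H) · (z · u G (J ∪ S))))
        (𝟙-∧ (J ⊆? G) (S ⊆? G) (J ∪ S ⊆? G) (λ J⊆G S⊆G → ∪-lub J⊆G S⊆G)
          (λ J∪S⊆G → ⊆-trans (p⊆p∪q S) J∪S⊆G) (λ J∪S⊆G → ⊆-trans (q⊆p∪q J S) J∪S⊆G)))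

  -- By double counting, the proportion of copies of H that contain J is `count J H` / `total J`.
  -- Sparsity bounds 1 / `total J` by q^∣J∣ when J lies in a copy of H, and `count J H` is at most
  -- the number of subsets of H.
  extensions-bound : ∀ {q H} → 0ℚ ≤ q → Sparse q H → ∀ J →
    extensions H J ≤ total H · 2ℚ ^ ∣ H ∣ · (𝟙 (extendable? H J) · q ^ ∣ J ∣)
  extensions-bound {q} {H} 0≤q sparse J with extendable? H J
  ... | no ¬ext = ℚ.≤-reflexive (trans
    (Σ-zero λ G → trans (𝟙*-cong (G ~? H) (λ G~H → 𝟙-no (J ⊆? G) (λ J⊆G → ¬ext (G , G~H , J⊆G)))) (ℚ.*-zeroʳ (𝟙 (G ~? H))))
    (solve 2 (λ a b → con 0ℚ := a :* (con 0ℚ :* b)) refl (total H · 2ℚ ^ ∣ H ∣) (q ^ ∣ J ∣)))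
  ... | yes (G , G~H , J⊆G) = begin
    extensions H J                                     ≡⟨ sym (ℚ.*-identityʳ (extensions H J)) ⟩
    extensions H J · 1ℚ                                ≤⟨ *-monoˡ (0≤Σ λ G → 0≤* (0≤𝟙 (G ~? H)) (0≤𝟙 (J ⊆? G))) (sparse-cong G~H sparse J J⊆G) ⟩
    extensions H J · (total J · q ^ ∣ J ∣)             ≡⟨ sym (ℚ.*-assoc (extensions H J) (total J) (q ^ ∣ J ∣)) ⟩
    extensions H J · total J · q ^ ∣ J ∣               ≡⟨ cong (_· q ^ ∣ J ∣) (extensions*total≡total*count H J) ⟩
    total H · count J H · q ^ ∣ J ∣                    ≤⟨ *-monoʳ (^-nonneg ∣ J ∣ 0≤q) (*-monoˡ (ℚ.<⇒≤ (0<total H)) (count≤2^ J H)) ⟩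
    total H · 2ℚ ^ ∣ H ∣ · q ^ ∣ J ∣                   ≡⟨ cong (total H · 2ℚ ^ ∣ H ∣ ·_) (sym (ℚ.*-identityˡ (q ^ ∣ J ∣))) ⟩
    total H · 2ℚ ^ ∣ H ∣ · (1ℚ · q ^ ∣ J ∣)            ∎
    where open ℚ.≤-Reasoning

  count-without : ∀ I G e → Σ (λ S → 𝟙 (S ~? I) · 𝟙 (S ⊆? G) · 𝟙 (¬? (e ∈? S))) ≡ count I (G -ˢ e)
  count-without I G e = Σ-cong λ S → trans (ℚ.*-assoc (𝟙 (S ~? I)) (𝟙 (S ⊆? G)) (𝟙 (¬? (e ∈? S))))
    (cong (𝟙 (S ~? I) ·_) (𝟙-∧ (S ⊆? G) (¬? (e ∈? S)) (S ⊆? G -ˢ e)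
      (λ S⊆G e∉S {i} i∈S → x∈p∧x≢y⇒x∈p-y (S⊆G i∈S) (λ { refl → e∉S i∈S }))
      (λ S⊆G-e → ⊆-trans S⊆G-e (p─q⊆p G _))
      (λ S⊆G-e e∈S → x∉p-x G e (S⊆G-e e∈S))))

  -- If a typical t-tuple of copies of I in H covered half of H, then counting all pairs of a copy
  -- of H and such a tuple in two ways would give 16 ^ ∣ H ∣ ≤ 2 · 4 ^ ∣ H ∣.
  no-heavy-subgraph : ∀ {q H I b x} t .{{_ : ℕ.NonZero ∣ H ∣}} → 0ℚ < q → Sparse q H → 0ℚ < b → 0ℚ ≤ x → x · b ≡ 256ℚ · q →
    0ℚ < count I H →
    (∀ A → count A H · (total I · b ^ ∣ I ∣) ≤ count I H · (total A · b ^ ∣ A ∣)) →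
    (∀ G → G ~ H → ∀ e → e ∈ G → 4ℚ · count I (G -ˢ e) ^ t ≤ count I H ^ t) →
    ¬ ((1ℚ + x) ^ (∣ I ∣ ℕ.* t) ≤ 2ℚ ^ ∣ H ∣)
  no-heavy-subgraph {q} {H} {I} {b} {x} t 0<q sparse 0<b 0≤x xb≡256q 0<n maximal rare growth = contradictory
    where
    open ℚ.≤-Reasoning
    N = ∣ H ∣
    n = count I H
    T = total H
    κ = n · (1ℚ + x) ^ ∣ I ∣
    0≤1+x = 0≤+ 0≤1 0≤x
    0≤κ : 0ℚ ≤ κ
    0≤κ = 0≤* (0≤count I H) (^-nonneg ∣ I ∣ 0≤1+x)
    w : Subset m → ℚ
    w S = 𝟙 (S ~? I)
    0≤w : ∀ S → 0ℚ ≤ w S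
    0≤w S = 0≤𝟙 (S ~? I)
    wᴳ : Subset m → Subset m → ℚ
    wᴳ G S = w S · 𝟙 (S ⊆? G)
    h : Subset m → ℚ
    h J = 256ℚ ^ ∣ J ∣
    f : Subset m → ℚ
    f J = 𝟙 (extendable? H J) · (x · b) ^ ∣ J ∣
    T2^N : ℚ
    T2^N = T · 2ℚ ^ N
    -- By `unionSum-restrict`, this counts the pairs of a copy G of H and a t-tuple of copies of I
    -- in G, weighted by 256 to the size of the union.
    D : ℚ
    D = unionSum w t (λ J → extensions H J · h J) ⊥

    upper : D ≤ T2^N · κ ^ t
    upper = begin
      D                                       ≤⟨ unionSum-mono 0≤w t pointwise ⊥ ⟩
      unionSum w t (λ J → T2^N · f J) ⊥       ≡⟨ unionSum-*ˡ w t T2^N f ⊥ ⟩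
      T2^N · unionSum w t f ⊥                 ≤⟨ *-monoˡ 0≤T2^N (unionSum-bound 0≤w t {f} 0≤κ (weight-step {I} {H} {b} {x} 0<b 0≤x maximal) ⊥) ⟩
      T2^N · (κ ^ t · f ⊥)                    ≤⟨ *-monoˡ 0≤T2^N (*-monoˡ (^-nonneg t 0≤κ) f⊥≤1) ⟩
      T2^N · (κ ^ t · 1ℚ)                     ≡⟨ cong (T2^N ·_) (ℚ.*-identityʳ (κ ^ t)) ⟩
      T2^N · κ ^ t                            ∎
      where
      0≤T2^N : 0ℚ ≤ T2^N
      0≤T2^N = 0≤* (ℚ.<⇒≤ (0<total H)) (^-nonneg N (0≤fromℕ 2))
      pointwise : ∀ J → extensions H J · h J ≤ T2^N · f J
      pointwise J = begin
        extensions H J · h J                            ≤⟨ *-monoʳ (^-nonneg ∣ J ∣ (0≤fromℕ 256)) (extensions-bound (ℚ.<⇒≤ 0<q) sparse J) ⟩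
        T2^N · (v · q ^ ∣ J ∣) · h J                    ≡⟨ solve 4 (λ c v p h → c :* (v :* p) :* h := c :* (v :* (h :* p))) refl T2^N v (q ^ ∣ J ∣) (h J) ⟩
        T2^N · (v · (256ℚ ^ ∣ J ∣ · q ^ ∣ J ∣))         ≡⟨ cong (λ z → T2^N · (v · z)) (sym (^-distrib-* 256ℚ q ∣ J ∣)) ⟩
        T2^N · (v · (256ℚ · q) ^ ∣ J ∣)                 ≡⟨ cong (λ z → T2^N · (v · z ^ ∣ J ∣)) (sym xb≡256q) ⟩
        T2^N · f J                                      ∎
        where v = 𝟙 (extendable? H J)
      f⊥≤1 : f ⊥ ≤ 1ℚ
      f⊥≤1 = subst (λ k → 𝟙 (extendable? H ⊥) · (x · b) ^ k ≤ 1ℚ) (sym (∣⊥∣≡0 m))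
        (subst (_≤ 1ℚ) (sym (ℚ.*-identityʳ _)) (𝟙≤1 (extendable? H ⊥)))

    lower : T · (16ℚ ^ N · n ^ t) ≤ 2ℚ · D
    lower = begin
      T · (16ℚ ^ N · n ^ t)                                       ≡⟨ sym (Σ-*ʳ (16ℚ ^ N · n ^ t) (λ G → 𝟙 (G ~? H))) ⟩
      Σ (λ G → 𝟙 (G ~? H) · (16ℚ ^ N · n ^ t))                    ≤⟨ Σ-mono (λ G → 𝟙*-mono (G ~? H) (large G)) ⟩
      Σ (λ G → 𝟙 (G ~? H) · (2ℚ · (𝟙 (⊥ ⊆? G) · Z G)))            ≡⟨ Σ-cong (λ G → solve 2 (λ i z → i :* (con 2ℚ :* z) := con 2ℚ :* (i :* z)) refl (𝟙 (G ~? H)) (𝟙 (⊥ ⊆? G) · Z G)) ⟩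
      Σ (λ G → 2ℚ · (𝟙 (G ~? H) · (𝟙 (⊥ ⊆? G) · Z G)))            ≡⟨ Σ-*ˡ 2ℚ (λ G → 𝟙 (G ~? H) · (𝟙 (⊥ ⊆? G) · Z G)) ⟩
      2ℚ · Σ (λ G → 𝟙 (G ~? H) · (𝟙 (⊥ ⊆? G) · Z G))              ≡⟨ cong (2ℚ ·_) (unionSum-restrict w t h H ⊥) ⟩
      2ℚ · D                                                      ∎
      where
      Z : Subset m → ℚ
      Z G = unionSum (wᴳ G) t h ⊥
      large : ∀ G → G ~ H → 16ℚ ^ N · n ^ t ≤ 2ℚ · (𝟙 (⊥ ⊆? G) · Z G)
      large G G~H = subst₂ _≤_
        (cong₂ (λ k c → 16ℚ ^ k · c ^ t) ∣G∣≡N (count-congʳ I G~H))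
        (cong (2ℚ ·_) (sym (trans (cong (_· Z G) (𝟙-yes (⊥ ⊆? G) (⊆-min G))) (ℚ.*-identityˡ (Z G)))))
        (union-large G {{subst ℕ.NonZero (sym ∣G∣≡N) it}} (λ S → 0≤* (0≤w S) (0≤𝟙 (S ⊆? G))) t
          (λ e e∈G → subst₂ (λ a c → 4ℚ · a ^ t ≤ c ^ t) (sym (count-without I G e)) (sym (count-congʳ I G~H)) (rare G G~H e e∈G)))
        where ∣G∣≡N = ~⇒∣∣≡ G~H

    -- On the right, one factor 2^N bounds the number of subgraphs of H, another the cost (1 +
    -- x)^(∣I∣ t) of the enumeration, and the single 2 comes from `union-large`.
    combined : T · n ^ t · 16ℚ ^ N ≤ T · n ^ t · (2ℚ · 4ℚ ^ N)
    combined = begin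
      T · n ^ t · 16ℚ ^ N                                            ≡⟨ solve 3 (λ T n p → T :* n :* p := T :* (p :* n)) refl T (n ^ t) (16ℚ ^ N) ⟩
      T · (16ℚ ^ N · n ^ t)                                          ≤⟨ ℚ.≤-trans lower (*-monoˡ (0≤fromℕ 2) upper) ⟩
      2ℚ · (T2^N · κ ^ t)                                            ≡⟨ cong (λ z → 2ℚ · (T2^N · z)) (trans (^-distrib-* n ((1ℚ + x) ^ ∣ I ∣) t) (cong (n ^ t ·_) (^-assocʳ (1ℚ + x) ∣ I ∣ t))) ⟩
      2ℚ · (T · 2ℚ ^ N · (n ^ t · (1ℚ + x) ^ (∣ I ∣ ℕ.* t)))         ≡⟨ solve 4 (λ T p n g → con 2ℚ :* (T :* p :* (n :* g)) := T :* n :* (con 2ℚ :* p) :* g) refl T (2ℚ ^ N) (n ^ t) ((1ℚ + x) ^ (∣ I ∣ ℕ.* t)) ⟩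
      T · n ^ t · (2ℚ · 2ℚ ^ N) · (1ℚ + x) ^ (∣ I ∣ ℕ.* t)           ≤⟨ *-monoˡ (0≤* (0≤* (ℚ.<⇒≤ (0<total H)) (^-nonneg t (0≤count I H))) (0≤* (0≤fromℕ 2) (^-nonneg N (0≤fromℕ 2)))) growth ⟩
      T · n ^ t · (2ℚ · 2ℚ ^ N) · 2ℚ ^ N                             ≡⟨ trans (solve 2 (λ c p → c :* (con 2ℚ :* p) :* p := c :* (con 2ℚ :* (p :* p))) refl (T · n ^ t) (2ℚ ^ N)) (cong (λ z → T · n ^ t · (2ℚ · z)) (sym (^-distrib-* 2ℚ 2ℚ N))) ⟩
      T · n ^ t · (2ℚ · 4ℚ ^ N)                                      ∎

    16^N≤2*4^N : 4ℚ ^ N · 4ℚ ^ N ≤ 4ℚ ^ N · 2ℚ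
    16^N≤2*4^N = subst₂ _≤_ (^-distrib-* 4ℚ 4ℚ N) (ℚ.*-comm 2ℚ (4ℚ ^ N)) (*-cancelˡ (0<* (0<total H) (^-pos t 0<n)) combined)

    -- What remains is 4^N ≤ 2, which N ≥ 1 excludes. With 8 in place of 16 there would be equality
    -- at N = 1 and no contradiction.
    contradictory : Empty
    contradictory = ℚ.<-irrefl refl (ℚ.<-≤-trans 2<4^N (*-cancelˡ (^-pos N (0<fromℕ 4)) 16^N≤2*4^N))
      where
      2<4^N : 2ℚ < 4ℚ ^ N
      2<4^N = ℚ.<-≤-trans (ℚ.+-monoʳ-< 2ℚ (0<fromℕ 2)) (^-monoʳ {4ℚ} {1} {N} (1≤fromℕ 4) (ℕ.>-nonZero⁻¹ N))

  -- The factor 256 = 16² makes up for only half of H being covered; the factor 12 bounds the cost of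
  -- t ≤ 6 N g(N) / e(I) enumeration steps by 2^N.
  β : ℚ → ℚ
  β q = 12ℚ · 256ℚ · q

  -- The induction on the number of edges

  CountBound : ℚ → ℚ → Subset m → Set
  CountBound q g H = ∀ I → count I H ≤ total I · (β q · g) ^ ∣ I ∣

  module _ {q : ℚ} (0<q : 0ℚ < q) where

    0<β : 0ℚ < β q
    0<β = 0<* (0<* (0<fromℕ 12) (0<fromℕ 256)) 0<q

    maximal-bound : ∀ n {H I} → ∣ H ∣ ≡ suc n → Sparse q H →
      (∀ G → Sparse q G → ∣ G ∣ ℕ.≤ n → CountBound q (harmonic n) G) →
      (∀ A → count A H · (total I · (β q · harmonic (suc n)) ^ ∣ I ∣) ≤ count I H · (total A · (β q · harmonic (suc n)) ^ ∣ A ∣)) →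
      ∀ i → ∣ I ∣ ≡ suc i → ¬ (total I · (β q · harmonic (suc n)) ^ ∣ I ∣ ≤ count I H)
    maximal-bound n {H} {I} ∣H∣≡ sparse IH maximal i ∣I∣≡ c≤n =
      no-heavy-subgraph {q} {H} {I} {b} {x} t {{subst ℕ.NonZero (sym ∣H∣≡) _}} 0<q sparse 0<b (ℚ.<⇒≤ 0<x) xb≡ 0<n maximal rare
        (subst₂ (λ k l → (1ℚ + x) ^ (k ℕ.* t) ≤ 2ℚ ^ l) (sym ∣I∣≡) (sym ∣H∣≡) (proj₂ estimates))
      where
      open ℚ.≤-Reasoning
      g = harmonic (suc n)
      b = β q · g
      0<g : 0ℚ < g
      0<g = ℚ.<-≤-trans 0<1 (1≤harmonic n)
      0<b : 0ℚ < b
      0<b = 0<* 0<β 0<g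
      0<n : 0ℚ < count I H
      0<n = ℚ.<-≤-trans (0<* (0<total I) (^-pos ∣ I ∣ 0<b)) c≤n
      -- A positive count forces ∣I∣ ≤ ∣H∣, which keeps the rounding of t affordable in `exponent`.
      i≤n : i ℕ.≤ n
      i≤n = ℕ.≤-pred (subst₂ ℕ._≤_ ∣I∣≡ ∣H∣≡ (ℕ.≮⇒≥ λ ∣H∣<∣I∣ → ℚ.<-irrefl (sym (count-small I H ∣H∣<∣I∣)) 0<n))
      t = proj₁ (exponent n i i≤n)
      g⁻¹ = proj₁ (reciprocal 0<g)
      0≤g⁻¹ : 0ℚ ≤ g⁻¹
      0≤g⁻¹ = ℚ.<⇒≤ (proj₁ (proj₂ (reciprocal 0<g)))
      gg⁻¹≡1 : g · g⁻¹ ≡ 1ℚ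
      gg⁻¹≡1 = proj₂ (proj₂ (reciprocal 0<g))
      ξ = harmonic n · g⁻¹
      0≤ξ : 0ℚ ≤ ξ
      0≤ξ = 0≤* (0≤harmonic n) 0≤g⁻¹
      ξg≡ : ξ · g ≡ harmonic n
      ξg≡ = trans (solve 3 (λ h r g → h :* r :* g := h :* (g :* r)) refl (harmonic n) g⁻¹ g) (trans (cong (harmonic n ·_) gg⁻¹≡1) (ℚ.*-identityʳ (harmonic n)))
      12g⁻¹ = reciprocal (0<* (0<fromℕ 12) 0<g)
      x = proj₁ 12g⁻¹
      0<x : 0ℚ < x
      0<x = proj₁ (proj₂ 12g⁻¹)
      x12g≡1 : x · (12ℚ · g) ≡ 1ℚ
      x12g≡1 = trans (ℚ.*-comm x (12ℚ · g)) (proj₂ (proj₂ 12g⁻¹))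
      xb≡ : x · b ≡ 256ℚ · q
      xb≡ = trans (solve 5 (λ x q g a c → x :* (a :* c :* q :* g) := x :* (a :* g) :* (c :* q)) refl x q g 12ℚ 256ℚ)
        (trans (cong (_· (256ℚ · q)) x12g≡1) (ℚ.*-identityˡ (256ℚ · q)))
      estimates = proj₂ (exponent n i i≤n) 0≤ξ ξg≡ (ℚ.<⇒≤ 0<x) x12g≡1
      rare : ∀ G → G ~ H → ∀ e → e ∈ G → 4ℚ · count I (G -ˢ e) ^ t ≤ count I H ^ t
      rare G G~H e e∈G = begin
        4ℚ · count I (G -ˢ e) ^ t                     ≤⟨ *-monoˡ (0≤fromℕ 4) (^-monoˡ t (0≤count I (G -ˢ e)) fewer) ⟩
        4ℚ · (count I H · ξ ^ ∣ I ∣) ^ t              ≡⟨ cong (4ℚ ·_) (trans (^-distrib-* (count I H) (ξ ^ ∣ I ∣) t) (cong (count I H ^ t ·_) (trans (^-assocʳ ξ ∣ I ∣ t) (cong (λ k → ξ ^ (k ℕ.* t)) ∣I∣≡)))) ⟩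
        4ℚ · (count I H ^ t · ξ ^ (suc i ℕ.* t))      ≡⟨ solve 2 (λ n z → con 4ℚ :* (n :* z) := n :* (con 4ℚ :* z)) refl (count I H ^ t) (ξ ^ (suc i ℕ.* t)) ⟩
        count I H ^ t · (4ℚ · ξ ^ (suc i ℕ.* t))      ≤⟨ *-monoˡ (^-nonneg t (0≤count I H)) (proj₁ estimates) ⟩
        count I H ^ t · 1ℚ                            ≡⟨ ℚ.*-identityʳ _ ⟩
        count I H ^ t                                 ∎
        where
        -- The induction hypothesis gives `total I` b^∣I∣ ξ^∣I∣. The assumption `c≤n`, that the
        -- count of I in H is at least the desired bound, turns this into a fraction of `count I H`.
        fewer : count I (G -ˢ e) ≤ count I H · ξ ^ ∣ I ∣
        fewer = begin
          count I (G -ˢ e)                            ≤⟨ IH (G -ˢ e) (sparse-⊆ (p─q⊆p G _) (sparse-cong G~H sparse))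
                                                           (ℕ.≤-pred (subst (∣ G -ˢ e ∣ ℕ.<_) (trans (~⇒∣∣≡ G~H) ∣H∣≡) (x∈p⇒∣p-x∣<∣p∣ e∈G))) I ⟩
          total I · (β q · harmonic n) ^ ∣ I ∣        ≡⟨ cong (λ h → total I · (β q · h) ^ ∣ I ∣) (trans (sym ξg≡) (ℚ.*-comm ξ g)) ⟩
          total I · (β q · (g · ξ)) ^ ∣ I ∣           ≡⟨ cong (λ z → total I · z ^ ∣ I ∣) (sym (ℚ.*-assoc (β q) g ξ)) ⟩
          total I · (b · ξ) ^ ∣ I ∣                   ≡⟨ trans (cong (total I ·_) (^-distrib-* b ξ ∣ I ∣)) (sym (ℚ.*-assoc (total I) (b ^ ∣ I ∣) (ξ ^ ∣ I ∣))) ⟩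
          total I · b ^ ∣ I ∣ · ξ ^ ∣ I ∣             ≤⟨ *-monoʳ (^-nonneg ∣ I ∣ 0≤ξ) c≤n ⟩
          count I H · ξ ^ ∣ I ∣                       ∎

    -- It suffices that the largest ratio `count A H` / `d A` is at most 1. The maximum ranges over
    -- all edge sets, so that maximality is available for every A in the sums over intersections,
    -- and an edgeless maximiser is settled by `count≤total`.
    peel : ∀ n H → ∣ H ∣ ≡ suc n → Sparse q H →
      (∀ G → Sparse q G → ∣ G ∣ ℕ.≤ n → CountBound q (harmonic n) G) →
      CountBound q (harmonic (suc n)) H
    peel n H ∣H∣≡ sparse IH A = *-cancelˡ (0<d I) (begin
      d I · count A H   ≡⟨ ℚ.*-comm (d I) (count A H) ⟩
      count A H · d I   ≤⟨ maximal A ⟩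
      count I H · d A   ≤⟨ *-monoʳ (ℚ.<⇒≤ (0<d A)) (bound ∣ I ∣ refl) ⟩
      d I · d A         ∎)
      where
      open ℚ.≤-Reasoning
      b = β q · harmonic (suc n)
      0<b : 0ℚ < b
      0<b = 0<* 0<β (ℚ.<-≤-trans 0<1 (1≤harmonic n))
      d : Subset m → ℚ
      d A = total A · b ^ ∣ A ∣
      0<d : ∀ A → 0ℚ < d A
      0<d A = 0<* (0<total A) (^-pos ∣ A ∣ 0<b)
      d⁻¹ : Subset m → ℚ
      d⁻¹ A = proj₁ (reciprocal (0<d A))
      dd⁻¹≡1 : ∀ A → d A · d⁻¹ A ≡ 1ℚ
      dd⁻¹≡1 A = proj₂ (proj₂ (reciprocal (0<d A)))
      maximum = argmax λ A → count A H · d⁻¹ A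
      I = proj₁ maximum
      maximal : ∀ A → count A H · d I ≤ count I H · d A
      maximal A = begin
        count A H · d I                       ≡⟨ expand (count A H) (d I) A ⟩
        count A H · d⁻¹ A · (d A · d I)       ≤⟨ *-monoʳ (0≤* (ℚ.<⇒≤ (0<d A)) (ℚ.<⇒≤ (0<d I))) (proj₂ maximum A) ⟩
        count I H · d⁻¹ I · (d A · d I)       ≡⟨ cong (count I H · d⁻¹ I ·_) (ℚ.*-comm (d A) (d I)) ⟩
        count I H · d⁻¹ I · (d I · d A)       ≡⟨ sym (expand (count I H) (d A) I) ⟩
        count I H · d A                       ∎
        where
        expand : ∀ k c B → k · c ≡ k · d⁻¹ B · (d B · c)
        expand k c B = trans (sym (trans (cong (_· (k · c)) (dd⁻¹≡1 B)) (ℚ.*-identityˡ (k · c))))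
          (solve 4 (λ k c d r → d :* r :* (k :* c) := k :* r :* (d :* c)) refl k c (d B) (d⁻¹ B))
      bound : ∀ i → ∣ I ∣ ≡ i → count I H ≤ d I
      bound zero    ∣I∣≡ = subst (λ k → count I H ≤ total I · b ^ k) (sym ∣I∣≡) (subst (count I H ≤_) (sym (ℚ.*-identityʳ (total I))) (count≤total I H))
      bound (suc i) ∣I∣≡ = [ (λ le → le) , (λ ge → ⊥-elim (maximal-bound n {H} {I} ∣H∣≡ sparse IH maximal i ∣I∣≡ ge)) ]′
        (ℚ.≤-total (count I H) (d I))

    -- The induction runs on an upper bound n for ∣H∣: graphs with fewer edges inherit the bound
    -- because harmonic numbers increase.
    count-bound : ∀ n H → Sparse q H → ∣ H ∣ ℕ.≤ n → CountBound q (harmonic n) H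
    count-bound zero H sparse ∣H∣≤0 I = bound ∣ I ∣ refl
      where
      -- As `harmonic 0` is 0, the claim for nonempty I is that an edgeless H contains no copy of
      -- it.
      bound : ∀ i → ∣ I ∣ ≡ i → count I H ≤ total I · (β q · 0ℚ) ^ ∣ I ∣
      bound zero    ∣I∣≡ = subst (λ k → count I H ≤ total I · (β q · 0ℚ) ^ k) (sym ∣I∣≡)
        (subst (count I H ≤_) (sym (ℚ.*-identityʳ (total I))) (count≤total I H))
      bound (suc i) ∣I∣≡ = ℚ.≤-trans
        (ℚ.≤-reflexive (count-small I H (subst₂ ℕ._<_ (sym (ℕ.n≤0⇒n≡0 ∣H∣≤0)) (sym ∣I∣≡) (ℕ.s≤s ℕ.z≤n))))
        (0≤* (ℚ.<⇒≤ (0<total I)) (^-nonneg ∣ I ∣ (0≤* (ℚ.<⇒≤ 0<β) (ℚ.≤-refl {0ℚ}))))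
    count-bound (suc n) H sparse ∣H∣≤1+n = [ smaller , (λ ∣H∣≡ → peel n H ∣H∣≡ sparse (count-bound n)) ]′ (ℕ.m≤n⇒m<n∨m≡n ∣H∣≤1+n)
      where
      smaller : ∣ H ∣ ℕ.< suc n → CountBound q (harmonic (suc n)) H
      smaller ∣H∣<1+n A = ℚ.≤-trans (count-bound n H sparse (ℕ.≤-pred ∣H∣<1+n) A)
        (*-monoˡ (ℚ.<⇒≤ (0<total A)) (^-monoˡ ∣ A ∣ (0≤* (ℚ.<⇒≤ 0<β) (0≤harmonic n)) (*-monoˡ (ℚ.<⇒≤ 0<β) (≤-by-+ (0≤1/ (suc n)) refl))))

-- Graph isomorphisms as vertex permutations

lookup-injective : ∀ {A : Set} {xs : List A} → Unique xs → ∀ i j → List.lookup xs i ≡ List.lookup xs j → i ≡ j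
lookup-injective (x∉ ∷ u) zero    zero    eq = refl
lookup-injective (x∉ ∷ u) zero    (suc j) eq = contradiction eq (All.lookup x∉ (∈-lookup j))
lookup-injective (x∉ ∷ u) (suc i) zero    eq = contradiction (sym eq) (All.lookup x∉ (∈-lookup i))
lookup-injective (x∉ ∷ u) (suc i) (suc j) eq = cong suc (lookup-injective u i j eq)

transpose-to : ∀ {n} (i j : Fin n) → transpose i j ⟨$⟩ʳ i ≡ j
transpose-to i j rewrite dec-true (i Fin.≟ i) refl = refl

transpose-fixes : ∀ {n} {i j k : Fin n} → k ≢ i → k ≢ j → transpose i j ⟨$⟩ʳ k ≡ k
transpose-fixes {i = i} {j} {k} k≢i k≢j with k Fin.≟ i
... | yes k≡i = contradiction k≡i k≢i
... | no  _ with k Fin.≟ j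
...   | yes k≡j = contradiction k≡j k≢j
...   | no  _ = refl

-- An isomorphism speaks of non-isolated vertices, whereas a symmetry of the complete graph moves
-- all of them. Values are corrected one at a time: composing with the transposition of σ x and f x
-- repairs x, and an earlier u keeps its image, as σ u = σ x or f u = f x would force u = x.
permutation-extending : ∀ {n} {P : Pred (Fin n) 0ℓ} → Decidable P → (f : Fin n → Fin n) →
  (∀ u v → P u → P v → f u ≡ f v → u ≡ v) → ∃ λ (σ : Permutation′ n) → ∀ u → P u → σ ⟨$⟩ʳ u ≡ f u
permutation-extending {n} {P} P? f f-injective =
  let (σ , σ≗f) = extend (allFin n) in σ , λ u → σ≗f u (∈-allFin u)
  where
  extend : ∀ xs → ∃ λ (σ : Permutation′ n) → ∀ u → u ∈ˡ xs → P u → σ ⟨$⟩ʳ u ≡ f u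
  extend []       = Permutation.id , λ _ ()
  extend (x ∷ xs) with extend xs | P? x
  ... | σ , σ≗f | no ¬Px = σ , λ { u (here refl) Pu → contradiction Pu ¬Px ; u (there u∈) Pu → σ≗f u u∈ Pu }
  ... | σ , σ≗f | yes Px = σ ∘ₚ transpose (σ ⟨$⟩ʳ x) (f x) , agrees
    where
    agrees : ∀ u → u ∈ˡ x ∷ xs → P u → transpose (σ ⟨$⟩ʳ x) (f x) ⟨$⟩ʳ (σ ⟨$⟩ʳ u) ≡ f u
    agrees u u∈ Pu with u Fin.≟ x
    ... | yes refl = transpose-to (σ ⟨$⟩ʳ x) (f x)
    agrees u (here u≡x) Pu | no u≢x = contradiction u≡x u≢x
    agrees u (there u∈) Pu | no u≢x = trans
      (transpose-fixes
        (λ σu≡σx → u≢x (trans (sym (inverseˡ σ)) (trans (cong (σ ⟨$⟩ˡ_) σu≡σx) (inverseˡ σ))))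
        (λ σu≡fx → u≢x (f-injective u x Pu Px (trans (sym (σ≗f u u∈ Pu)) σu≡fx))))
      (σ≗f u u∈ Pu)

module VertexPermutations (n : ℕ) where

  private
    pair : Fin (length (edges n)) → Fin n × Fin n
    pair = List.lookup (edges n)

  pair-injective : ∀ {k l} → pair k ≡ pair l → k ≡ l
  pair-injective {k} {l} = lookup-injective
    (Unique.filter⁺ (λ (i , j) → i Fin.<? j) (Unique.cartesianProduct⁺ (Unique.allFin⁺ n) (Unique.allFin⁺ n))) k l

  pair-< : ∀ k → proj₁ (pair k) Fin.< proj₂ (pair k)
  pair-< k = proj₂ (∈-filter⁻ (λ (i , j) → i Fin.<? j) {xs = cartesianProduct (allFin n) (allFin n)} (∈-lookup k))

  <⇒pair : ∀ {u v} → u Fin.< v → ∃ λ k → pair k ≡ (u , v)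
  <⇒pair {u} {v} u<v = Any.index uv∈ , sym (lookup-index uv∈)
    where
    uv∈ : (u , v) ∈ˡ edges n
    uv∈ = ∈-filter⁺ (λ (i , j) → i Fin.<? j) (∈-cartesianProduct⁺ (∈-allFin u) (∈-allFin v)) u<v

  ≢⇒pair : ∀ {u v} → u ≢ v → ∃ λ k → pair k ≡ (u , v) ⊎ pair k ≡ (v , u)
  ≢⇒pair {u} {v} u≢v with Fin.<-cmp u v
  ... | tri< u<v _ _ = let (k , eq) = <⇒pair u<v in k , inj₁ eq
  ... | tri≈ _ u≡v _ = contradiction u≡v u≢v
  ... | tri> _ _ v<u = let (k , eq) = <⇒pair v<u in k , inj₂ eq

  Adj-sym : ∀ {G : Graph n} {u v} → Adj G u v → Adj G v u
  Adj-sym (k , k∈ , eq) = k , k∈ , Sum.swap eq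

  Adj-irrefl : ∀ {G : Graph n} {u v} → Adj G u v → u ≢ v
  Adj-irrefl (k , _ , eq) refl = Fin.<-irrefl refl (subst (λ (i , j) → i Fin.< j) (Sum.[ (λ p → p) , (λ p → p) ]′ eq) (pair-< k))

  ∈⇒Adj : ∀ {S : EdgeSet n} {k} → k ∈ S → Adj (graph S) (proj₁ (pair k)) (proj₂ (pair k))
  ∈⇒Adj {k = k} k∈S = k , k∈S , inj₁ refl

  Adj⇒∈ : ∀ {S : EdgeSet n} {k} → Adj (graph S) (proj₁ (pair k)) (proj₂ (pair k)) → k ∈ S
  Adj⇒∈ {S} {k} (l , l∈S , inj₁ eq) = subst (_∈ S) (pair-injective eq) l∈S
  -- The reversed pair is impossible because `edges` lists increasing pairs.
  Adj⇒∈ {S} {k} (l , l∈S , inj₂ eq) = ⊥-elim (Fin.<-asym (pair-< k) (subst (λ (i , j) → i Fin.< j) eq (pair-< l)))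

  Adj-⊆ : ∀ {S T : EdgeSet n} → S ⊆ T → ∀ {u v : Fin n} → Adj (graph S) u v → Adj (graph T) u v
  Adj-⊆ S⊆T (k , k∈S , eq) = k , S⊆T k∈S , eq

  ⊆-Adj : ∀ {S T : EdgeSet n} → (∀ {u v} → Adj (graph S) u v → Adj (graph T) u v) → S ⊆ T
  ⊆-Adj {S} {T} S⇒T {k} k∈S = Adj⇒∈ {T} {k} (S⇒T (∈⇒Adj {S} {k} k∈S))

  -- Pulling back makes membership of an edge a single adjacency test, where an image would have to
  -- be searched. Pushing forward along a permutation is pulling back along its inverse.
  preimage : (Fin n → Fin n) → EdgeSet n → EdgeSet n
  preimage g S = Vec.tabulate λ k → does (adj? (graph S) (g (proj₁ (pair k))) (g (proj₂ (pair k))))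

  module _ (g : Fin n → Fin n) (S : EdgeSet n) where

    Adj-preimage⁻ : ∀ {u v} → Adj (graph (preimage g S)) u v → Adj (graph S) (g u) (g v)
    Adj-preimage⁻ {u} {v} (k , k∈ , eq) with adj? (graph S) (g (proj₁ (pair k))) (g (proj₂ (pair k))) in adj≡
    ... | yes adj = [adj] eq
      where
      [adj] : ∀ {u v} → pair k ≡ (u , v) ⊎ pair k ≡ (v , u) → Adj (graph S) (g u) (g v)
      [adj] (inj₁ eq) = subst (λ (i , j) → Adj (graph S) (g i) (g j)) eq adj
      [adj] (inj₂ eq) = Adj-sym (subst (λ (i , j) → Adj (graph S) (g i) (g j)) eq adj)
    ... | no _ with trans (sym (Vec.[]=⇒lookup k∈)) (trans (Vec.lookup∘tabulate _ k) (cong does adj≡))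
    ...   | ()

    Adj-preimage⁺ : ∀ {u v} → Adj (graph S) (g u) (g v) → Adj (graph (preimage g S)) u v
    Adj-preimage⁺ {u} {v} adj = let (k , eq) = ≢⇒pair (Adj-irrefl adj ∘ cong g) in k , k∈ k eq , eq
      where
      k∈ : ∀ k → pair k ≡ (u , v) ⊎ pair k ≡ (v , u) → k ∈ preimage g S
      k∈ k eq = Vec.lookup⇒[]= k (preimage g S) (trans (Vec.lookup∘tabulate _ k) (dec-true (adj? (graph S) (g (proj₁ (pair k))) (g (proj₂ (pair k)))) (adj′ eq)))
        where
        adj′ : pair k ≡ (u , v) ⊎ pair k ≡ (v , u) → Adj (graph S) (g (proj₁ (pair k))) (g (proj₂ (pair k)))
        adj′ (inj₁ eq) = subst (λ (i , j) → Adj (graph S) (g i) (g j)) (sym eq) adj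
        adj′ (inj₂ eq) = subst (λ (i , j) → Adj (graph S) (g i) (g j)) (sym eq) (Adj-sym adj)

  preimage-inverse : ∀ {g h : Fin n → Fin n} → (∀ u → h (g u) ≡ u) → ∀ S → preimage g (preimage h S) ≡ S
  preimage-inverse {g} {h} hg S = ⊆-antisym
    (⊆-Adj λ adj → subst₂ (Adj (graph S)) (hg _) (hg _) (Adj-preimage⁻ h S (Adj-preimage⁻ g (preimage h S) adj)))
    (⊆-Adj λ adj → Adj-preimage⁺ g (preimage h S) (Adj-preimage⁺ h S (subst₂ (Adj (graph S)) (sym (hg _)) (sym (hg _)) adj)))

  preimage-mono : ∀ {g : Fin n → Fin n} {S T} → S ⊆ T → preimage g S ⊆ preimage g T
  preimage-mono {g} {S} {T} S⊆T = ⊆-Adj λ adj → Adj-preimage⁺ g T (Adj-⊆ {S} {T} S⊆T (Adj-preimage⁻ g S adj))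

  -- These conditions range over all vertices with no case for isolated ones, so inverses and
  -- composites are immediate, in contrast to `IsIsomorphism`.
  record Carries (σ : Permutation′ n) (G H : Graph n) : Set where
    field
      forth : ∀ {u v} → Adj G u v → Adj H (σ ⟨$⟩ʳ u) (σ ⟨$⟩ʳ v)
      back  : ∀ {u v} → Adj H (σ ⟨$⟩ʳ u) (σ ⟨$⟩ʳ v) → Adj G u v

  open Carries

  carries⇒≅ : ∀ {σ G H} → Carries σ G H → G ≅ H
  carries⇒≅ {σ} {G} {H} c = Vec.tabulate (σ ⟨$⟩ʳ_) , record
    { maps       = λ u (v , adj) → σ ⟨$⟩ʳ v , subst (λ w → Adj H w (σ ⟨$⟩ʳ v)) (sym (f≗σ u)) (forth c adj)
    ; injective  = λ u v _ _ eq → trans (sym (inverseˡ σ)) (trans (cong (σ ⟨$⟩ˡ_) (trans (sym (f≗σ u)) (trans eq (f≗σ v)))) (inverseˡ σ))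
    ; surjective = λ w (v , adj) → σ ⟨$⟩ˡ w
        , (σ ⟨$⟩ˡ v , back c (subst₂ (Adj H) (sym (inverseʳ σ)) (sym (inverseʳ σ)) adj))
        , trans (f≗σ (σ ⟨$⟩ˡ w)) (inverseʳ σ)
    ; preserves  = λ u v _ _ adj → subst₂ (Adj H) (sym (f≗σ u)) (sym (f≗σ v)) (forth c adj)
    ; reflects   = λ u v _ _ adj → back c (subst₂ (Adj H) (f≗σ u) (f≗σ v) adj)
    }
    where
    f≗σ : ∀ u → Vec.lookup (Vec.tabulate (σ ⟨$⟩ʳ_)) u ≡ σ ⟨$⟩ʳ u
    f≗σ = Vec.lookup∘tabulate (σ ⟨$⟩ʳ_)

  ≅⇒carries : ∀ {G H} → G ≅ H → ∃ λ σ → Carries σ G H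
  ≅⇒carries {G} {H} (fᵛ , iso) = σ , record { forth = forthσ ; back = backσ }
    where
    open IsIsomorphism iso
    f = Vec.lookup fᵛ
    extension = permutation-extending (isVertex? G) f injective
    σ = proj₁ extension
    σ≗f = proj₂ extension
    forthσ : ∀ {u v} → Adj G u v → Adj H (σ ⟨$⟩ʳ u) (σ ⟨$⟩ʳ v)
    forthσ {u} {v} adj = subst₂ (Adj H) (sym (σ≗f u Gu)) (sym (σ≗f v Gv)) (preserves u v Gu Gv adj)
      where
      Gu = v , adj
      Gv = u , Adj-sym adj
    -- By surjectivity σ u is the f-image of some vertex of G, where σ agrees with f; injectivity of
    -- σ identifies that vertex with u.
    vertex : ∀ {u} → IsVertex H (σ ⟨$⟩ʳ u) → IsVertex G u
    vertex {u} Hσu with surjective (σ ⟨$⟩ʳ u) Hσu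
    ... | u′ , Gu′ , fu′≡σu = subst (IsVertex G)
      (trans (sym (inverseˡ σ)) (trans (cong (σ ⟨$⟩ˡ_) (trans (σ≗f u′ Gu′) fu′≡σu)) (inverseˡ σ))) Gu′
    backσ : ∀ {u v} → Adj H (σ ⟨$⟩ʳ u) (σ ⟨$⟩ʳ v) → Adj G u v
    backσ {u} {v} adj = reflects u v Gu Gv (subst₂ (Adj H) (σ≗f u Gu) (σ≗f v Gv) adj)
      where
      Gu = vertex (_ , adj)
      Gv = vertex (_ , Adj-sym adj)

  carries-flip : ∀ {σ G H} → Carries σ G H → Carries (flip σ) H G
  carries-flip {σ} {G} {H} c = record
    { forth = λ adj → back c (subst₂ (Adj H) (sym (inverseʳ σ)) (sym (inverseʳ σ)) adj)
    ; back  = λ adj → subst₂ (Adj H) (inverseʳ σ) (inverseʳ σ) (forth c adj)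
    }

  carries-∘ : ∀ {σ τ G H I} → Carries σ G H → Carries τ H I → Carries (σ ∘ₚ τ) G I
  carries-∘ c d = record { forth = forth d ∘ forth c ; back = back c ∘ back d }

  preimage-carries : ∀ σ S → Carries σ (graph (preimage (σ ⟨$⟩ʳ_) S)) (graph S)
  preimage-carries σ S = record { forth = Adj-preimage⁻ (σ ⟨$⟩ʳ_) S ; back = Adj-preimage⁺ (σ ⟨$⟩ʳ_) S }

  graphIsomorphism : Isomorphism (length (edges n))
  graphIsomorphism = record
    { _~_          = λ A B → graph A ≅ graph B
    ; _~?_         = λ A B → graph A ≅? graph B
    ; ~-refl       = λ {A} → ≅-refl (graph A)
    ; ~-sym        = λ A≅B → carries⇒≅ (carries-flip (proj₂ (≅⇒carries A≅B)))
    ; ~-trans      = λ A≅B B≅C → carries⇒≅ (carries-∘ (proj₂ (≅⇒carries A≅B)) (proj₂ (≅⇒carries B≅C)))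
    ; automorphism = λ {A} {B} A≅B → let (σ , c) = ≅⇒carries A≅B in
        record
          { to        = preimage (σ ⟨$⟩ˡ_)
          ; from      = preimage (σ ⟨$⟩ʳ_)
          ; from-to   = preimage-inverse {σ ⟨$⟩ʳ_} {σ ⟨$⟩ˡ_} (λ u → inverseˡ σ)
          ; to-from   = preimage-inverse {σ ⟨$⟩ˡ_} {σ ⟨$⟩ʳ_} (λ u → inverseʳ σ)
          ; to-mono   = preimage-mono {σ ⟨$⟩ˡ_}
          ; from-mono = preimage-mono {σ ⟨$⟩ʳ_}
          ; to-~      = λ S → carries⇒≅ (preimage-carries (flip σ) S)
          }
        , ⊆-antisym
            (⊆-Adj λ adj → subst₂ (Adj (graph B)) (inverseʳ σ) (inverseʳ σ) (Carries.forth c (Adj-preimage⁻ (σ ⟨$⟩ˡ_) A adj)))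
            (⊆-Adj λ adj → Adj-preimage⁺ (σ ⟨$⟩ˡ_) A (Carries.back c (subst₂ (Adj (graph B)) (sym (inverseʳ σ)) (sym (inverseʳ σ)) adj)))
    }

-- Measures and nonnegative reals

sumℚ-++ : ∀ xs ys → sumℚ (xs ++ ys) ≡ sumℚ xs + sumℚ ys
sumℚ-++ []       ys = sym (ℚ.+-identityˡ (sumℚ ys))
sumℚ-++ (x ∷ xs) ys = trans (cong (x +_) (sumℚ-++ xs ys)) (sym (ℚ.+-assoc x (sumℚ xs) (sumℚ ys)))

sumℚ-subsets : ∀ {m} (f : Subset m → ℚ) → sumℚ (map f (subsets m)) ≡ Σ f
sumℚ-subsets {zero}  f = ℚ.+-identityʳ (f [])
sumℚ-subsets {suc m} f = begin
  sumℚ (map f (map (false ∷_) (subsets m) ++ map (true ∷_) (subsets m)))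
    ≡⟨ cong sumℚ (List.map-++ f (map (false ∷_) (subsets m)) (map (true ∷_) (subsets m))) ⟩
  sumℚ (map f (map (false ∷_) (subsets m)) ++ map f (map (true ∷_) (subsets m)))
    ≡⟨ sumℚ-++ (map f (map (false ∷_) (subsets m))) (map f (map (true ∷_) (subsets m))) ⟩
  sumℚ (map f (map (false ∷_) (subsets m))) + sumℚ (map f (map (true ∷_) (subsets m)))
    ≡⟨ sym (cong₂ (λ xs ys → sumℚ xs + sumℚ ys) (List.map-∘ (subsets m)) (List.map-∘ (subsets m))) ⟩
  sumℚ (map (f ∘ (false ∷_)) (subsets m)) + sumℚ (map (f ∘ (true ∷_)) (subsets m))
    ≡⟨ cong₂ _+_ (sumℚ-subsets (f ∘ (false ∷_))) (sumℚ-subsets (f ∘ (true ∷_))) ⟩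
  Σ f ∎
  where open ≡-Reasoning

sumℚ-graphs : ∀ {n} (f : Graph n → ℚ) → sumℚ (map f (graphs n)) ≡ Σ (f ∘ graph)
sumℚ-graphs {n} f = trans (sym (cong sumℚ (List.map-∘ (subsets (length (edges n)))))) (sumℚ-subsets (f ∘ graph))

sumℚ-filter : {A : Set} {P : Pred A 0ℓ} (P? : Decidable P) (f : A → ℚ) (xs : List A) →
  sumℚ (map f (filter P? xs)) ≡ sumℚ (map (λ x → 𝟙 (P? x) · f x) xs)
sumℚ-filter P? f []       = refl
sumℚ-filter P? f (x ∷ xs) with P? x
... | yes _ = cong₂ _+_ (sym (ℚ.*-identityˡ (f x))) (sumℚ-filter P? f xs)
... | no  _ = trans (sumℚ-filter P? f xs) (sym (trans (cong (_+ rest) (ℚ.*-zeroˡ (f x))) (ℚ.+-identityˡ rest)))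
  where rest = sumℚ (map (λ x → 𝟙 (P? x) · f x) xs)

if≡𝟙* : {P : Set} (P? : Dec P) (p : ℚ) → (if does P? then p else 0ℚ) ≡ 𝟙 P? · p
if≡𝟙* (yes _) p = sym (ℚ.*-identityˡ p)
if≡𝟙* (no _)  p = sym (ℚ.*-zeroˡ p)

-- The two equations say μ = x / h = c / a with the denominators cleared.
ratio-bound : ∀ {μ h a x c p} → 0ℚ < h → 0ℚ < a → μ · h ≡ x → x · a ≡ h · c → c ≤ a · p → μ ≤ p
ratio-bound {μ} {h} {a} {x} {c} {p} 0<h 0<a μh≡x xa≡hc c≤ap = *-cancelˡ (0<* 0<h 0<a) (begin
  h · a · μ      ≡⟨ solve 3 (λ h a m → h :* a :* m := m :* h :* a) refl h a μ ⟩
  μ · h · a      ≡⟨ trans (cong (_· a) μh≡x) xa≡hc ⟩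
  h · c          ≤⟨ *-monoˡ (ℚ.<⇒≤ 0<h) c≤ap ⟩
  h · (a · p)    ≡⟨ sym (ℚ.*-assoc h a p) ⟩
  h · a · p      ∎)
  where open ℚ.≤-Reasoning

module _ {n : ℕ} where

  open Counting (VertexPermutations.graphIsomorphism n)

  isCopy-K : ∀ (H S : Graph n) → 𝟙 (isCopy? H (K n) S) ≡ 𝟙 (S ≅? H)
  isCopy-K H S = 𝟙-⇔ (isCopy? H (K n) S) (S ≅? H) proj₂ (λ S≅H → ⊆-max (E S) , S≅H)

  #copies≡total : ∀ (H : Graph n) → fromℕ (#copies H (K n)) ≡ total (E H)
  #copies≡total H = begin
    fromℕ (#copies H (K n))                        ≡⟨ sym (ℚ.*-identityʳ _) ⟩
    fromℕ (#copies H (K n)) · 1ℚ                   ≡⟨ sym (sum-indicator (isCopy? H (K n)) 1ℚ (graphs n)) ⟩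
    sumℚ (map (λ S → 𝟙 (isCopy? H (K n) S)) (graphs n))  ≡⟨ sumℚ-graphs (λ S → 𝟙 (isCopy? H (K n) S)) ⟩
    Σ (λ S → 𝟙 (isCopy? H (K n) (graph S)))        ≡⟨ Σ-cong (λ S → isCopy-K H (graph S)) ⟩
    total (E H)                                    ∎
    where open ≡-Reasoning

  measure-⊇ : ∀ (H : Graph n) (A : EdgeSet n) → measure (ν H) (λ S → A ⊆? E S) · total (E H) ≡ extensions (E H) A
  measure-⊇ H A = begin
    measure (ν H) (λ S → A ⊆? E S) · total (E H)
      ≡⟨ cong (_· total (E H)) (trans (sumℚ-filter (λ S → A ⊆? E S) (mass (ν H)) (graphs n)) (sumℚ-graphs (λ S → 𝟙 (A ⊆? E S) · mass (ν H) S))) ⟩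
    Σ (λ S → 𝟙 (A ⊆? S) · mass (ν H) (graph S)) · total (E H)
      ≡⟨ cong (_· total (E H)) (trans (Σ-cong term) (Σ-*ʳ p (λ S → 𝟙 (graph S ≅? H) · 𝟙 (A ⊆? S)))) ⟩
    extensions (E H) A · p · total (E H)
      ≡⟨ solve 3 (λ x p t → x :* p :* t := x :* (t :* p)) refl (extensions (E H) A) p (total (E H)) ⟩
    extensions (E H) A · (total (E H) · p)
      ≡⟨ cong (λ t → extensions (E H) A · (t · p)) (sym (#copies≡total H)) ⟩
    extensions (E H) A · (fromℕ (#copies H (K n)) · p)
      ≡⟨ cong (extensions (E H) A ·_) (fromℕ*1/ (#copies H (K n))) ⟩
    extensions (E H) A · 1ℚ
      ≡⟨ ℚ.*-identityʳ _ ⟩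
    extensions (E H) A ∎
    where
    open ≡-Reasoning
    instance _ = #copies-nonZero H
    p : ℚ
    p = ℤ.+ 1 ℚ./ #copies H (K n)
    term : ∀ S → 𝟙 (A ⊆? S) · mass (ν H) (graph S) ≡ 𝟙 (graph S ≅? H) · 𝟙 (A ⊆? S) · p
    term S = trans (cong (𝟙 (A ⊆? S) ·_) (trans (if≡𝟙* (isCopy? H (K n) (graph S)) p) (cong (_· p) (isCopy-K H (graph S)))))
      (solve 3 (λ a i p → a :* (i :* p) := i :* a :* p) refl (𝟙 (A ⊆? S)) (𝟙 (graph S ≅? H)) p)

  measure-bound : ∀ {q₀} (H : Graph n) (A : EdgeSet n) → 0ℚ < q₀ → Sparse q₀ (E H) →
    measure (ν H) (λ S → A ⊆? E S) ≤ (β q₀ · harmonic (e H)) ^ ∣ A ∣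
  measure-bound {q₀} H A 0<q₀ sparse = ratio-bound {measure (ν H) (λ S → A ⊆? E S)} {a = total A} {c = count A (E H)} (0<total (E H)) (0<total A) (measure-⊇ H A)
    (extensions*total≡total*count (E H) A) (count-bound 0<q₀ (e H) (E H) sparse ℕ.≤-refl A)

  Above-maxᴿ : ∀ {xs x r} → x ∈ˡ xs → Above (maxᴿ xs) r → Above x r
  Above-maxᴿ {x ∷ xs} (here refl) (s , (x<s , _) , s<r)  = ℝ≥0.upward x x<s (ℚ.<⇒≤ s<r)
  Above-maxᴿ {y ∷ xs} {x} (there x∈) (s , (_ , max<s) , s<r) = ℝ≥0.upward x (Above-maxᴿ x∈ max<s) (ℚ.<⇒≤ s<r)

  -- A rational above the maximum lies above each root N_J^(-1/e(J)), hence above some s with N_J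
  -- s^e(J) ≥ 1.
  Above-q⇒sparse : ∀ {q₀} (H : Graph n) → Above (q H) q₀ → Sparse q₀ (E H)
  Above-q⇒sparse {q₀} H q<q₀ J J⊆H = [ nonempty⇒ , empty⇒ ]′ (toSum (nonempty? J))
    where
    empty⇒ : ¬ Nonempty J → 1ℚ ≤ total J · q₀ ^ ∣ J ∣
    empty⇒ empty = subst (λ k → 1ℚ ≤ total J · q₀ ^ k) (sym (trans (cong ∣_∣ (Empty-unique empty)) (∣⊥∣≡0 (length (edges n)))))
      (subst (1ℚ ≤_) (sym (ℚ.*-identityʳ (total J))) (1≤total J))
    root : Graph n → ℝ≥0
    root I = let instance _ = #copies-nonZero I in #copies I (K n) ^-1/ e I
    above⇒ : Above (root (graph J)) q₀ → 1ℚ ≤ total J · q₀ ^ ∣ J ∣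
    above⇒ (s , (0≤s , 1≤) , s<q₀) = ℚ.≤-trans
      (subst (λ t → 1ℚ ≤ t · s ^ ∣ J ∣) (#copies≡total (graph J)) 1≤)
      (*-monoˡ (ℚ.<⇒≤ (0<total J)) (^-monoˡ ∣ J ∣ 0≤s (ℚ.<⇒≤ s<q₀)))
    nonempty⇒ : Nonempty J → 1ℚ ≤ total J · q₀ ^ ∣ J ∣
    nonempty⇒ nonempty = above⇒ (Above-maxᴿ
      (∈-map⁺ root (∈-filter⁺ (λ I → nonempty? (E I) ×-dec (E I ⊆? E H)) (∈-map⁺ graph (∈-subsets J)) (nonempty , J⊆H))) q<q₀)

-- A rational above x^k dominates a product of k rationals above x that may all differ; the smallest
-- of them serves as s.
Above-^ᴿ : ∀ x k {r} → Above (x ^ᴿ k) r → ∃ λ s → Above x s × s ^ k ≤ r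
Above-^ᴿ x zero    (_ , refl , 1<r) = let (s , x<s) = ℝ≥0.inhabited x in s , x<s , ℚ.<⇒≤ 1<r
Above-^ᴿ x (suc k) (_ , (s , t , x<s , xᵏ<t , refl) , st<r) with Above-^ᴿ x k xᵏ<t
... | s′ , x<s′ , s′ᵏ≤t with ℚ.≤-total s s′
...   | inj₁ s≤s′ = s , x<s , ℚ.≤-trans (*-monoˡ 0≤s (ℚ.≤-trans (^-monoˡ k 0≤s s≤s′) s′ᵏ≤t)) (ℚ.<⇒≤ st<r)
  where 0≤s = ℚ.<⇒≤ (ℝ≥0.>0 x x<s)
...   | inj₂ s′≤s = s′ , x<s′ , ℚ.≤-trans (*-mono 0≤s′ (ℚ.<⇒≤ (ℝ≥0.>0 (x ^ᴿ k) xᵏ<t)) s′≤s s′ᵏ≤t) (ℚ.<⇒≤ st<r)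
  where 0≤s′ = ℚ.<⇒≤ (ℝ≥0.>0 x x<s′)

Above-log⇒harmonic : ∀ N .{{_ : ℕ.NonZero N}} {l} → Above (log (2 ℕ.* N)) l → harmonic N ≤ 4ℚ · l
Above-log⇒harmonic N (s , (0≤s , k , 2N≤exp) , s<l) = ℚ.≤-trans (harmonic≤4s N k 0≤s 2N≤exp) (*-monoˡ (0≤fromℕ 4) (ℚ.<⇒≤ s<l))

-- The constant 12 · 256 is that of `β`, and 4 is the price of passing from harmonic numbers to the
-- logarithm.
C₀ : ℚ
C₀ = 12ℚ · 256ℚ · 4ℚ

0<C₀ : 0ℚ < C₀
0<C₀ = 0<* (0<* (0<fromℕ 12) (0<fromℕ 256)) (0<fromℕ 4)

e-nonZero : ∀ {n} (H : Graph n) → NonemptyGraph H → ℕ.NonZero (e H)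
e-nonZero H (x , x∈H) = ℕ.>-nonZero (ℕ.≤-<-trans ℕ.z≤n (x∈p⇒∣p-x∣<∣p∣ x∈H))

Above-fromℚ : ∀ {p r} (0≤p : 0ℚ ≤ p) → Above (fromℚ p 0≤p) r → p ≤ r
Above-fromℚ 0≤p (_ , refl , p<r) = ℚ.<⇒≤ p<r

Above-*ᴿ³ : ∀ {x y z r} → Above (x *ᴿ y *ᴿ z) r →
  ∃ λ s → ∃ λ t → ∃ λ u → Above x s × Above y t × Above z u × s · t · u ≤ r
Above-*ᴿ³ {z = z} (_ , (v , u , (_ , (s , t , x<s , y<t , refl) , st<v) , z<u , refl) , vu<r) =
  s , t , u , x<s , y<t , z<u , ℚ.≤-trans (*-monoʳ (ℚ.<⇒≤ (ℝ≥0.>0 z z<u)) (ℚ.<⇒≤ st<v)) (ℚ.<⇒≤ vu<r)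

β-bound : ∀ {c q₀ h l} → C₀ ≤ c → 0ℚ ≤ q₀ → 0ℚ ≤ l → h ≤ 4ℚ · l → 12ℚ · 256ℚ · q₀ · h ≤ c · q₀ · l
β-bound {c} {q₀} {h} {l} C≤c 0≤q₀ 0≤l h≤4l = begin
  12ℚ · 256ℚ · q₀ · h            ≤⟨ *-monoˡ (0≤* (0≤* (0≤fromℕ 12) (0≤fromℕ 256)) 0≤q₀) h≤4l ⟩
  12ℚ · 256ℚ · q₀ · (4ℚ · l)     ≡⟨ solve 5 (λ a b q c l → a :* b :* q :* (c :* l) := a :* b :* c :* q :* l) refl 12ℚ 256ℚ q₀ 4ℚ l ⟩
  C₀ · q₀ · l              ≤⟨ *-monoʳ 0≤l (*-monoʳ 0≤q₀ C≤c) ⟩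
  c · q₀ · l                     ∎
  where open ℚ.≤-Reasoning

0≤C₀ : 0ℚ ≤ C₀
0≤C₀ = ℚ.<⇒≤ 0<C₀

Cᴿ : ℝ≥0
Cᴿ = fromℚ C₀ 0≤C₀

-- Every rational r above the right side dominates s^∣A∣ for some s that is at least c q₀ l, with c,
-- q₀, l rationals above the three factors. This reduces the claim to `measure-bound` for q₀.
spread : ∀ (n : ℕ) (H : Graph n) → NonemptyGraph H → Spread (ν H) (Cᴿ *ᴿ q H *ᴿ log (2 ℕ.* e H))
spread n H nonempty A _ r above =
  let s , x<s , sᴬ≤r = Above-^ᴿ (Cᴿ *ᴿ q H *ᴿ log (2 ℕ.* e H)) ∣ A ∣ above
      c , q₀ , l , C<c , q<q₀ , log<l , cql≤s = Above-*ᴿ³ {Cᴿ} {q H} {log (2 ℕ.* e H)} x<s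
      0<q₀ = ℝ≥0.>0 (q H) q<q₀
      0≤l = ℚ.<⇒≤ (ℝ≥0.>0 (log (2 ℕ.* e H)) log<l)
      h≤4l = Above-log⇒harmonic (e H) {{e-nonZero H nonempty}} log<l
  in ℚ.≤-trans (measure-bound H A 0<q₀ (Above-q⇒sparse H q<q₀))
      (ℚ.≤-trans (^-monoˡ ∣ A ∣ (0≤* (0≤* (0≤* (0≤fromℕ 12) (0≤fromℕ 256)) (ℚ.<⇒≤ 0<q₀)) (0≤harmonic (e H)))
        (ℚ.≤-trans (β-bound (Above-fromℚ 0≤C₀ C<c) (ℚ.<⇒≤ 0<q₀) 0≤l h≤4l) cql≤s)) sᴬ≤r)

theorem1p1 : ∃ λ (C : ℝ≥0) → Positiveᴿ C ×
    (∀ (n : ℕ) (H : Graph n) → NonemptyGraph H →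
    Spread (ν H) (C *ᴿ q H *ᴿ log (2 * e H)))
theorem1p1 = Cᴿ , (C₀ , 0<C₀ , λ r → Above-fromℚ 0≤C₀) , spread
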